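{- Let $\ell>2$ be prime and let $\mathbf{F}=(F_1,F_2)$ be a $2$-dimensional symmetric formal group law over $\mathbb{Z}_\ell$ of height $4$ whose exponent $r$ equals $2$. Then the wild inertia group $I_{\mathrm{wild}}\subset\mathrm{Gal}(\overline{\mathbb{Q}}_\ell/\mathbb{Q}_\ell)$ acts trivially on the $\mathbb{F}_\ell$-vector space of $\ell$-torsion points of $\mathbf{F}(\overline{\mathfrak{m}})$.
   Context: $v$ is the valuation on $\overline{\mathbb{Q}}_\ell$ with $v(\ell)=1$, $\overline{\mathfrak{m}}=\{x:v(x)>0\}$, and $\mathbf{F}(\overline{\mathfrak{m}})$ is $\overline{\mathfrak{m}}\times\overline{\mathfrak{m}}$ with the group law given by $\mathbf{F}$, with Galois action coordinatewise. The formal group law is symmetric if $F_2(X_2,X_1,Y_2,Y_1)=F_1(X_1,X_2,Y_1,Y_2)$. The multiplication-by-$\ell$ series $[\ell]=([\ell]_1,[\ell]_2)$ is defined by $[1](\mathbf{Z})=\mathbf{Z}$, $[m+1](\mathbf{Z})=\mathbf{F}(\mathbf{Z},[m](\mathbf{Z}))$. The height of $\mathbf{F}$ is $h$ with $\ell^h=\dim_{\mathbb{F}_\ell}\mathbb{F}_\ell[[Z_1,Z_2]]/\langle\overline{[\ell]}_1,\overline{[\ell]}_2\rangle$, where bars denote reduction mod $\ell$. The exponent $r$ of $\mathbf{F}$ is the largest integer $r$ such that both $\overline{[\ell]}_1,\overline{[\ell]}_2$ lie in $\mathbb{F}_\ell[[Z_1^{\ell^r},Z_2^{\ell^r}]]$.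 -}

module Defs where

open import Algebra.Bundles using (RawRing; CommutativeRing)
import Algebra.Definitions.RawSemiring as RawSemiringDefs
open import Algebra.Morphism.Structures using (module RingMorphisms)
open import Data.Bool.Base using (if_then_else_)
open import Data.Fin.Base using (Fin; zero; suc; toℕ; _↑ˡ_; _↑ʳ_)
open import Data.Integer.Base as ℤ using (ℤ; +_)
open import Data.Integer.Divisibility.Signed
  using (_∣_; divides; ∣m∣n⇒∣m+n; ∣m⇒∣-m; ∣n⇒∣m*n; ∣m⇒∣m*n)
import Data.Integer.Properties as ℤ
open import Data.Integer.Tactic.RingSolver using (solve-∀)
open import Data.List.Base using (List; _∷_; []; foldr; upTo; cartesianProductWith)
open import Data.Nat.Base as ℕ using (ℕ; zero; suc; _^_; _≤_)
import Data.Nat.Divisibility as ℕ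
import Data.Nat.Properties as ℕ
open import Data.Product.Base using (Σ; ∃-syntax; _×_; _,_)
open import Data.Rational.Base as ℚ using (ℚ; 0ℚ; 1ℚ)
open import Data.Vec.Base as Vec using (Vec; []; _∷_; _[_]≔_)
import Data.Vec.Properties as Vec
open import Data.Vec.Functional using (Vector; _++_)
open import Function.Base using (_∘_)
open import Function.Bundles using (_⇔_)
open import Level using (Level; Lift; _⊔_; 0ℓ) renaming (suc to lsuc)
import Relation.Binary.Construct.Add.Supremum.NonStrict as NonStrict
import Relation.Binary.Construct.Add.Supremum.Strict as Strict
open import Relation.Binary.PropositionalEquality.Core using (_≡_; refl; subst)
open import Relation.Nullary.Construct.Add.Supremum using (_⁺; [_]; ⊤⁺)
open import Relation.Nullary.Decidable.Core using (does)
open import Relation.Nullary.Negation.Core using (¬_)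

private variable
  a c e : Level
  d n k : ℕ

infix 4 _≡_[mod_]

record _≡_[mod_] (x y : ℤ) (m : ℕ) : Set where
  constructor congruent
  field divides-difference : + m ∣ x ℤ.- y

module _ {m : ℕ} where

  private
    recast : ∀ {x y z} → z ≡ x ℤ.- y → + m ∣ z → x ≡ y [mod m ]
    recast eq p = congruent (subst (+ m ∣_) eq p)

  mod-reflexive : ∀ {x y} → x ≡ y → x ≡ y [mod m ]
  mod-reflexive {x} refl = congruent (divides (+ 0) (ℤ.+-inverseʳ x))

  mod-sym : ∀ {x y} → x ≡ y [mod m ] → y ≡ x [mod m ]
  mod-sym {x} {y} (congruent p) = recast (lemma x y) (∣m⇒∣-m p)
    where
    lemma : ∀ x y → ℤ.- (x ℤ.- y) ≡ y ℤ.- x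
    lemma = solve-∀

  mod-trans : ∀ {x y z} → x ≡ y [mod m ] → y ≡ z [mod m ] → x ≡ z [mod m ]
  mod-trans {x} {y} {z} (congruent p) (congruent q) =
    recast (lemma x y z) (∣m∣n⇒∣m+n p q)
    where
    lemma : ∀ x y z → (x ℤ.- y) ℤ.+ (y ℤ.- z) ≡ x ℤ.- z
    lemma = solve-∀

  mod-+ : ∀ {x y u w} → x ≡ y [mod m ] → u ≡ w [mod m ] →
          x ℤ.+ u ≡ y ℤ.+ w [mod m ]
  mod-+ {x} {y} {u} {w} (congruent p) (congruent q) =
    recast (lemma x y u w) (∣m∣n⇒∣m+n p q)
    where
    lemma : ∀ x y u w → (x ℤ.- y) ℤ.+ (u ℤ.- w) ≡ (x ℤ.+ u) ℤ.- (y ℤ.+ w)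
    lemma = solve-∀

  mod-* : ∀ {x y u w} → x ≡ y [mod m ] → u ≡ w [mod m ] →
          x ℤ.* u ≡ y ℤ.* w [mod m ]
  mod-* {x} {y} {u} {w} (congruent p) (congruent q) =
    recast (lemma x y u w) (∣m∣n⇒∣m+n (∣m⇒∣m*n u p) (∣n⇒∣m*n y q))
    where
    lemma : ∀ x y u w →
            (x ℤ.- y) ℤ.* u ℤ.+ y ℤ.* (u ℤ.- w) ≡ (x ℤ.* u) ℤ.- (y ℤ.* w)
    lemma = solve-∀

  mod-neg : ∀ {x y} → x ≡ y [mod m ] → ℤ.- x ≡ ℤ.- y [mod m ]
  mod-neg {x} {y} (congruent p) = recast (lemma x y) (∣m⇒∣-m p)
    where
    lemma : ∀ x y → ℤ.- (x ℤ.- y) ≡ (ℤ.- x) ℤ.- (ℤ.- y)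
    lemma = solve-∀

ℤ/ : ℕ → CommutativeRing 0ℓ 0ℓ
ℤ/ m = record
  { Carrier = ℤ
  ; _≈_ = _≡_[mod m ]
  ; _+_ = ℤ._+_
  ; _*_ = ℤ._*_
  ; -_  = ℤ.-_
  ; 0#  = + 0
  ; 1#  = + 1
  ; isCommutativeRing = record
    { isRing = record
      { +-isAbelianGroup = record
        { isGroup = record
          { isMonoid = record
            { isSemigroup = record
              { isMagma = record
                { isEquivalence = record
                  { refl = mod-reflexive refl ; sym = mod-sym ; trans = mod-trans }
                ; ∙-cong = mod-+
                }
              ; assoc = λ x y z → mod-reflexive (ℤ.+-assoc x y z)
              }
            ; identity = mod-reflexive ∘ ℤ.+-identityˡ , mod-reflexive ∘ ℤ.+-identityʳ
            }
          ; inverse = mod-reflexive ∘ ℤ.+-inverseˡ , mod-reflexive ∘ ℤ.+-inverseʳ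
          ; ⁻¹-cong = mod-neg
          }
        ; comm = λ x y → mod-reflexive (ℤ.+-comm x y)
        }
      ; *-cong = mod-*
      ; *-assoc = λ x y z → mod-reflexive (ℤ.*-assoc x y z)
      ; *-identity = mod-reflexive ∘ ℤ.*-identityˡ , mod-reflexive ∘ ℤ.*-identityʳ
      ; distrib = (λ x y z → mod-reflexive (ℤ.*-distribˡ-+ x y z))
                , (λ x y z → mod-reflexive (ℤ.*-distribʳ-+ x y z))
      }
    ; *-comm = λ x y → mod-reflexive (ℤ.*-comm x y)
    }
  }

-- ℤ_ℓ as lim ℤ/ℓⁿ: only the class of residue n modulo ℓⁿ is significant.
record AdicInteger (ℓ : ℕ) : Set where
  field
    residue  : ℕ → ℤ
    coherent : ∀ n → residue (suc n) ≡ residue n [mod ℓ ^ n ]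

open AdicInteger public

ℤ-adic : ℕ → CommutativeRing 0ℓ 0ℓ
ℤ-adic ℓ = record
  { Carrier = AdicInteger ℓ
  ; _≈_ = λ x y → ∀ n → residue x n ≡ residue y n [mod ℓ ^ n ]
  ; _+_ = λ x y → record
    { residue  = λ n → residue x n ℤ.+ residue y n
    ; coherent = λ n → mod-+ (coherent x n) (coherent y n) }
  ; _*_ = λ x y → record
    { residue  = λ n → residue x n ℤ.* residue y n
    ; coherent = λ n → mod-* (coherent x n) (coherent y n) }
  ; -_  = λ x → record
    { residue  = λ n → ℤ.- residue x n
    ; coherent = λ n → mod-neg (coherent x n) }
  ; 0#  = constant (+ 0)
  ; 1#  = constant (+ 1)
  ; isCommutativeRing = record
    { isRing = record
      { +-isAbelianGroup = record
        { isGroup = record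
          { isMonoid = record
            { isSemigroup = record
              { isMagma = record
                { isEquivalence = record
                  { refl  = λ n → mod-reflexive refl
                  ; sym   = λ p n → mod-sym (p n)
                  ; trans = λ p q n → mod-trans (p n) (q n) }
                ; ∙-cong = λ p q n → mod-+ (p n) (q n)
                }
              ; assoc = λ x y z n → R.+-assoc n (residue x n) (residue y n) (residue z n)
              }
            ; identity = (λ x n → R.+-identityˡ n (residue x n))
                       , (λ x n → R.+-identityʳ n (residue x n))
            }
          ; inverse = (λ x n → R.-‿inverseˡ n (residue x n))
                    , (λ x n → R.-‿inverseʳ n (residue x n))
          ; ⁻¹-cong = λ p n → mod-neg (p n)
          }
        ; comm = λ x y n → R.+-comm n (residue x n) (residue y n)
        }
      ; *-cong = λ p q n → mod-* (p n) (q n)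
      ; *-assoc = λ x y z n → R.*-assoc n (residue x n) (residue y n) (residue z n)
      ; *-identity = (λ x n → R.*-identityˡ n (residue x n))
                   , (λ x n → R.*-identityʳ n (residue x n))
      ; distrib = (λ x y z n → R.distribˡ n (residue x n) (residue y n) (residue z n))
                , (λ x y z n → R.distribʳ n (residue x n) (residue y n) (residue z n))
      }
    ; *-comm = λ x y n → R.*-comm n (residue x n) (residue y n)
    }
  }
  where
  module R (n : ℕ) = CommutativeRing (ℤ/ (ℓ ^ n))

  constant : ℤ → AdicInteger ℓ
  constant z = record { residue = λ _ → z ; coherent = λ _ → mod-reflexive refl }

ℤₗ 𝔽 : ℕ → RawRing 0ℓ 0ℓ
ℤₗ ℓ = CommutativeRing.rawRing (ℤ-adic ℓ)
𝔽 ℓ = CommutativeRing.rawRing (ℤ/ ℓ)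

Exponent : ℕ → Set
Exponent = Vec ℕ

unit : Fin n → Exponent n
unit i = Vec.replicate _ 0 [ i ]≔ 1

-- All β ≤ α in the componentwise order.
below : Exponent n → List (Exponent n)
below []      = [] ∷ []
below (a ∷ α) = cartesianProductWith _∷_ (upTo (suc a)) (below α)

box : (n N : ℕ) → List (Exponent n)
box n N = below (Vec.replicate n N)

module RingNotation (R : RawRing c e) where
  open RawRing R
  open RawSemiringDefs rawSemiring public
    using (sum; product) renaming (_^_ to _↑_; _×_ to _·_)

  ∑ : {A : Set a} → List A → (A → Carrier) → Carrier
  ∑ xs f = foldr (λ x s → f x + s) 0# xs

  monomial : Vector Carrier n → Exponent n → Carrier
  monomial x α = product λ i → x i ↑ Vec.lookup α i

module PowerSeries (R : RawRing c e) where
  open RawRing R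
  open RingNotation R using (∑)

  Series : ℕ → Set c
  Series n = Exponent n → Carrier

  infix 4 _≋_
  _≋_ : Series n → Series n → Set e
  f ≋ g = ∀ α → f α ≈ g α

  const : Carrier → Series n
  const r α = if does (Vec.≡-dec ℕ._≟_ α (Vec.replicate _ 0)) then r else 0#

  var : Fin n → Series n
  var i α = if does (Vec.≡-dec ℕ._≟_ α (unit i)) then 1# else 0#

  seriesRing : ℕ → RawRing c e
  seriesRing n = record
    { Carrier = Series n
    ; _≈_ = _≋_
    ; _+_ = λ f g α → f α + g α
    ; _*_ = λ f g α → ∑ (below α) λ β → f β * g (Vec.zipWith ℕ._∸_ α β)
    ; -_  = λ f α → - f α
    ; 0#  = λ _ → 0#
    ; 1#  = const 1#
    }

  -- f(g₁,…,gₙ), for g without constant terms: g^β then starts in degree ∣β∣,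
  -- so only the β with ∣β∣ ≤ ∣α∣ contribute to the coefficient at α.
  infix 9 _⟪_⟫
  _⟪_⟫ : Series n → Vector (Series k) n → Series k
  _⟪_⟫ {n} {k} f g α =
    ∑ (box n (Vec.sum α)) λ β → f β * RingNotation.monomial (seriesRing k) g β α

module Variables (R : RawRing c e) (d : ℕ) where
  open PowerSeries R

  X₂ Y₂ : Vector (Series (d ℕ.+ d)) d
  X₂ i = var (i ↑ˡ d)
  Y₂ i = var (d ↑ʳ i)

  X₃ Y₃ Z₃ : Vector (Series (d ℕ.+ (d ℕ.+ d))) d
  X₃ i = var (i ↑ˡ (d ℕ.+ d))
  Y₃ i = var (d ↑ʳ (i ↑ˡ d))
  Z₃ i = var (d ↑ʳ (d ↑ʳ i))

record FormalGroupLaw (R : RawRing c e) (d : ℕ) : Set (c ⊔ e) where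
  open RawRing R
  open PowerSeries R

  field
    -- The variables are X₁,…,X_d,Y₁,…,Y_d in this order.
    law : Vector (Series (d ℕ.+ d)) d

  apply : ∀ {k} → (g h : Vector (Series k) d) → Vector (Series k) d
  apply g h i = law i ⟪ g ++ h ⟫

  open Variables R d

  field
    linear : ∀ i α → Vec.sum α ≤ 1 → law i α ≈ X₂ i α + Y₂ i α
    assoc  : ∀ i → apply (apply X₃ Y₃) Z₃ i ≋ apply X₃ (apply Y₃ Z₃) i
    comm   : ∀ i → apply X₂ Y₂ i ≋ apply Y₂ X₂ i

  multiplication : ℕ → Vector (Series d) d
  multiplication 0             = λ _ _ → 0#
  multiplication 1             = var
  multiplication (suc (suc m)) = apply var (multiplication (suc m))

-- F₂(X₂,X₁,Y₂,Y₁) = F₁(X₁,X₂,Y₁,Y₂)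
Symmetric : {R : RawRing c e} → FormalGroupLaw R 2 → Set e
Symmetric {R = R} F = law (suc zero) ⟪ swapped ⟫ ≋ law zero
  where
  open FormalGroupLaw F
  open PowerSeries R
  swapped : Vector (Series 4) 4
  swapped zero                   = var (suc zero)
  swapped (suc zero)             = var zero
  swapped (suc (suc zero))       = var (suc (suc (suc zero)))
  swapped (suc (suc (suc zero))) = var (suc (suc zero))

module _ (R : RawRing c e) where
  open RawRing R
  open RingNotation R
  open PowerSeries R

  private module S {n} = RawRing (seriesRing n)

  ∑ₛ : ∀ {N} → Vector (Series n) N → Series n
  ∑ₛ {n} = RingNotation.sum (seriesRing n)

  combination : ∀ {N} → Vector Carrier N → Vector (Series n) N → Series n
  combination r b = ∑ₛ λ i → const (r i) S.* b i

  InIdeal : Vector (Series n) d → Series n → Set (c ⊔ e)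
  InIdeal {n} {d} f g = Σ (Vector (Series n) d) λ q → g ≋ ∑ₛ λ i → q i S.* f i

  -- R[[Z₁,…,Zₙ]]/⟨f₁,…,f_d⟩ has an R-basis of N elements.
  record QuotientHasDimension (f : Vector (Series n) d) (N : ℕ) : Set (c ⊔ e) where
    field
      basis       : Vector (Series n) N
      spanning    : ∀ g → ∃[ r ] InIdeal f (g S.+ S.- combination r basis)
      independent : ∀ r → InIdeal f (combination r basis) → ∀ i → r i ≈ 0#

  -- f ∈ R[[Z₁^q,…,Zₙ^q]]
  InPowers : ∀ {n} → ℕ → Series n → Set e
  InPowers q f = ∀ α → ¬ (∀ i → q ℕ.∣ Vec.lookup α i) → f α ≈ 0#

module _ (ℓ : ℕ) (F : FormalGroupLaw (ℤₗ ℓ) d) where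
  open FormalGroupLaw F using (multiplication)
  open PowerSeries (𝔽 ℓ) using (Series)

  -- Index 1 of the inverse system is ℤ/ℓ.
  reduced-[ℓ] : Vector (Series d) d
  reduced-[ℓ] i α = residue (multiplication ℓ i α) 1

  HasHeight : ℕ → Set
  HasHeight h = QuotientHasDimension (𝔽 ℓ) reduced-[ℓ] (ℓ ^ h)

  HasExponent : ℕ → Set
  HasExponent r = Divides r × (∀ s → Divides s → s ≤ r)
    where
    Divides : ℕ → Set
    Divides s = ∀ i → InPowers (𝔽 ℓ) (ℓ ^ s) (reduced-[ℓ] i)

-- K is an algebraic closure of Frac ℤ_ℓ = ℚ_ℓ. The field axioms are phrased with
-- denial inequality; a valuation, being a function into ℚ ∪ {∞} that is infinite
-- only at 0, makes equality of K decidable.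
record AlgebraicClosure (ℓ : ℕ) (c e : Level) : Set (lsuc (c ⊔ e)) where
  field
    ring : CommutativeRing c e

  open CommutativeRing ring public hiding (ring)
  open RingNotation rawRing public
  private module ℤ_ℓ = RawRing (ℤₗ ℓ)

  field
    1≉0     : 1# ≉ 0#
    inverse : ∀ x → x ≉ 0# → ∃[ y ] x * y ≈ 1#
    ι       : AdicInteger ℓ → Carrier
    ι-mono  : RingMorphisms.IsRingMonomorphism (ℤₗ ℓ) rawRing ι

  Inℚₗ : Carrier → Set e
  Inℚₗ x = ∃[ a ] ∃[ b ] (b ℤ_ℓ.≉ ℤ_ℓ.0#) × ι b * x ≈ ι a

  monic : Vector Carrier n → Carrier → Carrier
  monic {n} r x = x ↑ n + sum (λ i → r i * x ↑ toℕ i)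

  field
    algebraic : ∀ x → ∃[ n ] Σ (Vector Carrier n) λ r → (∀ i → Inℚₗ (r i)) × monic r x ≈ 0#
    closed    : ∀ n (r : Vector Carrier (suc n)) → ∃[ x ] monic r x ≈ 0#

ℚ∞ : Set
ℚ∞ = ℚ ⁺

open NonStrict ℚ._≤_ public using () renaming (_≤⁺_ to _≤∞_)
open Strict ℚ._<_ public using () renaming (_<⁺_ to _<∞_)

infixl 6 _+∞_ _⊓∞_

_+∞_ _⊓∞_ : ℚ∞ → ℚ∞ → ℚ∞
[ p ] +∞ [ q ] = [ p ℚ.+ q ]
[ p ] +∞ ⊤⁺    = ⊤⁺
⊤⁺    +∞ _     = ⊤⁺

[ p ] ⊓∞ [ q ] = [ p ℚ.⊓ q ]
[ p ] ⊓∞ ⊤⁺    = [ p ]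
⊤⁺    ⊓∞ y     = y

record Valuation {ℓ : ℕ} (K : AlgebraicClosure ℓ c e) : Set (c ⊔ e) where
  open AlgebraicClosure K
  field
    v          : Carrier → ℚ∞
    v-cong     : ∀ {x y} → x ≈ y → v x ≡ v y
    v-zero     : ∀ x → v x ≡ ⊤⁺ ⇔ x ≈ 0#
    v-*        : ∀ x y → v (x * y) ≡ v x +∞ v y
    v-+        : ∀ x y → v x ⊓∞ v y ≤∞ v (x + y)
    -- Together these say that v extends the ℓ-adic valuation of ℤ_ℓ; normalising
    -- at ℓ alone does not exclude exotic valuations that are negative on ℤ_ℓ.
    v-integral : ∀ z → [ 0ℚ ] ≤∞ v (ι z)
    v-ℓ        : v (ℓ · 1#) ≡ [ 1ℚ ]

record Gal {ℓ : ℕ} (K : AlgebraicClosure ℓ c e) : Set (c ⊔ e) where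
  open AlgebraicClosure K
  field
    act   : Carrier → Carrier
    iso   : RingMorphisms.IsRingIsomorphism rawRing rawRing act
    fixes : ∀ x → Inℚₗ x → act x ≈ x

-- The ramification group of v: σx/x ≡ 1 modulo the maximal ideal, for all x ≠ 0.
IsWild : {ℓ : ℕ} {K : AlgebraicClosure ℓ c e} → Valuation K → Gal K → Set (c ⊔ e)
IsWild {K = K} V σ = ∀ x x⁻¹ → x * x⁻¹ ≈ 1# → [ 0ℚ ] <∞ v (act x * x⁻¹ - 1#)
  where
  open AlgebraicClosure K
  open Valuation V
  open Gal σ

module _ {ℓ : ℕ} {K : AlgebraicClosure ℓ c e} (V : Valuation K) where
  open AlgebraicClosure K
  open Valuation V
  open PowerSeries (ℤₗ ℓ) using (Series)

  partialSum : Series n → Vector Carrier n → ℕ → Carrier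
  partialSum {n} f x N = ∑ (box n N) λ α → ι (f α) * monomial x α

  -- ∑ f_α x^α = s for the v-adic topology; at points of 𝔪̄ⁿ the terms tend to 0,
  -- so summing over boxes is as good as summing by total degree.
  HasValue : Series n → Vector Carrier n → Carrier → Set
  HasValue f x s =
    ∀ (M : ℕ) → ∃[ N₀ ] ∀ N → N₀ ≤ N → [ (+ M) ℚ./ 1 ] ≤∞ v (s - partialSum f x N)

  record Point (d : ℕ) : Set c where
    field
      coord    : Vector Carrier d
      positive : ∀ i → [ 0ℚ ] <∞ v (coord i)

  open Point public

  infix 4 _≈ₚ_
  _≈ₚ_ : Point d → Point d → Set e
  P ≈ₚ Q = ∀ i → coord P i ≈ coord Q i

  IsOrigin : Point d → Set e
  IsOrigin P = ∀ i → coord P i ≈ 0#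

  module _ (F : FormalGroupLaw (ℤₗ ℓ) d) where
    open FormalGroupLaw F using (law)

    -- P + Q = S in F(𝔪̄). The group law is given by its graph, because the
    -- existence of the sum of a power series at a point of 𝔪̄ᵈ is a theorem
    -- (completeness of finite extensions of ℚ_ℓ); its uniqueness is immediate.
    Adds : Point d → Point d → Point d → Set
    Adds P Q S = ∀ i → HasValue (law i) (coord P ++ coord Q) (coord S i)

    -- m P = Q in F(𝔪̄), by the same recursion as [m].
    Multiple : ℕ → Point d → Point d → Set (c ⊔ e)
    Multiple 0             P Q = Lift c (IsOrigin Q)
    Multiple 1             P Q = Lift c (P ≈ₚ Q)
    Multiple (suc (suc m)) P Q = ∃[ S ] Multiple (suc m) P S × Adds P S Q

    IsTorsion : ℕ → Point d → Set (c ⊔ e)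
    IsTorsion m P = ∃[ O ] IsOrigin O × Multiple m P O

{-# OPTIONS --safe #-}
-- The exponent hypothesis gives [ℓ](Z) ≡ g(Z^q) modulo ℓ with q = ℓ², and height 4
-- forces the linear part of g to be invertible: otherwise the ℓ⁴ coefficients of
-- Z₁^a Z₂^b with a, b < q, together with a functional on those of Z₁^q and Z₂^q,
-- would be ℓ⁴ + 1 independent functionals on a space of dimension ℓ⁴.
-- Hence, comparing ℓ Z with g(Z^q), a nonzero ℓ-torsion point x has coordinates of
-- valuation at least 1/(q - 1). For a wild σ the difference d = σx - x has larger
-- valuation than x, so v(d) > 1/(q - 1); in [ℓ](σx) - [ℓ](x) = 0 the term ℓ d then
-- has smaller valuation than all others, which forces d = 0.
module Submission where

open import Defs
open import Algebra.Bundles using (CommutativeRing; RawRing)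
open import Algebra.Morphism.Structures using (module RingMorphisms)
open import Algebra.Structures using (IsCommutativeRing)
open import Data.Bool.Base using (true; false)
open import Data.Empty using (⊥; ⊥-elim)
open import Data.Fin.Base
  using (Fin; zero; suc; toℕ; fromℕ<; splitAt; _↑ˡ_; _↑ʳ_; combine; remQuot; funToFin; finToFun)
import Data.Fin.Properties as Fin
open import Data.Integer.Base as ℤ using (ℤ; +_; -[1+_])
open import Data.Integer.DivMod using (_%ℕ_; _/ℕ_; a≡a%ℕn+[a/ℕn]*n; n%ℕd<d)
open import Data.Integer.Divisibility.Signed as ℤ∣ using (_∣_; divides)
import Data.Integer.Properties as ℤ
open import Data.Integer.Tactic.RingSolver using (solve-∀)
open import Data.List.Base as List using (List; []; _∷_; _∷ʳ_; upTo; cartesianProductWith)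
open import Data.List.Membership.Propositional using (_∈_)
open import Data.List.Membership.Propositional.Properties
  using (∈-upTo⁺; ∈-upTo⁻; ∈-cartesianProductWith⁺; ∈-cartesianProductWith⁻)
open import Data.List.Properties using (map-upTo; upTo-∷ʳ)
open import Data.List.Relation.Unary.All as All using ([]; _∷_)
open import Data.List.Relation.Unary.AllPairs using ([]; _∷_)
open import Data.List.Relation.Unary.Any using (here; there)
open import Data.List.Relation.Unary.Unique.Propositional using (Unique)
import Data.List.Relation.Unary.Unique.Propositional.Properties as Unique
open import Data.Nat.Base as ℕ
  using (ℕ; zero; suc; _≤_; _<_; _^_; _∸_; _⊔_; z≤n; s≤s; NonZero)
open import Data.Nat.Combinatorics using (_C_; nCk+nC[k+1]≡[n+1]C[k+1])
open import Data.Nat.Coprimality using (prime⇒coprime; coprime-Bézout)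
import Data.Nat.Divisibility as ℕ∣
open import Data.Nat.GCD using (module Bézout)
open import Data.Nat.Primality using (Prime; prime⇒nonZero; prime⇒nonTrivial; euclidsLemma)
import Data.Nat.Properties as ℕ
import Data.Nat.Tactic.RingSolver as ℕ
open import Data.Product.Base using (Σ; ∃-syntax; _×_; _,_; proj₁; proj₂)
open import Data.Rational.Base as ℚ using (ℚ; 0ℚ; 1ℚ; mkℚ)
import Data.Rational.Properties as ℚ
import Data.Rational.Unnormalised.Base as ℚᵘ
import Data.Rational.Unnormalised.Properties as ℚᵘ
open import Data.Sum.Base as Sum using (_⊎_; inj₁; inj₂)
open import Data.Vec.Base as Vec using (Vec; []; _∷_; lookup; zipWith; replicate)
open import Data.Vec.Functional using (Vector; _++_)
import Data.Vec.Properties as Vec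
open import Function.Base using (_∘_)
open import Function.Bundles using (Equivalence)
open import Level using (Level; lift) renaming (_⊔_ to _⊔ₗ_)
import Relation.Binary.Construct.Add.Supremum.NonStrict as NonStrict
import Relation.Binary.Construct.Add.Supremum.Strict as Strict
open import Relation.Binary.PropositionalEquality.Core as ≡
  using (_≡_; _≢_; cong; cong₂; subst; subst₂)
open import Relation.Binary.PropositionalEquality.Properties using (module ≡-Reasoning)
open import Relation.Nullary.Construct.Add.Supremum using ([_]; ⊤⁺)
open import Relation.Nullary.Decidable.Core using (Dec; does; yes; no; map′)
open import Relation.Nullary.Negation.Core using (¬_; contradiction)

-- A torsion point is given by the recursion for multiples of a point, whereas the argument needs
-- the series [ℓ] to vanish at it; hence values must be shown to be compatible with substitution.
-- This is done for one precision t at a time, in {v ≥ 0}/{v ≥ t}, where evaluation is a finite sum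
-- and a ring homomorphism.
--
-- The linear part of g is the 2×2 matrix of the coefficients of [ℓ] at Z₁^q and Z₂^q modulo ℓ. In a
-- multiple h·[ℓ]ᵢ only h(0) reaches these two exponents, because [ℓ]ᵢ has no smaller terms; so a
-- functional that annihilates both rows of a singular matrix kills the whole ideal. The dimension
-- count is a pigeonhole argument: ℓ^(q²+1) prescriptions of functional values against ℓ^(q²)
-- coordinate vectors.
--
-- The constant 1/(q - 1) is the solution of 1 + t = q t, the valuation at which ℓ Z and Z^q
-- balance; it is kept in the form 1 + t ≤ q t, which avoids division. Beyond it d^q is smaller than
-- ℓ d, but (x + d)^q - x^q also has mixed terms. Since q is ℓ², these are controlled by raising to
-- the power ℓ twice and using that the middle binomial coefficients are divisible by ℓ each time.

private variable
  a b c e c′ e′ : Level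
  n k m : ℕ
  A : Set a
  B : Set b
  s t : ℚ

-- Exponents and finite sums

_⊖_ : Exponent n → Exponent n → Exponent n
_⊖_ = zipWith _∸_

_⊕_ : Exponent n → Exponent n → Exponent n
_⊕_ = zipWith ℕ._+_

∈-below⁻ : ∀ (α : Exponent n) {β} → β ∈ below α → ∀ i → lookup β i ≤ lookup α i
∈-below⁻ (x ∷ α) β∈ i with ∈-cartesianProductWith⁻ _∷_ (upTo (suc x)) (below α) β∈
∈-below⁻ (x ∷ α) β∈ zero    | _ , _ , y∈ , _ , ≡.refl = ℕ.s≤s⁻¹ (∈-upTo⁻ y∈)
∈-below⁻ (x ∷ α) β∈ (suc i) | _ , _ , _ , γ∈ , ≡.refl = ∈-below⁻ α γ∈ i

∈-below⁺ : ∀ (α β : Exponent n) → (∀ i → lookup β i ≤ lookup α i) → β ∈ below α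
∈-below⁺ []      []      _   = here ≡.refl
∈-below⁺ (x ∷ α) (y ∷ β) β≤α =
  ∈-cartesianProductWith⁺ _∷_ (∈-upTo⁺ (s≤s (β≤α zero))) (∈-below⁺ α β (β≤α ∘ suc))

below-unique : ∀ (α : Exponent n) → Unique (below α)
below-unique []      = [] ∷ []
below-unique (x ∷ α) =
  Unique.cartesianProductWith⁺ _∷_ Vec.∷-injective (Unique.upTo⁺ (suc x)) (below-unique α)

∈-box⁺ : ∀ {N} (β : Exponent n) → (∀ i → lookup β i ≤ N) → β ∈ box n N
∈-box⁺ {N = N} β β≤N =
  ∈-below⁺ (replicate _ N) β λ i → subst (lookup β i ≤_) (≡.sym (Vec.lookup-replicate i N)) (β≤N i)

⊕-⊖ : ∀ (α : Exponent n) {β} → β ∈ below α → β ⊕ (α ⊖ β) ≡ α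
⊕-⊖ α {β} β∈ = helper α β (∈-below⁻ α β∈)
  where
  helper : ∀ {n} (α β : Exponent n) → (∀ i → lookup β i ≤ lookup α i) → β ⊕ (α ⊖ β) ≡ α
  helper []      []      _   = ≡.refl
  helper (x ∷ α) (y ∷ β) β≤α = cong₂ _∷_ (ℕ.m+[n∸m]≡n (β≤α zero)) (helper α β (β≤α ∘ suc))

sum-⊕ : ∀ (α β : Exponent n) → Vec.sum (α ⊕ β) ≡ Vec.sum α ℕ.+ Vec.sum β
sum-⊕ []      []      = ≡.refl
sum-⊕ (x ∷ α) (y ∷ β) = begin
  x ℕ.+ y ℕ.+ Vec.sum (α ⊕ β)               ≡⟨ cong (x ℕ.+ y ℕ.+_) (sum-⊕ α β) ⟩
  x ℕ.+ y ℕ.+ (Vec.sum α ℕ.+ Vec.sum β)     ≡⟨ ℕ.+-assoc x y _ ⟩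
  x ℕ.+ (y ℕ.+ (Vec.sum α ℕ.+ Vec.sum β))   ≡⟨ cong (x ℕ.+_) (ℕ.+-assoc y _ _) ⟨
  x ℕ.+ (y ℕ.+ Vec.sum α ℕ.+ Vec.sum β)     ≡⟨ cong (λ z → x ℕ.+ (z ℕ.+ Vec.sum β)) (ℕ.+-comm y _) ⟩
  x ℕ.+ (Vec.sum α ℕ.+ y ℕ.+ Vec.sum β)     ≡⟨ cong (x ℕ.+_) (ℕ.+-assoc (Vec.sum α) y _) ⟩
  x ℕ.+ (Vec.sum α ℕ.+ (y ℕ.+ Vec.sum β))   ≡⟨ ℕ.+-assoc x _ _ ⟨
  x ℕ.+ Vec.sum α ℕ.+ (y ℕ.+ Vec.sum β)     ∎
  where open ≡-Reasoning

module ListSum (R : CommutativeRing c e) where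
  open CommutativeRing R hiding (zero)
  open RingNotation rawRing using (∑)
  open import Relation.Binary.Reasoning.Setoid setoid
  open import Algebra.Properties.CommutativeSemigroup +-commutativeSemigroup using (interchange)

  ∑-cong-∈ : ∀ (xs : List A) {f g : A → Carrier} → (∀ x → x ∈ xs → f x ≈ g x) → ∑ xs f ≈ ∑ xs g
  ∑-cong-∈ []       f≈g = refl
  ∑-cong-∈ (x ∷ xs) f≈g = +-cong (f≈g x (here ≡.refl)) (∑-cong-∈ xs λ y y∈ → f≈g y (there y∈))

  ∑-cong : ∀ (xs : List A) {f g : A → Carrier} → (∀ x → f x ≈ g x) → ∑ xs f ≈ ∑ xs g
  ∑-cong xs f≈g = ∑-cong-∈ xs λ x _ → f≈g x

  ∑-zero-∈ : ∀ (xs : List A) {f : A → Carrier} → (∀ x → x ∈ xs → f x ≈ 0#) → ∑ xs f ≈ 0#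
  ∑-zero-∈ []       f≈0 = refl
  ∑-zero-∈ (x ∷ xs) f≈0 =
    trans (+-cong (f≈0 x (here ≡.refl)) (∑-zero-∈ xs λ y y∈ → f≈0 y (there y∈))) (+-identityˡ 0#)

  ∑-zero : ∀ (xs : List A) {f : A → Carrier} → (∀ x → f x ≈ 0#) → ∑ xs f ≈ 0#
  ∑-zero xs f≈0 = ∑-zero-∈ xs λ x _ → f≈0 x

  ∑-+ : ∀ (xs : List A) (f g : A → Carrier) → ∑ xs (λ x → f x + g x) ≈ ∑ xs f + ∑ xs g
  ∑-+ []       f g = sym (+-identityˡ 0#)
  ∑-+ (x ∷ xs) f g = trans (+-congˡ (∑-+ xs f g)) (interchange _ _ _ _)

  *-∑ : ∀ (xs : List A) y (f : A → Carrier) → y * ∑ xs f ≈ ∑ xs (λ x → y * f x)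
  *-∑ []       y f = zeroʳ y
  *-∑ (x ∷ xs) y f = trans (distribˡ _ _ _) (+-congˡ (*-∑ xs y f))

  ∑-* : ∀ (xs : List A) (f : A → Carrier) y → ∑ xs f * y ≈ ∑ xs (λ x → f x * y)
  ∑-* []       f y = zeroˡ y
  ∑-* (x ∷ xs) f y = trans (distribʳ _ _ _) (+-congˡ (∑-* xs f y))

  ∑-swap : ∀ (xs : List A) (ys : List B) (f : A → B → Carrier) →
           ∑ xs (λ x → ∑ ys (f x)) ≈ ∑ ys (λ y → ∑ xs (λ x → f x y))
  ∑-swap []       ys f = sym (∑-zero ys λ _ → refl)
  ∑-swap (x ∷ xs) ys f = trans (+-congˡ (∑-swap xs ys f)) (sym (∑-+ ys (f x) _))

  ∑-++ : ∀ (xs ys : List A) (f : A → Carrier) → ∑ (xs List.++ ys) f ≈ ∑ xs f + ∑ ys f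
  ∑-++ []       ys f = sym (+-identityˡ _)
  ∑-++ (x ∷ xs) ys f = trans (+-congˡ (∑-++ xs ys f)) (sym (+-assoc _ _ _))

  ∑-map : ∀ (g : B → A) (xs : List B) (f : A → Carrier) → ∑ (List.map g xs) f ≈ ∑ xs (f ∘ g)
  ∑-map g []       f = refl
  ∑-map g (x ∷ xs) f = +-congˡ (∑-map g xs f)

  ∑-cartesian : ∀ (xs : List ℕ) (ys : List (Exponent n)) (f : Exponent (suc n) → Carrier) →
                ∑ (cartesianProductWith _∷_ xs ys) f ≈ ∑ xs (λ x → ∑ ys (λ y → f (x ∷ y)))
  ∑-cartesian []       ys f = refl
  ∑-cartesian (x ∷ xs) ys f =
    trans (∑-++ (List.map (x ∷_) ys) _ f) (+-cong (∑-map (x ∷_) ys f) (∑-cartesian xs ys f))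

  ∑-upTo-suc : ∀ n (f : ℕ → Carrier) → ∑ (upTo (suc n)) f ≈ f 0 + ∑ (upTo n) (f ∘ suc)
  ∑-upTo-suc n f =
    +-congˡ (trans (reflexive (cong (λ xs → ∑ xs f) (≡.sym (map-upTo suc n)))) (∑-map suc (upTo n) f))

  ∑-upTo-last : ∀ n (f : ℕ → Carrier) → ∑ (upTo (suc n)) f ≈ ∑ (upTo n) f + f n
  ∑-upTo-last n f = begin
    ∑ (upTo (suc n)) f        ≡⟨ cong (λ xs → ∑ xs f) (upTo-∷ʳ n) ⟨
    ∑ (upTo n ∷ʳ n) f         ≈⟨ ∑-++ (upTo n) (n ∷ []) f ⟩
    ∑ (upTo n) f + (f n + 0#) ≈⟨ +-congˡ (+-identityʳ _) ⟩
    ∑ (upTo n) f + f n        ∎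

  ∑-single : ∀ {xs : List A} {x} → Unique xs → x ∈ xs → (f : A → Carrier) →
             (∀ y → y ∈ xs → y ≢ x → f y ≈ 0#) → ∑ xs f ≈ f x
  ∑-single {xs = x ∷ xs} (x# ∷ _) (here ≡.refl) f f≈0 =
    trans (+-congˡ (∑-zero-∈ xs λ y y∈ → f≈0 y (there y∈) (All.lookup x# y∈ ∘ ≡.sym))) (+-identityʳ _)
  ∑-single {xs = z ∷ xs} (z# ∷ u) (there x∈) f f≈0 =
    trans (+-cong (f≈0 z (here ≡.refl) (All.lookup z# x∈))
                  (∑-single u x∈ f λ y y∈ → f≈0 y (there y∈)))
          (+-identityˡ _)

  -- Antidiagonals against rows: splitting the entry with b = 0 off every antidiagonal leaves the
  -- same triangle with D one smaller. The hypothesis makes the rest of the square contribute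
  -- nothing.
  ∑-triangle : ∀ D (G : ℕ → ℕ → Carrier) → (∀ b c → D ≤ b ℕ.+ c → G b c ≈ 0#) →
               ∑ (upTo D) (λ a → ∑ (upTo (suc a)) (λ b → G b (a ∸ b))) ≈
               ∑ (upTo D) (λ b → ∑ (upTo D) (G b))
  ∑-triangle zero    G G≈0 = refl
  ∑-triangle (suc D) G G≈0 = begin
    ∑ (upTo (suc D)) (λ a → ∑ (upTo (suc a)) (λ b → G b (a ∸ b)))
      ≈⟨ ∑-cong (upTo (suc D)) (λ a → ∑-upTo-suc a (λ b → G b (a ∸ b))) ⟩
    ∑ (upTo (suc D)) (λ a → G 0 a + ∑ (upTo a) (λ b → G (suc b) (a ∸ suc b)))
      ≈⟨ ∑-+ (upTo (suc D)) (G 0) (λ a → ∑ (upTo a) (λ b → G (suc b) (a ∸ suc b))) ⟩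
    ∑ (upTo (suc D)) (G 0) + ∑ (upTo (suc D)) (λ a → ∑ (upTo a) (λ b → G (suc b) (a ∸ suc b)))
      ≈⟨ +-congˡ (trans (∑-upTo-suc D (λ a → ∑ (upTo a) (λ b → G (suc b) (a ∸ suc b)))) (+-identityˡ _)) ⟩
    ∑ (upTo (suc D)) (G 0) + ∑ (upTo D) (λ a → ∑ (upTo (suc a)) (λ b → G (suc b) (a ∸ b)))
      ≈⟨ +-congˡ (∑-triangle D (G ∘ suc) λ b c D≤ → G≈0 (suc b) c (s≤s D≤)) ⟩
    ∑ (upTo (suc D)) (G 0) + ∑ (upTo D) (λ b → ∑ (upTo D) (G (suc b)))
      ≈⟨ +-congˡ (∑-cong (upTo D) λ b → sym (trans (∑-upTo-last D (G (suc b)))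
           (trans (+-congˡ (G≈0 (suc b) D (s≤s (ℕ.m≤n+m D b)))) (+-identityʳ _)))) ⟩
    ∑ (upTo (suc D)) (G 0) + ∑ (upTo D) (λ b → ∑ (upTo (suc D)) (G (suc b)))
      ≈⟨ ∑-upTo-suc D (λ b → ∑ (upTo (suc D)) (G b)) ⟨
    ∑ (upTo (suc D)) (λ b → ∑ (upTo (suc D)) (G b)) ∎

  -- Reindexing by the pair of β and α ⊖ β, one coordinate at a time through `∑-triangle`. This is
  -- what makes truncated evaluation multiplicative.
  ∑-convolution : ∀ n N (F : Exponent n → Exponent n → Carrier) →
                  (∀ β γ i → N < lookup β i ℕ.+ lookup γ i → F β γ ≈ 0#) →
                  ∑ (box n N) (λ α → ∑ (below α) (λ β → F β (α ⊖ β))) ≈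
                  ∑ (box n N) (λ β → ∑ (box n N) (F β))
  ∑-convolution zero    N F F≈0 = refl
  ∑-convolution (suc n) N F F≈0 = begin
    ∑ (box (suc n) N) (λ α → ∑ (below α) (λ β → F β (α ⊖ β)))
      ≈⟨ ∑-cartesian I (box n N) _ ⟩
    ∑ I (λ a → ∑ (box n N) (λ α → ∑ (below (a ∷ α)) (λ β → F β ((a ∷ α) ⊖ β))))
      ≈⟨ ∑-cong I (λ a → ∑-cong (box n N) λ α → ∑-cartesian (upTo (suc a)) (below α) _) ⟩
    ∑ I (λ a → ∑ (box n N) (λ α → ∑ (upTo (suc a)) (λ b → ∑ (below α) (λ β → F′ b (a ∸ b) β (α ⊖ β)))))
      ≈⟨ ∑-cong I (λ a → ∑-swap (box n N) (upTo (suc a)) _) ⟩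
    ∑ I (λ a → ∑ (upTo (suc a)) (λ b → ∑ (box n N) (λ α → ∑ (below α) (λ β → F′ b (a ∸ b) β (α ⊖ β)))))
      ≈⟨ ∑-cong I (λ a → ∑-cong (upTo (suc a)) λ b → ∑-convolution n N (F′ b (a ∸ b))
           λ β γ i → F≈0 (b ∷ β) ((a ∸ b) ∷ γ) (suc i)) ⟩
    ∑ I (λ a → ∑ (upTo (suc a)) (λ b → H b (a ∸ b)))
      ≈⟨ ∑-triangle (suc N) H (λ b c N< → ∑-zero (box n N) λ β → ∑-zero (box n N) λ γ →
           F≈0 (b ∷ β) (c ∷ γ) zero N<) ⟩
    ∑ I (λ b → ∑ I (H b))
      ≈⟨ ∑-cong I (λ b → ∑-swap I (box n N) _) ⟩
    ∑ I (λ b → ∑ (box n N) (λ β → ∑ I (λ c → ∑ (box n N) (F′ b c β))))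
      ≈⟨ ∑-cong I (λ b → ∑-cong (box n N) λ β → sym (∑-cartesian I (box n N) _)) ⟩
    ∑ I (λ b → ∑ (box n N) (λ β → ∑ (box (suc n) N) (F (b ∷ β))))
      ≈⟨ ∑-cartesian I (box n N) _ ⟨
    ∑ (box (suc n) N) (λ β → ∑ (box (suc n) N) (F β)) ∎
    where
    I = upTo (suc N)
    F′ : ℕ → ℕ → Exponent n → Exponent n → Carrier
    F′ b c β γ = F (b ∷ β) (c ∷ γ)
    H : ℕ → ℕ → Carrier
    H b c = ∑ (box n N) λ β → ∑ (box n N) (F′ b c β)

  ∑-upTo-mono : ∀ {M N} → M ≤ N → (f : ℕ → Carrier) → (∀ m → M ≤ m → f m ≈ 0#) →
                ∑ (upTo M) f ≈ ∑ (upTo N) f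
  ∑-upTo-mono {N = N}     z≤n       f f≈0 = sym (∑-zero (upTo N) λ m → f≈0 m z≤n)
  ∑-upTo-mono {suc M} {suc N} (s≤s M≤N) f f≈0 = begin
    ∑ (upTo (suc M)) f             ≈⟨ ∑-upTo-suc M f ⟩
    f 0 + ∑ (upTo M) (f ∘ suc)     ≈⟨ +-congˡ (∑-upTo-mono M≤N (f ∘ suc) λ m M≤m → f≈0 (suc m) (s≤s M≤m)) ⟩
    f 0 + ∑ (upTo N) (f ∘ suc)     ≈⟨ ∑-upTo-suc N f ⟨
    ∑ (upTo (suc N)) f             ∎

  ∑-box-mono : ∀ n {M N} → M ≤ N → (f : Exponent n → Carrier) →
               (∀ β i → M < lookup β i → f β ≈ 0#) → ∑ (box n M) f ≈ ∑ (box n N) f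
  ∑-box-mono zero    M≤N f f≈0 = refl
  ∑-box-mono (suc n) {M} {N} M≤N f f≈0 = begin
    ∑ (box (suc n) M) f
      ≈⟨ ∑-cartesian (upTo (suc M)) (box n M) f ⟩
    ∑ (upTo (suc M)) (λ b → ∑ (box n M) (λ β → f (b ∷ β)))
      ≈⟨ ∑-cong (upTo (suc M)) (λ b → ∑-box-mono n M≤N (λ β → f (b ∷ β)) λ β i → f≈0 (b ∷ β) (suc i)) ⟩
    ∑ (upTo (suc M)) (λ b → ∑ (box n N) (λ β → f (b ∷ β)))
      ≈⟨ ∑-upTo-mono (s≤s M≤N) _ (λ b M<b → ∑-zero (box n N) λ β → f≈0 (b ∷ β) zero M<b) ⟩
    ∑ (upTo (suc N)) (λ b → ∑ (box n N) (λ β → f (b ∷ β)))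
      ≈⟨ ∑-cartesian (upTo (suc N)) (box n N) f ⟨
    ∑ (box (suc n) N) f ∎

-- Evaluation of power series at nilpotent points

sum-split-< : ∀ {p q a b} → a ℕ.+ b < p ℕ.+ q → a < p ⊎ b < q
sum-split-< {p} {q} {a} {b} a+b< with a ℕ.<? p
... | yes a<p = inj₁ a<p
... | no  a≮p = inj₂ (ℕ.+-cancelˡ-< p b q (ℕ.≤-<-trans (ℕ.+-monoˡ-≤ b (ℕ.≮⇒≥ a≮p)) a+b<))

lookup-⊕ : ∀ (α β : Exponent n) i → lookup (α ⊕ β) i ≡ lookup α i ℕ.+ lookup β i
lookup-⊕ α β i = Vec.lookup-zipWith ℕ._+_ i α β

lookup≤sum : ∀ (α : Exponent n) i → lookup α i ≤ Vec.sum α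
lookup≤sum (x ∷ α) zero    = ℕ.m≤m+n x _
lookup≤sum (x ∷ α) (suc i) = ℕ.m≤n⇒m≤o+n x (lookup≤sum α i)

sum≤ : ∀ (α : Exponent n) N → (∀ i → lookup α i ≤ N) → Vec.sum α ≤ n ℕ.* N
sum≤ []      N _   = z≤n
sum≤ (x ∷ α) N α≤N = ℕ.+-mono-≤ (α≤N zero) (sum≤ α N (α≤N ∘ suc))

module Monomials (R : CommutativeRing c e) where
  open CommutativeRing R hiding (zero)
  open RingNotation rawRing
  open import Algebra.Properties.CommutativeSemigroup *-commutativeSemigroup using (interchange)

  open import Algebra.Properties.Monoid.Mult *-monoid public
    using () renaming (×-homo-+ to ↑-+; ×-congʳ to ↑-cong; ×-assocˡ to ↑-↑)

  ·-zero : ∀ m → m · 0# ≈ 0#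
  ·-zero zero    = refl
  ·-zero (suc m) = trans (+-identityˡ _) (·-zero m)

  monomial-⊕ : ∀ (x : Vector Carrier n) α β → monomial x (α ⊕ β) ≈ monomial x α * monomial x β
  monomial-⊕ x []      []      = sym (*-identityˡ _)
  monomial-⊕ x (a ∷ α) (b ∷ β) =
    trans (*-cong (↑-+ (x zero) a b) (monomial-⊕ (x ∘ suc) α β)) (interchange _ _ _ _)

  monomial-cong : ∀ {x y : Vector Carrier n} α → (∀ i → x i ≈ y i) → monomial x α ≈ monomial y α
  monomial-cong []      x≈y = refl
  monomial-cong (a ∷ α) x≈y = *-cong (↑-cong a (x≈y zero)) (monomial-cong α (x≈y ∘ suc))

  monomial-replicate-0 : ∀ n (x : Vector Carrier n) → monomial x (replicate n 0) ≈ 1#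
  monomial-replicate-0 zero    x = refl
  monomial-replicate-0 (suc n) x = trans (*-identityˡ _) (monomial-replicate-0 n (x ∘ suc))

  monomial-unit : ∀ (x : Vector Carrier n) i → monomial x (unit i) ≈ x i
  monomial-unit {suc n} x zero    = trans (*-cong (*-identityʳ _) (monomial-replicate-0 n (x ∘ suc))) (*-identityʳ _)
  monomial-unit {suc n} x (suc i) = trans (*-identityˡ _) (monomial-unit (x ∘ suc) i)

  monomial-nilpotent : ∀ {N} (x : Vector Carrier n) → (∀ i m → N < m → x i ↑ m ≈ 0#) →
                       ∀ α i → N < lookup α i → monomial x α ≈ 0#
  monomial-nilpotent x nil (a ∷ α) zero    N<a = trans (*-congʳ (nil zero a N<a)) (zeroˡ _)
  monomial-nilpotent x nil (a ∷ α) (suc i) N<a =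
    trans (*-congˡ (monomial-nilpotent (x ∘ suc) (nil ∘ suc) α i N<a)) (zeroʳ _)

-- The coefficients are given by the raw ring itself, not by the one underlying
-- a bundle, so that instances speak of ℤₗ ℓ literally; unfolding ℤₗ ℓ to the raw
-- ring of ℤ-adic ℓ inside a series is not feasible.
record IsCommutative (R : RawRing c e) : Set (c ⊔ₗ e) where
  open RawRing R
  field isCommutativeRing : IsCommutativeRing _≈_ _+_ _*_ -_ 0# 1#

  bundle : CommutativeRing c e
  bundle = record { isCommutativeRing = isCommutativeRing }

module Order {R : RawRing c e} (isComm : IsCommutative R) where
  open CommutativeRing (IsCommutative.bundle isComm) hiding (zero)
  open PowerSeries R
  open ListSum (IsCommutative.bundle isComm)

  private module S {k} = RawRing (seriesRing k)
  private module SN {k} = RingNotation (seriesRing k)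

  HasOrder : ℕ → Series k → Set e
  HasOrder m f = ∀ α → Vec.sum α < m → f α ≈ 0#

  order-* : ∀ {p q} {f g : Series k} → HasOrder p f → HasOrder q g → HasOrder (p ℕ.+ q) (f S.* g)
  order-* {f = f} {g} f-ord g-ord α α< = ∑-zero-∈ (below α) λ β β∈ →
    case β (sum-split-< (subst (_< _) (≡.trans (cong Vec.sum (≡.sym (⊕-⊖ α β∈))) (sum-⊕ β _)) α<))
    where
    case : ∀ β → Vec.sum β < _ ⊎ Vec.sum (α ⊖ β) < _ → f β * g (α ⊖ β) ≈ 0#
    case β (inj₁ β<) = trans (*-congʳ (f-ord β β<)) (zeroˡ _)
    case β (inj₂ γ<) = trans (*-congˡ (g-ord (α ⊖ β) γ<)) (zeroʳ _)

  order-↑ : ∀ {f : Series k} → HasOrder 1 f → ∀ m → HasOrder m (f SN.↑ m)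
  order-↑ f-ord (suc m) = order-* f-ord (order-↑ f-ord m)

  order-monomial : ∀ {g : Vector (Series k) n} → (∀ i → HasOrder 1 (g i)) →
                   ∀ β → HasOrder (Vec.sum β) (SN.monomial g β)
  order-monomial g-ord (b ∷ β) = order-* (order-↑ (g-ord zero) b) (order-monomial (g-ord ∘ suc) β)

module Evaluation
  {R : RawRing c e} (isComm : IsCommutative R) {A : CommutativeRing c′ e′}
  (ι : RawRing.Carrier R → CommutativeRing.Carrier A)
  (ι-homo : RingMorphisms.IsRingHomomorphism R (CommutativeRing.rawRing A) ι)
  where
  open CommutativeRing A hiding (zero)

  private
    module R = CommutativeRing (IsCommutative.bundle isComm)
    module S {k} = RawRing (PowerSeries.seriesRing R k)
    module SN {k} = RingNotation (PowerSeries.seriesRing R k)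
  open RingMorphisms.IsRingHomomorphism ι-homo
  open RingNotation rawRing
  open PowerSeries R
  open ListSum A
  open Monomials A
  open Order isComm
  open import Relation.Binary.Reasoning.Setoid setoid
  open import Algebra.Properties.CommutativeSemigroup *-commutativeSemigroup using (interchange)

  ι-∑ : ∀ {X : Set a} (xs : List X) f → ι (RingNotation.∑ R xs f) ≈ ∑ xs (ι ∘ f)
  ι-∑ []       f = 0#-homo
  ι-∑ (x ∷ xs) f = trans (+-homo _ _) (+-congˡ (ι-∑ xs f))

  -- When all powers of the coordinates beyond the N-th vanish, this truncation is the full value of
  -- the series at x.
  evalAt : ℕ → Vector Carrier k → Series k → Carrier
  evalAt {k = k} N x f = ∑ (box k N) λ α → ι (f α) * monomial x α

  module _ (N : ℕ) {k} (x : Vector Carrier k) where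

    private
      eval : Series k → Carrier
      eval = evalAt N x

    eval-1 : eval S.1# ≈ 1#
    eval-1 = trans
      (∑-single (below-unique (replicate k N)) (∈-box⁺ (replicate k 0) λ i → subst (_≤ N) (≡.sym (Vec.lookup-replicate i 0)) z≤n)
        (λ α → ι (S.1# α) * monomial x α) λ α _ α≢0 → trans (*-congʳ (off α α≢0)) (zeroˡ _))
      (trans (*-cong on (monomial-replicate-0 k x)) (*-identityˡ 1#))
      where
      off : ∀ α → α ≢ replicate k 0 → ι (S.1# α) ≈ 0#
      off α α≢0 with Vec.≡-dec ℕ._≟_ α (replicate k 0)
      ... | yes α≡0 = contradiction α≡0 α≢0
      ... | no _    = 0#-homo
      on : ι (S.1# {k} (replicate k 0)) ≈ 1#
      on with Vec.≡-dec ℕ._≟_ (replicate k 0) (replicate k 0)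
      ... | yes _  = 1#-homo
      ... | no 0≢0 = contradiction ≡.refl 0≢0

    module _ (nilpotent : ∀ i m → N < m → x i ↑ m ≈ 0#) where

      -- The product of the two truncated sums contains pairs β, γ whose sum leaves the box; these
      -- vanish, since some coordinate of x is then raised to a power beyond N.
      eval-* : ∀ f g → eval (f S.* g) ≈ eval f * eval g
      eval-* f g = begin
        ∑ (box k N) (λ α → ι ((f S.* g) α) * monomial x α)
          ≈⟨ ∑-cong (box k N) (λ α → trans (*-congʳ (ι-∑ (below α) _)) (∑-* (below α) _ _)) ⟩
        ∑ (box k N) (λ α → ∑ (below α) (λ β → ι (f β R.* g (α ⊖ β)) * monomial x α))
          ≈⟨ ∑-cong (box k N) (λ α → ∑-cong-∈ (below α) λ β β∈ → trans
               (*-cong (*-homo _ _) (trans (reflexive (cong (monomial x) (≡.sym (⊕-⊖ α β∈)))) (monomial-⊕ x β _)))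
               (interchange _ _ _ _)) ⟩
        ∑ (box k N) (λ α → ∑ (below α) (λ β → F β (α ⊖ β)))
          ≈⟨ ∑-convolution k N F (λ β γ i N< → trans (interchange _ _ _ _) (trans
               (*-congˡ (trans (sym (monomial-⊕ x β γ)) (monomial-nilpotent x nilpotent (β ⊕ γ) i
                  (subst (N <_) (≡.sym (lookup-⊕ β γ i)) N<))))
               (zeroʳ _))) ⟩
        ∑ (box k N) (λ β → ∑ (box k N) (F β))
          ≈⟨ ∑-cong (box k N) (λ β → sym (*-∑ (box k N) _ _)) ⟩
        ∑ (box k N) (λ β → (ι (f β) * monomial x β) * eval g)
          ≈⟨ ∑-* (box k N) _ _ ⟨
        eval f * eval g ∎
        where
        F : Exponent k → Exponent k → Carrier
        F β γ = (ι (f β) * monomial x β) * (ι (g γ) * monomial x γ)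

      eval-↑ : ∀ f m → eval (f SN.↑ m) ≈ eval f ↑ m
      eval-↑ f zero    = eval-1
      eval-↑ f (suc m) = trans (eval-* f _) (*-congˡ (eval-↑ f m))

      eval-monomial : ∀ (g : Vector (Series k) n) β → eval (SN.monomial g β) ≈ monomial (eval ∘ g) β
      eval-monomial g []      = eval-1
      eval-monomial g (b ∷ β) =
        trans (eval-* (g zero SN.↑ b) _) (*-cong (eval-↑ (g zero) b) (eval-monomial (g ∘ suc) β))

      -- The coefficient of the composite at α is a sum over a box that depends on α. Inside the box
      -- of side N the degree of α is at most k·N, so all these boxes may be enlarged to the side
      -- N′: g^β starts in degree ∣β∣, hence the added terms are zero. Then the two sums can be
      -- exchanged.
      eval-⟪⟫ : ∀ (f : Series n) (g : Vector (Series k) n) → (∀ i → HasOrder 1 (g i)) →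
                ∀ {N′} → k ℕ.* N ≤ N′ →
                eval (f ⟪ g ⟫) ≈ evalAt N′ (eval ∘ g) f
      eval-⟪⟫ {n} f g g-ord {N′} kN≤N′ = begin
        ∑ (box k N) (λ α → ι (∑ᴿ (box n (Vec.sum α)) (term α)) * monomial x α)
          ≈⟨ ∑-cong-∈ (box k N) (λ α α∈ → *-congʳ (trans (⟦⟧-cong (enlarge α (small α α∈))) (ι-∑ (box n N′) _))) ⟩
        ∑ (box k N) (λ α → ∑ (box n N′) (λ β → ι (term α β)) * monomial x α)
          ≈⟨ ∑-cong (box k N) (λ α → ∑-* (box n N′) _ _) ⟩
        ∑ (box k N) (λ α → ∑ (box n N′) (λ β → ι (term α β) * monomial x α))
          ≈⟨ ∑-swap (box k N) (box n N′) _ ⟩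
        ∑ (box n N′) (λ β → ∑ (box k N) (λ α → ι (term α β) * monomial x α))
          ≈⟨ ∑-cong (box n N′) (λ β → trans
               (∑-cong (box k N) λ α → trans (*-congʳ (*-homo _ _)) (*-assoc _ _ _))
               (sym (*-∑ (box k N) _ _))) ⟩
        ∑ (box n N′) (λ β → ι (f β) * eval (SN.monomial g β))
          ≈⟨ ∑-cong (box n N′) (λ β → *-congˡ (eval-monomial g β)) ⟩
        ∑ (box n N′) (λ β → ι (f β) * monomial (eval ∘ g) β) ∎
        where
        ∑ᴿ : ∀ {a} {X : Set a} → List X → (X → R.Carrier) → R.Carrier
        ∑ᴿ = RingNotation.∑ R
        term : Exponent k → Exponent n → R.Carrier
        term α β = f β R.* SN.monomial g β α
        small : ∀ α → α ∈ box k N → Vec.sum α ≤ N′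
        small α α∈ = ℕ.≤-trans
          (sum≤ α N λ i → subst (lookup α i ≤_) (Vec.lookup-replicate i N) (∈-below⁻ (replicate k N) α∈ i)) kN≤N′
        enlarge : ∀ α → Vec.sum α ≤ N′ → ∑ᴿ (box n (Vec.sum α)) (term α) R.≈ ∑ᴿ (box n N′) (term α)
        enlarge α α≤N′ = ListSum.∑-box-mono (IsCommutative.bundle isComm) n α≤N′ (term α) λ β i s<β →
            R.trans (R.*-congˡ (order-monomial g-ord β α (ℕ.<-≤-trans s<β (lookup≤sum β i)))) (R.zeroʳ _)

-- Constant and linear terms of series and of [m]

sum-replicate-0 : ∀ n → Vec.sum (replicate n 0) ≡ 0
sum-replicate-0 zero    = ≡.refl
sum-replicate-0 (suc n) = sum-replicate-0 n

sum-unit : ∀ (i : Fin n) → Vec.sum (unit i) ≡ 1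
sum-unit {suc n} zero    = cong suc (sum-replicate-0 n)
sum-unit {suc n} (suc i) = sum-unit i

⊖-identityʳ : ∀ (α : Exponent n) → α ⊖ replicate n 0 ≡ α
⊖-identityʳ []      = ≡.refl
⊖-identityʳ (a ∷ α) = cong (a ∷_) (⊖-identityʳ α)

⊖-self : ∀ (α : Exponent n) → α ⊖ α ≡ replicate n 0
⊖-self []      = ≡.refl
⊖-self (a ∷ α) = cong₂ _∷_ (ℕ.n∸n≡0 a) (⊖-self α)

⊕-identityʳ : ∀ (α : Exponent n) → α ⊕ replicate n 0 ≡ α
⊕-identityʳ []      = ≡.refl
⊕-identityʳ (a ∷ α) = cong₂ _∷_ (ℕ.+-identityʳ a) (⊕-identityʳ α)

0∈below : ∀ (α : Exponent n) → replicate n 0 ∈ below α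
0∈below α = ∈-below⁺ α _ λ i → subst (_≤ lookup α i) (≡.sym (Vec.lookup-replicate i 0)) z≤n

self∈below : ∀ (α : Exponent n) → α ∈ below α
self∈below α = ∈-below⁺ α α λ i → ℕ.≤-refl

unit∈box : ∀ {N} (i : Fin n) → 1 ≤ N → unit i ∈ box n N
unit∈box i 1≤N = ∈-box⁺ (unit i) λ j →
  ℕ.≤-trans (subst (lookup (unit i) j ≤_) (sum-unit i) (lookup≤sum (unit i) j)) 1≤N

module _ {R : RawRing c e} {d} (F : FormalGroupLaw R d) where
  open FormalGroupLaw F
  open PowerSeries R

  -- Definitional; stated so that `multiple-value` can pass to the composite series by an explicit
  -- `subst`.
  multiplication-suc : ∀ m i → multiplication (suc (suc m)) i ≡ law i ⟪ var ++ multiplication (suc m) ⟫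
  multiplication-suc m i = ≡.refl

module LinearPart {R : RawRing c e} (isComm : IsCommutative R) where
  open CommutativeRing (IsCommutative.bundle isComm) hiding (zero)
  open RingNotation R using (∑; _·_)
  open PowerSeries R
  open ListSum (IsCommutative.bundle isComm)
  open Order isComm
  open Monomials (IsCommutative.bundle isComm) using (·-zero)
  open import Algebra.Properties.Monoid.Mult +-monoid using (×-congʳ)
  open import Relation.Binary.Reasoning.Setoid setoid

  private
    module S {k} = RawRing (seriesRing k)
    module SN {k} = RingNotation (seriesRing k)

  const-0 : ∀ r → const {n} r (replicate n 0) ≈ r
  const-0 {n} r with Vec.≡-dec ℕ._≟_ (replicate n 0) (replicate n 0)
  ... | yes _  = refl
  ... | no 0≢0 = contradiction ≡.refl 0≢0

  const-≢0 : ∀ r (α : Exponent n) → α ≢ replicate n 0 → const r α ≈ 0#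
  const-≢0 {n} r α α≢0 with Vec.≡-dec ℕ._≟_ α (replicate n 0)
  ... | yes α≡0 = contradiction α≡0 α≢0
  ... | no _    = refl

  var-unit : ∀ (i : Fin n) → var i (unit i) ≈ 1#
  var-unit i with Vec.≡-dec ℕ._≟_ (unit i) (unit i)
  ... | yes _  = refl
  ... | no u≢u = contradiction ≡.refl u≢u

  var-≢unit : ∀ (i : Fin n) α → α ≢ unit i → var i α ≈ 0#
  var-≢unit i α α≢u with Vec.≡-dec ℕ._≟_ α (unit i)
  ... | yes α≡u = contradiction α≡u α≢u
  ... | no _    = refl

  const-*ₛ : ∀ r (f : Series k) α → (const r S.* f) α ≈ r * f α
  const-*ₛ {k} r f α = trans
    (∑-single (below-unique α) (0∈below α) (λ β → const r β * f (α ⊖ β))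
      λ β _ β≢0 → trans (*-congʳ (const-≢0 r β β≢0)) (zeroˡ _))
    (*-cong (const-0 {k} r) (reflexive (cong f (⊖-identityʳ α))))

  1-*ₛ : ∀ (f : Series k) → S.1# S.* f ≋ f
  1-*ₛ f α = trans (const-*ₛ 1# f α) (*-identityˡ _)

  *ₛ-1 : ∀ (f : Series k) → f S.* S.1# ≋ f
  *ₛ-1 {k} f α = trans
    (∑-single (below-unique α) (self∈below α) (λ β → f β * S.1# (α ⊖ β))
      λ β β∈ β≢α → trans (*-congˡ (const-≢0 1# (α ⊖ β) λ eq → β≢α
        (≡.trans (≡.sym (⊕-identityʳ β)) (≡.trans (cong (β ⊕_) (≡.sym eq)) (⊕-⊖ α β∈))))) (zeroʳ _))
    (trans (*-congˡ (trans (reflexive (cong S.1# (⊖-self α))) (const-0 {k} 1#))) (*-identityʳ _))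

  *ₛ-cong : ∀ {f f′ g g′ : Series k} → f ≋ f′ → g ≋ g′ → f S.* g ≋ f′ S.* g′
  *ₛ-cong f≋f′ g≋g′ α = ∑-cong (below α) λ β → *-cong (f≋f′ β) (g≋g′ (α ⊖ β))

  monomialₛ-0 : ∀ n (g : Vector (Series k) n) → SN.monomial g (replicate n 0) ≋ S.1#
  monomialₛ-0 zero    g α = refl
  monomialₛ-0 (suc n) g α = trans (1-*ₛ (SN.monomial (g ∘ suc) (replicate n 0)) α) (monomialₛ-0 n (g ∘ suc) α)

  monomialₛ-unit : ∀ (g : Vector (Series k) n) i → SN.monomial g (unit i) ≋ g i
  monomialₛ-unit {n = suc n} g zero α = trans
    (*ₛ-cong (*ₛ-1 (g zero)) (monomialₛ-0 n (g ∘ suc)) α) (*ₛ-1 (g zero) α)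
  monomialₛ-unit {n = suc n} g (suc i) α = trans (1-*ₛ (SN.monomial (g ∘ suc) (unit i)) α) (monomialₛ-unit (g ∘ suc) i α)

  var-order : ∀ (i : Fin n) → HasOrder 1 (var i)
  var-order i α α<1 = var-≢unit i α λ α≡u →
    ℕ.<-irrefl ≡.refl (subst (_< 1) (≡.trans (cong Vec.sum α≡u) (sum-unit i)) α<1)

  ∑-var : ∀ (i : Fin n) {N} → 1 ≤ N → (f : Exponent n → Carrier) →
          ∑ (box n N) (λ β → var i β * f β) ≈ f (unit i)
  ∑-var i {N} 1≤N f = trans
    (∑-single (below-unique (replicate _ N)) (unit∈box i 1≤N) (λ β → var i β * f β)
      λ β _ β≢u → trans (*-congʳ (var-≢unit i β β≢u)) (zeroˡ _))
    (trans (*-congʳ (var-unit i)) (*-identityˡ _))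

  module _ {d} (F : FormalGroupLaw R d) where
    open FormalGroupLaw F
    open Variables R d

    -- Series without constant term turn monomials of degree at least 2 into series of order at
    -- least 2, which do not reach α; on the remaining monomials the law is X + Y.
    apply-linear : ∀ {g h : Vector (Series k) d} → (∀ i → HasOrder 1 (g i)) → (∀ i → HasOrder 1 (h i)) →
                   ∀ i α → Vec.sum α ≤ 1 → apply g h i α ≈ g i α + h i α
    apply-linear {k} {g} {h} g-ord h-ord i α α≤1 = begin
      ∑ (box (d ℕ.+ d) (Vec.sum α)) (λ β → law i β * M β)
        ≈⟨ ∑-cong (box (d ℕ.+ d) (Vec.sum α)) truncate ⟩
      ∑ (box (d ℕ.+ d) (Vec.sum α)) (λ β → (X₂ i β + Y₂ i β) * M β)
        ≈⟨ ∑-box-mono (d ℕ.+ d) α≤1 _ (λ β j α<β → trans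
             (*-congˡ (M≈0 β (ℕ.<-≤-trans α<β (lookup≤sum β j)))) (zeroʳ _)) ⟩
      ∑ (box (d ℕ.+ d) 1) (λ β → (X₂ i β + Y₂ i β) * M β)
        ≈⟨ ∑-cong (box (d ℕ.+ d) 1) (λ β → distribʳ _ _ _) ⟩
      ∑ (box (d ℕ.+ d) 1) (λ β → X₂ i β * M β + Y₂ i β * M β)
        ≈⟨ ∑-+ (box (d ℕ.+ d) 1) (λ β → X₂ i β * M β) (λ β → Y₂ i β * M β) ⟩
      ∑ (box (d ℕ.+ d) 1) (λ β → X₂ i β * M β) + ∑ (box (d ℕ.+ d) 1) (λ β → Y₂ i β * M β)
        ≈⟨ +-cong (∑-var (i ↑ˡ d) ℕ.≤-refl M) (∑-var (d ↑ʳ i) ℕ.≤-refl M) ⟩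
      M (unit (i ↑ˡ d)) + M (unit (d ↑ʳ i))
        ≈⟨ +-cong (monomialₛ-unit (g ++ h) (i ↑ˡ d) α) (monomialₛ-unit (g ++ h) (d ↑ʳ i) α) ⟩
      (g ++ h) (i ↑ˡ d) α + (g ++ h) (d ↑ʳ i) α
        ≡⟨ cong₂ (λ s t → Sum.[_,_] {C = λ _ → Series k} g h s α + Sum.[_,_] {C = λ _ → Series k} g h t α) (Fin.splitAt-↑ˡ d i d) (Fin.splitAt-↑ʳ d d i) ⟩
      g i α + h i α ∎
      where
      M : Exponent (d ℕ.+ d) → Carrier
      M β = SN.monomial (g ++ h) β α
      gh-ord : ∀ j → HasOrder 1 ((g ++ h) j)
      gh-ord j with splitAt d j
      ... | inj₁ l = g-ord l
      ... | inj₂ l = h-ord l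
      M≈0 : ∀ β → Vec.sum α < Vec.sum β → M β ≈ 0#
      M≈0 β = order-monomial gh-ord β α
      truncate : ∀ β → law i β * M β ≈ (X₂ i β + Y₂ i β) * M β
      truncate β with Vec.sum β ℕ.≤? 1
      ... | yes β≤1 = *-congʳ (linear i β β≤1)
      ... | no  β≰1 = trans (trans (*-congˡ M≈) (zeroʳ _)) (sym (trans (*-congˡ M≈) (zeroʳ _)))
        where M≈ = M≈0 β (ℕ.≤-<-trans α≤1 (ℕ.≰⇒> β≰1))

    mutual
      -- The absence of a constant term is read off from the linear part of [m], whose recursion in
      -- turn needs it for the preceding multiple.
      multiplication-order : ∀ m i → HasOrder 1 (multiplication m i)
      multiplication-order m i α α<1 = trans (multiplication-linear m i α (ℕ.<⇒≤ α<1))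
        (trans (×-congʳ m (var-order i α α<1)) (·-zero m))

      multiplication-linear : ∀ m i α → Vec.sum α ≤ 1 → multiplication m i α ≈ m · var i α
      multiplication-linear 0             i α α≤1 = refl
      multiplication-linear 1             i α α≤1 = sym (+-identityʳ _)
      multiplication-linear (suc (suc m)) i α α≤1 = trans
        (apply-linear var-order (multiplication-order (suc m)) i α α≤1)
        (+-congˡ (multiplication-linear (suc m) i α α≤1))

-- ℓ-adic integers

≡-%ℕ : ∀ {m} .{{_ : NonZero m}} z → z ≡ + (z %ℕ m) [mod m ]
≡-%ℕ {m} z = congruent (divides (z /ℕ m) (≡.trans (cong (ℤ._- + (z %ℕ m)) (a≡a%ℕn+[a/ℕn]*n z m))
  (cancel (+ (z %ℕ m)) ((z /ℕ m) ℤ.* + m))))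
  where
  cancel : ∀ a b → (a ℤ.+ b) ℤ.- a ≡ b
  cancel = solve-∀

-- Bézout for ℓ and the remainder of z, which is nonzero and below ℓ. Over ℕ the identity has two
-- shapes, giving u = -y and u = y.
invertible-mod-prime : ∀ {ℓ} → Prime ℓ → ∀ z → ¬ (z ≡ + 0 [mod ℓ ]) → ∃[ u ] (u ℤ.* z) ≡ + 1 [mod ℓ ]
invertible-mod-prime {ℓ} ℓ-prime z z≢0 = helper (z %ℕ ℓ) ≡.refl
  where
  instance _ = prime⇒nonZero ℓ-prime
  z≡r : z ≡ + (z %ℕ ℓ) [mod ℓ ]
  z≡r = ≡-%ℕ z
  helper : ∀ r → r ≡ z %ℕ ℓ → ∃[ u ] (u ℤ.* z) ≡ + 1 [mod ℓ ]
  helper zero    r≡ = contradiction (subst (λ r → z ≡ + r [mod ℓ ]) (≡.sym r≡) z≡r) z≢0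
  helper (suc r) r≡ = bezout (coprime-Bézout (prime⇒coprime ℓ-prime (subst (_< ℓ) (≡.sym r≡) (n%ℕd<d z ℓ))))
    where
    z≡r′ : z ≡ + suc r [mod ℓ ]
    z≡r′ = subst (λ r → z ≡ + r [mod ℓ ]) (≡.sym r≡) z≡r
    bezout : Bézout.Identity 1 ℓ (suc r) → ∃[ u ] (u ℤ.* z) ≡ + 1 [mod ℓ ]
    bezout (Bézout.+- x y eq) = ℤ.- + y , mod-trans {y = ℤ.- + y ℤ.* + suc r} (mod-* {x = ℤ.- + y} {u = z} (mod-reflexive ≡.refl) z≡r′)
      (congruent (divides (ℤ.- + x) (≡.trans (rearrange (+ y) (+ suc r)) (≡.trans
        (cong ℤ.-_ (≡.trans (cong (λ w → + 1 ℤ.+ w) (≡.sym (ℤ.pos-* y (suc r)))) (≡.trans (cong +_ eq) (ℤ.pos-* x ℓ))))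
        (ℤ.neg-distribˡ-* (+ x) (+ ℓ))))))
      where
      rearrange : ∀ y r → (ℤ.- y) ℤ.* r ℤ.- + 1 ≡ ℤ.- (+ 1 ℤ.+ y ℤ.* r)
      rearrange = solve-∀
    bezout (Bézout.-+ x y eq) = + y , mod-trans {y = + y ℤ.* + suc r} (mod-* {x = + y} {u = z} (mod-reflexive ≡.refl) z≡r′)
      (congruent (divides (+ x) (≡.trans
        (cong (ℤ._- + 1) (≡.trans (≡.sym (ℤ.pos-* y (suc r))) (≡.trans (cong +_ (≡.sym eq)) (cong (λ w → + 1 ℤ.+ w) (ℤ.pos-* x ℓ)))))
        (rearrange (+ x ℤ.* + ℓ)))))
      where
      rearrange : ∀ a → + 1 ℤ.+ a ℤ.- + 1 ≡ a
      rearrange = solve-∀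

multiple : ∀ {m z} → z ≡ + 0 [mod m ] → ∃[ q ] z ≡ q ℤ.* + m
multiple {z = z} (congruent (divides q eq)) = q , ≡.trans (≡.sym (ℤ.+-identityʳ z)) eq

multiple-cancel : ∀ {k m a b} .{{_ : NonZero m}} →
                  (a ℤ.* + m) ≡ (b ℤ.* + m) [mod m ℕ.* k ] → a ≡ b [mod k ]
multiple-cancel {k} {m@(suc _)} {a} {b} (congruent (divides q eq)) =
  congruent (divides q (ℤ.*-cancelʳ-≡ (a ℤ.- b) (q ℤ.* + k) (+ m) (≡.trans (factor a b (+ m))
    (≡.trans eq (≡.trans (cong (q ℤ.*_) (≡.trans (ℤ.pos-* m k) (ℤ.*-comm (+ m) (+ k)))) (≡.sym (ℤ.*-assoc q (+ k) (+ m))))))))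
  where
  factor : ∀ a b c → (a ℤ.- b) ℤ.* c ≡ a ℤ.* c ℤ.- b ℤ.* c
  factor = solve-∀

mod-weaken : ∀ {k m x y} → x ≡ y [mod m ℕ.* k ] → x ≡ y [mod m ]
mod-weaken {k} {m} (congruent (divides q eq)) = congruent (divides (q ℤ.* + k) (≡.trans eq
  (≡.trans (cong (q ℤ.*_) (≡.trans (ℤ.pos-* m k) (ℤ.*-comm (+ m) (+ k)))) (≡.sym (ℤ.*-assoc q (+ k) (+ m))))))

module _ {ℓ : ℕ} where

  open CommutativeRing (ℤ-adic ℓ) using (_≈_; _*_; 1#; _-_)
  open RingNotation (ℤₗ ℓ) using (_·_)

  fromℤ : ℤ → AdicInteger ℓ
  fromℤ z = record { residue = λ _ → z ; coherent = λ _ → mod-reflexive ≡.refl }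

  residue-· : ∀ m z n → residue (m · z) n ≡ + m ℤ.* residue z n
  residue-· zero    z n = ≡.sym (ℤ.*-zeroˡ (residue z n))
  residue-· (suc m) z n = ≡.trans (cong (λ w → residue z n ℤ.+ w) (residue-· m z n)) (≡.sym (ℤ.suc-* (+ m) (residue z n)))

  residue-1 : ∀ (z : AdicInteger ℓ) n → residue z (suc n) ≡ residue z 1 [mod ℓ ]
  residue-1 z zero    = mod-reflexive ≡.refl
  residue-1 z (suc n) =
    mod-trans {x = residue z (suc (suc n))} (mod-weaken {k = ℓ ^ n} (coherent z (suc n))) (residue-1 z n)

  -- Division by ℓ costs one level of precision: residue n of the quotient is residue n + 1 of z
  -- divided by ℓ, and `multiple-cancel` turns coherence modulo ℓ^(n+1) into coherence modulo ℓ^n.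
  divide : .{{_ : NonZero ℓ}} → ∀ z → residue z 1 ≡ + 0 [mod ℓ ] → ∃[ w ] z ≈ ℓ · w
  divide z z₁≡0 = helper λ n → multiple (mod-trans {x = residue z (suc n)} {y = residue z 1} {z = + 0} (residue-1 z n) z₁≡0)
    where
    helper : (∀ n → ∃[ q ] residue z (suc n) ≡ q ℤ.* + ℓ) → ∃[ w ] z ≈ ℓ · w
    helper quotients = w , λ n → mod-trans {y = residue z (suc n)} (mod-sym {x = residue z (suc n)} {y = residue z n} (coherent z n))
      (mod-reflexive (≡.trans (w-eq n) (≡.trans (ℤ.*-comm (residue w n) (+ ℓ)) (≡.sym (residue-· ℓ w n)))))
      where
      w-eq : ∀ n → residue z (suc n) ≡ proj₁ (quotients n) ℤ.* + ℓ
      w-eq n = proj₂ (quotients n)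

      w : AdicInteger ℓ
      w = record
        { residue  = λ n → proj₁ (quotients n)
        ; coherent = λ n → multiple-cancel (subst₂ (_≡_[mod ℓ ^ suc n ]) (w-eq (suc n)) (w-eq n) (coherent z (suc n)))
        }

  -- A constant integer inverse modulo ℓ is enough: the error ℓ·w strictly raises valuations, and
  -- `gt-ι-cancel` absorbs it.
  invert : Prime ℓ → ∀ z → ¬ (residue z 1 ≡ + 0 [mod ℓ ]) → ∃[ u ] ∃[ w ] u * z - 1# ≈ ℓ · w
  invert ℓ-prime z z₁≢0 = helper (invertible-mod-prime ℓ-prime (residue z 1) z₁≢0)
    where
    instance _ = prime⇒nonZero ℓ-prime
    helper : ∃[ u ] (u ℤ.* residue z 1) ≡ + 1 [mod ℓ ] → ∃[ u ] ∃[ w ] u * z - 1# ≈ ℓ · w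
    helper (u , uz≡1) = fromℤ u , divide (fromℤ u * z - 1#)
      (mod-+ {x = u ℤ.* residue z 1} {y = + 1} {u = ℤ.- + 1} {w = ℤ.- + 1} uz≡1 (mod-reflexive ≡.refl))

-- Valuations

-- Opaque, because the type checker would otherwise unfold the normalisation of
-- fractions when comparing bounds on valuations.
opaque
  infixl 6 _⊞_
  _⊞_ : ℚ → ℚ → ℚ
  _⊞_ = ℚ._+_

  +∞-⊞ : ∀ s t → [ s ] +∞ [ t ] ≡ [ s ⊞ t ]
  +∞-⊞ s t = ≡.refl

  ⊞-assoc : ∀ r s t → (r ⊞ s) ⊞ t ≡ r ⊞ (s ⊞ t)
  ⊞-assoc = ℚ.+-assoc

  ⊞-comm : ∀ s t → s ⊞ t ≡ t ⊞ s
  ⊞-comm = ℚ.+-comm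

  ⊞-identityˡ : ∀ t → 0ℚ ⊞ t ≡ t
  ⊞-identityˡ = ℚ.+-identityˡ

  ⊞-identityʳ : ∀ t → t ⊞ 0ℚ ≡ t
  ⊞-identityʳ = ℚ.+-identityʳ

  ⊞-mono-≤ : ∀ {r s t u} → r ℚ.≤ s → t ℚ.≤ u → r ⊞ t ℚ.≤ s ⊞ u
  ⊞-mono-≤ = ℚ.+-mono-≤

  ⊞-mono-<-≤ : ∀ {r s t u} → r ℚ.< s → t ℚ.≤ u → r ⊞ t ℚ.< s ⊞ u
  ⊞-mono-<-≤ = ℚ.+-mono-<-≤

  ⊞-mono-≤-< : ∀ {r s t u} → r ℚ.≤ s → t ℚ.< u → r ⊞ t ℚ.< s ⊞ u
  ⊞-mono-≤-< = ℚ.+-mono-≤-<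

  ⊞-cancelˡ-≤ : ∀ r {s t} → r ⊞ s ℚ.≤ r ⊞ t → s ℚ.≤ t
  ⊞-cancelˡ-≤ r {s} {t} r+s≤r+t = ℚ.≮⇒≥ λ t<s → ℚ.<-irrefl ≡.refl (ℚ.<-≤-trans (ℚ.+-monoʳ-< r t<s) r+s≤r+t)

infixl 7 _⋆_
-- Repeated addition follows the recursion of `_↑_`, so that valuations of powers are computed step
-- by step.
_⋆_ : ℕ → ℚ → ℚ
zero  ⋆ t = 0ℚ
suc m ⋆ t = t ⊞ m ⋆ t

⋆-+ : ∀ t m n → (m ℕ.+ n) ⋆ t ≡ m ⋆ t ⊞ n ⋆ t
⋆-+ t zero    n = ≡.sym (⊞-identityˡ (n ⋆ t))
⋆-+ t (suc m) n = ≡.trans (cong (t ⊞_) (⋆-+ t m n)) (≡.sym (⊞-assoc t (m ⋆ t) (n ⋆ t)))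

⋆-mono-≤ : ∀ m → s ℚ.≤ t → m ⋆ s ℚ.≤ m ⋆ t
⋆-mono-≤ zero    s≤t = ℚ.≤-refl
⋆-mono-≤ (suc m) s≤t = ⊞-mono-≤ s≤t (⋆-mono-≤ m s≤t)

⋆-mono-< : ∀ m → s ℚ.< t → suc m ⋆ s ℚ.< suc m ⋆ t
⋆-mono-< m s<t = ⊞-mono-<-≤ s<t (⋆-mono-≤ m (ℚ.<⇒≤ s<t))

⋆-nonNeg : ∀ m → 0ℚ ℚ.≤ t → 0ℚ ℚ.≤ m ⋆ t
⋆-nonNeg zero    0≤t = ℚ.≤-refl
⋆-nonNeg {t} (suc m) 0≤t = subst (ℚ._≤ suc m ⋆ t) (⊞-identityʳ 0ℚ) (⊞-mono-≤ 0≤t (⋆-nonNeg m 0≤t))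

⋆-monoˡ-≤ : ∀ {m m′} → 0ℚ ℚ.≤ t → m ≤ m′ → m ⋆ t ℚ.≤ m′ ⋆ t
⋆-monoˡ-≤ {m′ = m′} 0≤t z≤n          = ⋆-nonNeg m′ 0≤t
⋆-monoˡ-≤           0≤t (s≤s m≤m′)   = ⊞-mono-≤ ℚ.≤-refl (⋆-monoˡ-≤ 0≤t m≤m′)

p<r⊞p : ∀ r p → 0ℚ ℚ.< r → p ℚ.< r ⊞ p
p<r⊞p r p 0<r = subst (ℚ._< r ⊞ p) (⊞-identityˡ p) (⊞-mono-<-≤ 0<r ℚ.≤-refl)

0<1 : 0ℚ ℚ.< 1ℚ
0<1 = ℚ.positive⁻¹ 1ℚ

-- The denominator is at least 1, so the absolute value of the numerator is a bound. It converts
-- rational thresholds into the natural precisions of `HasValue`.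
≤-natural : ∀ t → ∃[ m ] t ℚ.≤ (+ m) ℚ./ 1
≤-natural t = ℤ.∣ ℚ.↥ t ∣ , ℚ.toℚᵘ-cancel-≤ (ℚᵘ.≤-respʳ-≃ (ℚᵘ.≃-sym (ℚ.toℚᵘ-fromℚᵘ (ℚᵘ.mkℚᵘ (+ ℤ.∣ ℚ.↥ t ∣) 0))) (bound t))
  where
  i≤∣i∣ : ∀ i → i ℤ.≤ + ℤ.∣ i ∣
  i≤∣i∣ (+ _)    = ℤ.≤-refl
  i≤∣i∣ -[1+ _ ] = ℤ.-≤+
  bound : ∀ t → ℚ.toℚᵘ t ℚᵘ.≤ ℚᵘ.mkℚᵘ (+ ℤ.∣ ℚ.↥ t ∣) 0
  bound t@(mkℚ i d _) = ℚᵘ.*≤* (subst₂ ℤ._≤_ (≡.sym (ℤ.*-identityʳ i)) (ℤ.pos-* ℤ.∣ i ∣ (suc d))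
    (ℤ.≤-trans (i≤∣i∣ i) (ℤ.+≤+ (ℕ.m≤m*n ℤ.∣ i ∣ (suc d)))))

opaque
  unfolding _⊞_

  ⋆-*ℚ : ∀ t m → (m ⋆ 1ℚ) ℚ.* t ≡ m ⋆ t
  ⋆-*ℚ t zero    = ℚ.*-zeroˡ t
  ⋆-*ℚ t (suc m) = ≡.trans (ℚ.*-distribʳ-+ t 1ℚ (m ⋆ 1ℚ)) (cong₂ ℚ._+_ (ℚ.*-identityˡ t) (⋆-*ℚ t m))

  natural-⋆ : ∀ m → (+ m) ℚ./ 1 ≡ m ⋆ 1ℚ
  natural-⋆ zero    = ≡.refl
  natural-⋆ (suc m) = ≡.trans (ℚ.fromℚᵘ-cong {ℚᵘ.mkℚᵘ (+ suc m) 0} {ℚᵘ.1ℚᵘ ℚᵘ.+ ℚᵘ.mkℚᵘ (+ m) 0}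
     (ℚᵘ.*≡* (cong (ℤ._* + 1) (cong₂ ℤ._+_ {+ 1} ≡.refl (≡.sym (ℤ.*-identityʳ (+ m)))))))
   (≡.trans (ℚ.toℚᵘ-injective (ℚᵘ.≃-trans (ℚ.toℚᵘ-fromℚᵘ (ℚᵘ.1ℚᵘ ℚᵘ.+ ℚᵘ.mkℚᵘ (+ m) 0))
     (ℚᵘ.≃-trans (ℚᵘ.+-congʳ ℚᵘ.1ℚᵘ (ℚᵘ.≃-sym (ℚ.toℚᵘ-fromℚᵘ (ℚᵘ.mkℚᵘ (+ m) 0))))
       (ℚᵘ.≃-sym (ℚ.toℚᵘ-homo-+ 1ℚ ((+ m) ℚ./ 1))))))
   (cong (1ℚ ℚ.+_) (natural-⋆ m)))

archimedean : ∀ s → 0ℚ ℚ.< t → ∃[ m ] s ℚ.≤ m ⋆ t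
archimedean {t} s 0<t = helper (≤-natural (s ℚ.* ℚ.1/ t))
  where
  instance
    t-pos : ℚ.Positive t
    t-pos = ℚ.positive 0<t
    t-nz : ℚ.NonZero t
    t-nz = ℚ.pos⇒nonZero t
    t-nn : ℚ.NonNegative t
    t-nn = ℚ.pos⇒nonNeg t
  helper : (∃[ m ] s ℚ.* ℚ.1/ t ℚ.≤ (+ m) ℚ./ 1) → ∃[ m ] s ℚ.≤ m ⋆ t
  helper (m , le) = m , subst₂ ℚ._≤_
    (≡.trans (ℚ.*-assoc s (ℚ.1/ t) t) (≡.trans (cong (s ℚ.*_) (ℚ.*-inverseˡ t)) (ℚ.*-identityʳ s)))
    (≡.trans (cong (ℚ._* t) (natural-⋆ m)) (⋆-*ℚ t m))
    (ℚ.*-monoʳ-≤-nonNeg t le)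

module Differences (R : CommutativeRing c e) where
  open CommutativeRing R
  open import Algebra.Properties.Ring ring public using (x[y-z]≈xy-xz; [y-z]x≈yx-zx; -1*x≈-x; -‿distribˡ-*)
  open import Algebra.Properties.AbelianGroup +-abelianGroup public
    using (⁻¹-anti-homo‿-; ⁻¹-∙-comm; x≈y⇒x∙y⁻¹≈ε; x∙y⁻¹≈ε⇒x≈y; ε⁻¹≈ε)
  open import Algebra.Properties.CommutativeSemigroup +-commutativeSemigroup using (interchange)

  [x-y]+[y-z]≈x-z : ∀ x y z → (x - y) + (y - z) ≈ x - z
  [x-y]+[y-z]≈x-z x y z = trans (+-assoc x (- y) (y - z))
    (+-congˡ (trans (sym (+-assoc (- y) y (- z))) (trans (+-congʳ (-‿inverseˡ y)) (+-identityˡ (- z)))))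

  [x+y]-[z+w]≈[x-z]+[y-w] : ∀ x y z w → (x + y) - (z + w) ≈ (x - z) + (y - w)
  [x+y]-[z+w]≈[x-z]+[y-w] x y z w = trans (+-congˡ (sym (⁻¹-∙-comm z w))) (interchange x y (- z) (- w))

  xy-zw≈[x-z]y+z[y-w] : ∀ x y z w → x * y - z * w ≈ (x - z) * y + z * (y - w)
  xy-zw≈[x-z]y+z[y-w] x y z w =
    sym (trans (+-cong ([y-z]x≈yx-zx y x z) (x[y-z]≈xy-xz z y w)) ([x-y]+[y-z]≈x-z (x * y) (z * y) (z * w)))

  x-x≈0 : ∀ x → x - x ≈ 0#
  x-x≈0 = -‿inverseʳ

  [x-y]+y≈x : ∀ x y → (x - y) + y ≈ x
  [x-y]+y≈x x y = trans (+-assoc x (- y) y) (trans (+-congˡ (-‿inverseˡ y)) (+-identityʳ x))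

  x-0≈x : ∀ x → x - 0# ≈ x
  x-0≈x x = trans (+-congˡ ε⁻¹≈ε) (+-identityʳ x)

module Valued {ℓ : ℕ} {K : AlgebraicClosure ℓ c e} (V : Valuation K) where
  open AlgebraicClosure K hiding (zero)
  open AlgebraicClosure K using () renaming (ring to K-ring)
  open Valuation V
  open Differences K-ring
  open Monomials K-ring
  private
    module ι = RingMorphisms.IsRingMonomorphism ι-mono
    module ℤ_ℓ = CommutativeRing (ℤ-adic ℓ)

  -- Estimates are lower bounds by a rational, so that a vanishing term, of value ∞, needs no
  -- separate treatment. Exact values appear where a bound is to be contradicted.
  Ge Gt : ℚ → Carrier → Set
  Ge t x = [ t ] ≤∞ v x
  Gt t x = [ t ] <∞ v x

  ge-cong : ∀ {x y} → x ≈ y → Ge t x → Ge t y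
  ge-cong x≈y = subst ([ _ ] ≤∞_) (v-cong x≈y)

  gt-cong : ∀ {x y} → x ≈ y → Gt t x → Gt t y
  gt-cong x≈y = subst ([ _ ] <∞_) (v-cong x≈y)

  ge-trans : ∀ {x} → s ℚ.≤ t → Ge t x → Ge s x
  ge-trans s≤t = NonStrict.≤⁺-trans ℚ._≤_ ℚ.≤-trans NonStrict.[ s≤t ]

  ge⇒gt : ∀ {x} → s ℚ.< t → Ge t x → Gt s x
  ge⇒gt s<t = Strict.<⁺-transˡ ℚ._<_ ℚ.<-≤-trans Strict.[ s<t ]

  gt⇒ge : ∀ {x} → Gt t x → Ge t x
  gt⇒ge {x = x} lt with v x
  gt⇒ge Strict.[ t<s ] | [ _ ] = NonStrict.[ ℚ.<⇒≤ t<s ]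
  gt⇒ge _              | ⊤⁺    = _ NonStrict.≤⊤⁺

  ge-0 : ∀ {x} → x ≈ 0# → Ge t x
  ge-0 {x = x} x≈0 = subst ([ _ ] ≤∞_) (≡.sym (Equivalence.from (v-zero x) x≈0)) (_ NonStrict.≤⊤⁺)

  gt-0 : ∀ {x} → x ≈ 0# → Gt t x
  gt-0 {x = x} x≈0 = subst ([ _ ] <∞_) (≡.sym (Equivalence.from (v-zero x) x≈0)) Strict.[ _ ]<⊤⁺

  private
    ≤-⊓ : ∀ {u w} → [ t ] ≤∞ u → [ t ] ≤∞ w → [ t ] ≤∞ u ⊓∞ w
    ≤-⊓ {u = [ p ]} {[ q ]} NonStrict.[ t≤p ] NonStrict.[ t≤q ] with ℚ.⊓-sel p q
    ... | inj₁ eq = NonStrict.[ subst (_ ℚ.≤_) (≡.sym eq) t≤p ]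
    ... | inj₂ eq = NonStrict.[ subst (_ ℚ.≤_) (≡.sym eq) t≤q ]
    ≤-⊓ {u = [ p ]} {⊤⁺}    le _  = le
    ≤-⊓ {u = ⊤⁺}            _  le = le

    <-⊓ : ∀ {u w} → [ t ] <∞ u → [ t ] <∞ w → [ t ] <∞ u ⊓∞ w
    <-⊓ {u = [ p ]} {[ q ]} Strict.[ t<p ] Strict.[ t<q ] with ℚ.⊓-sel p q
    ... | inj₁ eq = Strict.[ subst (_ ℚ.<_) (≡.sym eq) t<p ]
    ... | inj₂ eq = Strict.[ subst (_ ℚ.<_) (≡.sym eq) t<q ]
    <-⊓ {u = [ p ]} {⊤⁺}    lt _  = lt
    <-⊓ {u = ⊤⁺}            _  lt = lt

    ≤-+ : ∀ {u w} → [ s ] ≤∞ u → [ t ] ≤∞ w → [ s ⊞ t ] ≤∞ u +∞ w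
    ≤-+ {s} {t} {u = [ p ]} {[ q ]} NonStrict.[ le ] NonStrict.[ le′ ] =
      subst ([ s ⊞ t ] ≤∞_) (≡.sym (+∞-⊞ p q)) NonStrict.[ ⊞-mono-≤ le le′ ]
    ≤-+ {u = [ p ]} {⊤⁺}    _  _                = _ NonStrict.≤⊤⁺
    ≤-+ {u = ⊤⁺}            _  _                = _ NonStrict.≤⊤⁺

    <-+ : ∀ {u w} → [ s ] <∞ u → [ t ] ≤∞ w → [ s ⊞ t ] <∞ u +∞ w
    <-+ {s} {t} {u = [ p ]} {[ q ]} Strict.[ lt ] NonStrict.[ le ] =
      subst ([ s ⊞ t ] <∞_) (≡.sym (+∞-⊞ p q)) Strict.[ ⊞-mono-<-≤ lt le ]
    <-+ {u = [ p ]} {⊤⁺}    _  _                = Strict.[ _ ]<⊤⁺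
    <-+ {u = ⊤⁺}            _  _                = Strict.[ _ ]<⊤⁺

  ge-+ : ∀ {x y} → Ge t x → Ge t y → Ge t (x + y)
  ge-+ {x = x} {y} p q = NonStrict.≤⁺-trans ℚ._≤_ ℚ.≤-trans (≤-⊓ p q) (v-+ x y)

  gt-+ : ∀ {x y} → Gt t x → Gt t y → Gt t (x + y)
  gt-+ {x = x} {y} p q = Strict.<⁺-transˡ ℚ._<_ ℚ.<-≤-trans (<-⊓ p q) (v-+ x y)

  ge-* : ∀ {x y} → Ge s x → Ge t y → Ge (s ⊞ t) (x * y)
  ge-* {x = x} {y} p q = subst ([ _ ] ≤∞_) (≡.sym (v-* x y)) (≤-+ p q)

  gt-* : ∀ {x y} → Gt s x → Ge t y → Gt (s ⊞ t) (x * y)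
  gt-* {x = x} {y} p q = subst ([ _ ] <∞_) (≡.sym (v-* x y)) (<-+ p q)

  ge-*ˡ : ∀ {x y} → Ge 0ℚ x → Ge t y → Ge t (x * y)
  ge-*ˡ {t = t} {x} {y} p q = subst (λ t → Ge t (x * y)) (⊞-identityˡ t) (ge-* p q)

  ge-*ʳ : ∀ {x y} → Ge t x → Ge 0ℚ y → Ge t (x * y)
  ge-*ʳ {t = t} {x} {y} p q = subst (λ t → Ge t (x * y)) (⊞-identityʳ t) (ge-* p q)

  gt-*ʳ : ∀ {x y} → Gt t x → Ge 0ℚ y → Gt t (x * y)
  gt-*ʳ {t = t} {x} {y} p q = subst (λ t → Gt t (x * y)) (⊞-identityʳ t) (gt-* p q)

  gt-*ˡ : ∀ {x y} → Ge 0ℚ x → Gt t y → Gt t (x * y)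
  gt-*ˡ {x = x} {y} p q = gt-cong (*-comm y x) (gt-*ʳ q p)

  ge-1 : Ge 0ℚ 1#
  ge-1 = ge-cong ι.1#-homo (v-integral ℤ_ℓ.1#)

  private
    -- The element -1 comes from ℤ_ℓ, where `v-integral` applies.
    ge-[-1] : Ge 0ℚ (- 1#)
    ge-[-1] = ge-cong (trans (ι.-‿homo ℤ_ℓ.1#) (-‿cong ι.1#-homo)) (v-integral (ℤ_ℓ.- ℤ_ℓ.1#))

  ge-neg : ∀ {x} → Ge t x → Ge t (- x)
  ge-neg {x = x} p = ge-cong (-1*x≈-x x) (ge-*ˡ ge-[-1] p)

  gt-neg : ∀ {x} → Gt t x → Gt t (- x)
  gt-neg {x = x} p = gt-cong (-1*x≈-x x) (gt-*ˡ ge-[-1] p)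

  ge-∑ : ∀ (xs : List A) {f : A → Carrier} → (∀ x → x ∈ xs → Ge t (f x)) → Ge t (∑ xs f)
  ge-∑ []       p = ge-0 refl
  ge-∑ (x ∷ xs) p = ge-+ (p x (here ≡.refl)) (ge-∑ xs λ y y∈ → p y (there y∈))

  gt-∑ : ∀ (xs : List A) {f : A → Carrier} → (∀ x → x ∈ xs → Gt t (f x)) → Gt t (∑ xs f)
  gt-∑ []       p = gt-0 refl
  gt-∑ (x ∷ xs) p = gt-+ (p x (here ≡.refl)) (gt-∑ xs λ y y∈ → p y (there y∈))

  ge-· : ∀ m {x} → Ge t x → Ge t (m · x)
  ge-· zero    p = ge-0 refl
  ge-· (suc m) p = ge-+ p (ge-· m p)

  ge-↑ : ∀ m {x} → Ge t x → Ge (m ⋆ t) (x ↑ m)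
  ge-↑ zero    p = ge-1
  ge-↑ {t = t} (suc m) p = ge-* {s = t} {t = m ⋆ t} p (ge-↑ m p)

  ge-monomial : ∀ {x : Vector Carrier n} → (∀ i → Ge t (x i)) → ∀ α → Ge (Vec.sum α ⋆ t) (monomial x α)
  ge-monomial {t = t} p []      = ge-1
  ge-monomial {t = t} {x} p (a ∷ α) = subst (λ s → Ge s (monomial x (a ∷ α))) (≡.sym (⋆-+ t a (Vec.sum α)))
    (ge-* {s = a ⋆ t} {t = Vec.sum α ⋆ t} (ge-↑ a (p zero)) (ge-monomial (p ∘ suc) α))

  gt-irrefl : ∀ {x} → v x ≡ [ t ] → ¬ Gt t x
  gt-irrefl eq p with subst ([ _ ] <∞_) eq p
  ... | Strict.[ t<t ] = ℚ.<-irrefl ≡.refl t<t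

  v-↑ : ∀ m {x} → v x ≡ [ t ] → v (x ↑ suc m) ≡ [ suc m ⋆ t ]
  v-↑ {t = t} zero    {x} eq = ≡.trans (v-cong (*-identityʳ x)) (≡.trans eq (cong [_] (≡.sym (⊞-identityʳ t))))
  v-↑ {t = t} (suc m) {x} eq = ≡.trans (v-* x (x ↑ suc m))
    (≡.trans (cong₂ _+∞_ eq (v-↑ m eq)) (+∞-⊞ t (suc m ⋆ t)))

  ge-ℓ· : ∀ {x} → Ge t x → Ge (1ℚ ⊞ t) (ℓ · x)
  ge-ℓ· {t = t} {x} p = ge-cong (trans (×-assoc-* ℓ 1# x) (×-congʳ ℓ (*-identityˡ x)))
    (ge-* {s = 1ℚ} {t = t} (subst ([ 1ℚ ] ≤∞_) (≡.sym v-ℓ) NonStrict.[ ℚ.≤-refl ]) p)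
    where open import Algebra.Properties.Semiring.Mult semiring using (×-assoc-*; ×-congʳ)

  ι-· : ∀ m w → ι (RingNotation._·_ (ℤₗ ℓ) m w) ≈ m · ι w
  ι-· zero    w = ι.0#-homo
  ι-· (suc m) w = trans (ι.+-homo w (RingNotation._·_ (ℤₗ ℓ) m w)) (+-congˡ (ι-· m w))

  ge-ι-divisible : ∀ .{{_ : ℕ.NonZero ℓ}} z → residue z 1 ≡ + 0 [mod ℓ ] → Ge 1ℚ (ι z)
  ge-ι-divisible z z₁≡0 = helper (divide z z₁≡0)
    where
    helper : ∃[ w ] z ℤ_ℓ.≈ RingNotation._·_ (ℤₗ ℓ) ℓ w → Ge 1ℚ (ι z)
    helper (w , z≈ℓw) = ge-cong (sym (trans (ι.⟦⟧-cong {z} {RingNotation._·_ (ℤₗ ℓ) ℓ w} z≈ℓw) (ι-· ℓ w)))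
      (subst (λ t → Ge t (ℓ · ι w)) (⊞-identityʳ 1ℚ) (ge-ℓ· {t = 0ℚ} (v-integral w)))

  -- With u z = 1 + ℓ w one has y = u (z y) - (ℓ w) y. The first term is bounded by hypothesis; the
  -- second has valuation at least 1 + t, which is where the weak bound on y enters.
  gt-ι-cancel : Prime ℓ → ∀ z → ¬ (residue z 1 ≡ + 0 [mod ℓ ]) → ∀ {y} → Ge t y → Gt t (ι z * y) → Gt t y
  gt-ι-cancel {t = t} ℓ-prime z z₁≢0 {y} p q = helper (invert ℓ-prime z z₁≢0)
   where
   helper : ∃[ u ] ∃[ w ] u ℤ_ℓ.* z ℤ_ℓ.- ℤ_ℓ.1# ℤ_ℓ.≈ RingNotation._·_ (ℤₗ ℓ) ℓ w → Gt t y
   helper (u , w , uz-1≈ℓw) = gt-cong {t = t} eq (gt-+ {t = t} (gt-*ˡ {t = t} (v-integral u) q) (gt-neg {t = t}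
           (ge⇒gt t<1+t (ge-cong {t = 1ℚ ⊞ t} (sym (×-assoc-* ℓ (ι w) y)) (ge-ℓ· {t = t} (ge-*ˡ {t = t} (v-integral w) p))))))
     where
     open import Algebra.Properties.Semiring.Mult semiring using (×-assoc-*)
     open import Relation.Binary.Reasoning.Setoid setoid
     t<1+t : t ℚ.< 1ℚ ⊞ t
     t<1+t = p<r⊞p 1ℚ t 0<1
     ιuz-1 : ι u * ι z - 1# ≈ ℓ · ι w
     ιuz-1 = begin
       ι u * ι z - 1#
         ≈⟨ +-cong (ι.*-homo u z) (trans (ι.-‿homo ℤ_ℓ.1#) (-‿cong ι.1#-homo)) ⟨
       ι (u ℤ_ℓ.* z) + ι (ℤ_ℓ.- ℤ_ℓ.1#)
         ≈⟨ ι.+-homo (u ℤ_ℓ.* z) (ℤ_ℓ.- ℤ_ℓ.1#) ⟨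
       ι (u ℤ_ℓ.* z ℤ_ℓ.- ℤ_ℓ.1#)
         ≈⟨ ι.⟦⟧-cong {u ℤ_ℓ.* z ℤ_ℓ.- ℤ_ℓ.1#} {RingNotation._·_ (ℤₗ ℓ) ℓ w} uz-1≈ℓw ⟩
       ι (RingNotation._·_ (ℤₗ ℓ) ℓ w)
         ≈⟨ ι-· ℓ w ⟩
       ℓ · ι w ∎
     eq : ι u * (ι z * y) + - ((ℓ · ι w) * y) ≈ y
     eq = begin
       ι u * (ι z * y) - (ℓ · ι w) * y            ≈⟨ +-cong (sym (*-assoc _ _ _)) (-‿cong (*-congʳ (sym ιuz-1))) ⟩
       (ι u * ι z) * y - (ι u * ι z - 1#) * y     ≈⟨ [y-z]x≈yx-zx y (ι u * ι z) (ι u * ι z - 1#) ⟨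
       (ι u * ι z - (ι u * ι z - 1#)) * y         ≈⟨ *-congʳ (+-congˡ (⁻¹-anti-homo‿- (ι u * ι z) 1#)) ⟩
       (ι u * ι z + (1# - ι u * ι z)) * y         ≈⟨ *-congʳ (+-comm _ _) ⟩
       ((1# - ι u * ι z) + ι u * ι z) * y         ≈⟨ *-congʳ ([x-y]+y≈x 1# (ι u * ι z)) ⟩
       1# * y                                     ≈⟨ *-identityˡ y ⟩
       y                                          ∎

-- Values of power series at points of 𝔪̄ⁿ

++-all : ∀ {m n b} (P : A → Set b) {f : Vector A m} {g : Vector A n} →
         (∀ i → P (f i)) → (∀ i → P (g i)) → ∀ i → P ((f ++ g) i)
++-all {m = m} P Pf Pg i with splitAt m i
... | inj₁ j = Pf j
... | inj₂ j = Pg j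

++-all₂ : ∀ {m n b r} {B : Set b} (R : A → B → Set r) {f : Vector A m} {g : Vector A n} {u : Vector B m} {w : Vector B n} →
          (∀ i → R (f i) (u i)) → (∀ i → R (g i) (w i)) → ∀ i → R ((f ++ g) i) ((u ++ w) i)
++-all₂ {m = m} R Rfu Rgw i with splitAt m i
... | inj₁ j = Rfu j
... | inj₂ j = Rgw j

Eventually : (ℕ → Set a) → Set a
Eventually P = ∃[ N₀ ] ∀ N → N₀ ≤ N → P N

eventually-all : ∀ {P : Fin n → ℕ → Set a} → (∀ i → Eventually (P i)) → Eventually (λ N → ∀ i → P i N)
eventually-all {zero}  h = 0 , λ _ _ ()
eventually-all {suc n} h with h zero | eventually-all (h ∘ suc)
... | N₀ , p | N₁ , q = N₀ ⊔ N₁ , λ where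
  N le zero    → p N (ℕ.≤-trans (ℕ.m≤m⊔n N₀ N₁) le)
  N le (suc i) → q N (ℕ.≤-trans (ℕ.m≤n⊔m N₀ N₁) le) i

ℤₗ-isCommutative : ∀ ℓ → IsCommutative (ℤₗ ℓ)
ℤₗ-isCommutative ℓ = record { isCommutativeRing = CommutativeRing.isCommutativeRing (ℤ-adic ℓ) }

module Values {ℓ : ℕ} {K : AlgebraicClosure ℓ c e} (V : Valuation K) where
  open AlgebraicClosure K hiding (zero)
  open AlgebraicClosure K using () renaming (ring to K-ring)
  open Valuation V
  open Differences K-ring
  open Monomials K-ring
  open ListSum K-ring
  open Valued V
  open PowerSeries (ℤₗ ℓ)
  open Order (ℤₗ-isCommutative ℓ) using (HasOrder)
  private
    module ι = RingMorphisms.IsRingMonomorphism ι-mono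
    module ℤ_ℓ = CommutativeRing (ℤ-adic ℓ)
    module LP = LinearPart (ℤₗ-isCommutative ℓ)

  valuationRing : CommutativeRing _ _
  valuationRing = record
    { Carrier = Σ Carrier (Ge 0ℚ)
    ; _≈_ = λ x y → proj₁ x ≈ proj₁ y
    ; _+_ = λ x y → proj₁ x + proj₁ y , ge-+ (proj₂ x) (proj₂ y)
    ; _*_ = λ x y → proj₁ x * proj₁ y , ge-*ˡ (proj₂ x) (proj₂ y)
    ; -_  = λ x → - proj₁ x , ge-neg (proj₂ x)
    ; 0#  = 0# , ge-0 refl
    ; 1#  = 1# , ge-1
    ; isCommutativeRing = record
      { isRing = record
        { +-isAbelianGroup = record
          { isGroup = record
            { isMonoid = record
              { isSemigroup = record
                { isMagma = record
                  { isEquivalence = record { refl = refl ; sym = sym ; trans = trans }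
                  ; ∙-cong = +-cong }
                ; assoc = λ x y z → +-assoc _ _ _ }
              ; identity = (λ x → +-identityˡ _) , (λ x → +-identityʳ _) }
            ; inverse = (λ x → -‿inverseˡ _) , (λ x → -‿inverseʳ _)
            ; ⁻¹-cong = -‿cong }
          ; comm = λ x y → +-comm _ _ }
        ; *-cong = *-cong
        ; *-assoc = λ x y z → *-assoc _ _ _
        ; *-identity = (λ x → *-identityˡ _) , (λ x → *-identityʳ _)
        ; distrib = (λ x y z → distribˡ _ _ _) , (λ x y z → distribʳ _ _ _) }
      ; *-comm = λ x y → *-comm _ _ } }

  -- The ring {v ≥ 0}/{v ≥ t}: in it a point of 𝔪̄ⁿ has nilpotent coordinates,
  -- so that evaluating a power series there is a finite sum.
  module _ (t : ℚ) where
    private module O = CommutativeRing valuationRing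

    ≈⇒≈ₜ : ∀ {x y} → x ≈ y → Ge t (x - y)
    ≈⇒≈ₜ x≈y = ge-0 (x≈y⇒x∙y⁻¹≈ε x≈y)

    quotientRing : CommutativeRing _ _
    quotientRing = record
      { Carrier = O.Carrier
      ; _≈_ = λ x y → Ge t (proj₁ x - proj₁ y)
      ; _+_ = O._+_
      ; _*_ = O._*_
      ; -_  = O.-_
      ; 0#  = O.0#
      ; 1#  = O.1#
      ; isCommutativeRing = record
        { isRing = record
          { +-isAbelianGroup = record
            { isGroup = record
              { isMonoid = record
                { isSemigroup = record
                  { isMagma = record
                    { isEquivalence = record
                      { refl  = ≈⇒≈ₜ refl
                      ; sym   = λ p → ge-cong (⁻¹-anti-homo‿- _ _) (ge-neg p)
                      ; trans = λ p q → ge-cong ([x-y]+[y-z]≈x-z _ _ _) (ge-+ p q) }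
                    ; ∙-cong = λ p q → ge-cong (sym ([x+y]-[z+w]≈[x-z]+[y-w] _ _ _ _)) (ge-+ p q) }
                  ; assoc = λ x y z → ≈⇒≈ₜ (+-assoc _ _ _) }
                ; identity = (λ x → ≈⇒≈ₜ (+-identityˡ _)) , (λ x → ≈⇒≈ₜ (+-identityʳ _)) }
              ; inverse = (λ x → ≈⇒≈ₜ (-‿inverseˡ _)) , (λ x → ≈⇒≈ₜ (-‿inverseʳ _))
              ; ⁻¹-cong = λ p → ge-cong (sym (⁻¹-∙-comm _ _)) (ge-neg p) }
            ; comm = λ x y → ≈⇒≈ₜ (+-comm _ _) }
          ; *-cong = λ {x} {y} {u} {w} p q → ge-cong (sym (xy-zw≈[x-z]y+z[y-w] _ _ _ _))
              (ge-+ (ge-*ʳ p (proj₂ u)) (ge-*ˡ (proj₂ y) q))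
          ; *-assoc = λ x y z → ≈⇒≈ₜ (*-assoc _ _ _)
          ; *-identity = (λ x → ≈⇒≈ₜ (*-identityˡ _)) , (λ x → ≈⇒≈ₜ (*-identityʳ _))
          ; distrib = (λ x y z → ≈⇒≈ₜ (distribˡ _ _ _)) , (λ x y z → ≈⇒≈ₜ (distribʳ _ _ _)) }
        ; *-comm = λ x y → ≈⇒≈ₜ (*-comm _ _) } }

    ι̂ : AdicInteger ℓ → O.Carrier
    ι̂ z = ι z , v-integral z

    ι̂-homo : RingMorphisms.IsRingHomomorphism (ℤₗ ℓ) (CommutativeRing.rawRing quotientRing) ι̂
    ι̂-homo = record
      { isSemiringHomomorphism = record
        { isNearSemiringHomomorphism = record
          { +-isMonoidHomomorphism = record
            { isMagmaHomomorphism = record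
              { isRelHomomorphism = record { cong = λ {x} {y} p → ≈⇒≈ₜ (ι.⟦⟧-cong {x} {y} p) }
              ; homo = λ x y → ≈⇒≈ₜ (ι.+-homo x y) }
            ; ε-homo = ≈⇒≈ₜ ι.0#-homo }
          ; *-homo = λ x y → ≈⇒≈ₜ (ι.*-homo x y) }
        ; 1#-homo = ≈⇒≈ₜ ι.1#-homo }
      ; -‿homo = λ x → ≈⇒≈ₜ (ι.-‿homo x) }

    open Evaluation (ℤₗ-isCommutative ℓ) {A = quotientRing} ι̂ ι̂-homo public
      using (evalAt; eval-⟪⟫)

    private
      module Q = CommutativeRing quotientRing
      module QN = RingNotation Q.rawRing
      module QM = Monomials quotientRing

    proj₁-∑ : ∀ (xs : List A) (f : A → O.Carrier) → proj₁ (QN.∑ xs f) ≡ ∑ xs (proj₁ ∘ f)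
    proj₁-∑ []       f = ≡.refl
    proj₁-∑ (x ∷ xs) f = cong (λ y → proj₁ (f x) + y) (proj₁-∑ xs f)

    proj₁-↑ : ∀ (x : O.Carrier) m → proj₁ (x QN.↑ m) ≡ proj₁ x ↑ m
    proj₁-↑ x zero    = ≡.refl
    proj₁-↑ x (suc m) = cong (λ y → proj₁ x * y) (proj₁-↑ x m)

    proj₁-monomial : ∀ (x : Vector O.Carrier n) α → proj₁ (QN.monomial x α) ≡ monomial (proj₁ ∘ x) α
    proj₁-monomial x []      = ≡.refl
    proj₁-monomial x (a ∷ α) = cong₂ _*_ (proj₁-↑ (x zero) a) (proj₁-monomial (x ∘ suc) α)

    proj₁-evalAt : ∀ N (x : Vector O.Carrier n) f → proj₁ (evalAt N x f) ≈ partialSum V f (proj₁ ∘ x) N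
    proj₁-evalAt {n} N x f = trans (reflexive (proj₁-∑ (box n N) _))
      (∑-cong (box n N) λ α → *-congˡ (reflexive (proj₁-monomial x α)))

    evalAt-cong : ∀ N {x y : Vector O.Carrier n} → (∀ i → x i Q.≈ y i) → ∀ f → evalAt N x f Q.≈ evalAt N y f
    evalAt-cong {n} N {x} {y} x≈y f = ListSum.∑-cong quotientRing (box n N) λ α →
      Q.*-congˡ {ι̂ (f α)} {QN.monomial x α} {QN.monomial y α} (QM.monomial-cong {x = x} {y} α x≈y)

  -- If v(x) is a rational μ > 0, its multiples eventually exceed t; this uses that points lie in
  -- 𝔪̄. If x = 0, every power with exponent m > N ≥ 0 is already zero.
  nilpotent : ∀ {x} t → [ 0ℚ ] <∞ v x → Eventually λ N → ∀ m → N < m → Ge t (x ↑ m)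
  nilpotent {x} t 0<v with v x in eq
  nilpotent {x} t Strict.[ 0<μ ] | [ μ ] with archimedean t 0<μ
  ... | D , t≤Dμ = D , λ N D≤N m N<m → ge-trans
    (ℚ.≤-trans t≤Dμ (⋆-monoˡ-≤ (ℚ.<⇒≤ 0<μ) (ℕ.≤-trans D≤N (ℕ.<⇒≤ N<m))))
    (ge-↑ m (subst ([ μ ] ≤∞_) (≡.sym eq) NonStrict.[ ℚ.≤-refl ]))
  nilpotent {x} t _ | ⊤⁺ = 0 , λ where
    N _ (suc m) _ → ge-0 (trans (*-congʳ (Equivalence.to (v-zero x) eq)) (zeroˡ _))

  positive⇒integral : ∀ {x} → [ 0ℚ ] <∞ v x → Ge 0ℚ x
  positive⇒integral = gt⇒ge

  Near : ℚ → Carrier → Carrier → Set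
  Near t x y = Ge t (x - y)

  near-sym : ∀ {x y} → Near t x y → Near t y x
  near-sym {x = x} {y} p = ge-cong (⁻¹-anti-homo‿- x y) (ge-neg p)

  near-trans : ∀ {x y z} → Near t x y → Near t y z → Near t x z
  near-trans {x = x} {y} {z} p q = ge-cong ([x-y]+[y-z]≈x-z x y z) (ge-+ p q)

  near-cong : ∀ {x x′ y y′} → x ≈ x′ → y ≈ y′ → Near t x y → Near t x′ y′
  near-cong x≈x′ y≈y′ = ge-cong (+-cong x≈x′ (-‿cong y≈y′))

  -- Everything takes place modulo {v ≥ t}. There the truncated values z of g at x agree with y, so
  -- f has the same truncated value at y as at z, and the latter is the value of the composite at x
  -- by `eval-⟪⟫`.
  partialSum-⟪⟫ : ∀ {f : Series n} {g : Vector (Series k) n} {x y} t N → (∀ i → HasOrder 1 (g i)) →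
                  (x≥0 : ∀ i → Ge 0ℚ (x i)) → (y≥0 : ∀ i → Ge 0ℚ (y i)) →
                  (∀ i m → N < m → Ge t (x i ↑ m)) →
                  (∀ i → Near t (y i) (partialSum V (g i) x N)) →
                  ∀ N′ → k ℕ.* N ≤ N′ → Near t (partialSum V f y N′) (partialSum V (f ⟪ g ⟫) x N)
  partialSum-⟪⟫ {n} {k} {f} {g} {x} {y} t N g-ord x≥0 y≥0 nil g-near N′ kN≤N′ =
    near-trans {x = partialSum V f y N′} {proj₁ (evalAt t N′ z f)} {partialSum V (f ⟪ g ⟫) x N}
      (near-sym {x = proj₁ (evalAt t N′ z f)} {partialSum V f y N′}
        (near-cong {x = proj₁ (evalAt t N′ z f)} {y = proj₁ (evalAt t N′ ŷ f)} refl (proj₁-evalAt t N′ ŷ f) inner))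
      (near-sym {x = partialSum V (f ⟪ g ⟫) x N} {proj₁ (evalAt t N′ z f)}
        (near-cong {x = proj₁ (evalAt t N x̂ (f ⟪ g ⟫))} {y = proj₁ (evalAt t N′ z f)} (proj₁-evalAt t N x̂ (f ⟪ g ⟫)) refl composite))
    where
    x̂ : Vector (Σ Carrier (Ge 0ℚ)) k
    x̂ i = x i , x≥0 i
    ŷ z : Vector (Σ Carrier (Ge 0ℚ)) n
    ŷ i = y i , y≥0 i
    z i = evalAt t N x̂ (g i)
    nil′ : ∀ i m → N < m → Near t (proj₁ (RingNotation._↑_ (CommutativeRing.rawRing (quotientRing t)) (x̂ i) m)) 0#
    nil′ i m N<m = ge-cong (sym (trans (x-0≈x _) (reflexive (proj₁-↑ t (x̂ i) m)))) (nil i m N<m)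
    composite : Near t (proj₁ (evalAt t N x̂ (f ⟪ g ⟫))) (proj₁ (evalAt t N′ z f))
    composite = eval-⟪⟫ t N x̂ nil′ f g g-ord kN≤N′
    z≈ŷ : ∀ i → Near t (proj₁ (z i)) (y i)
    z≈ŷ i = near-sym {x = y i} {proj₁ (z i)}
      (near-cong {x = y i} {y = partialSum V (g i) x N} refl (sym (proj₁-evalAt t N x̂ (g i))) (g-near i))
    inner : Near t (proj₁ (evalAt t N′ z f)) (proj₁ (evalAt t N′ ŷ f))
    inner = evalAt-cong t N′ {z} {ŷ} z≈ŷ f

  -- At each precision the outer series is summed over a box of side k·N ⊔ N₂, large enough both for
  -- f to have come close to s and for the comparison with the composite.
  hasValue-⟪⟫ : ∀ {f : Series n} {g : Vector (Series k) n} {x y s} →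
                (∀ i → HasOrder 1 (g i)) → (∀ i → [ 0ℚ ] <∞ v (x i)) → (∀ i → Ge 0ℚ (y i)) →
                (∀ i → HasValue V (g i) x (y i)) → HasValue V f y s → HasValue V (f ⟪ g ⟫) x s
  hasValue-⟪⟫ {n} {k} {f} {g} {x} {y} {s} g-ord x>0 y≥0 g↦y f↦s M = at ((+ M) ℚ./ 1)
    (eventually-all (λ i → nilpotent ((+ M) ℚ./ 1) (x>0 i))) (eventually-all (λ i → g↦y i M)) (f↦s M)
    where
    at : ∀ t → Eventually (λ N → ∀ i m → N < m → Ge t (x i ↑ m)) →
         Eventually (λ N → ∀ i → Near t (y i) (partialSum V (g i) x N)) →
         Eventually (λ N → Near t s (partialSum V f y N)) →
         Eventually (λ N → Near t s (partialSum V (f ⟪ g ⟫) x N))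
    at t (D , nil) (N₁ , g-near) (N₂ , f-near) = D ⊔ N₁ , λ N le →
      near-trans {x = s} {partialSum V f y (k ℕ.* N ⊔ N₂)} {partialSum V (f ⟪ g ⟫) x N}
      (f-near (k ℕ.* N ⊔ N₂) (ℕ.m≤n⊔m (k ℕ.* N) N₂))
      (partialSum-⟪⟫ {f = f} {g} {x} {y} t N g-ord (λ i → positive⇒integral (x>0 i)) y≥0
        (nil N (ℕ.≤-trans (ℕ.m≤m⊔n D N₁) le)) (g-near N (ℕ.≤-trans (ℕ.m≤n⊔m D N₁) le))
        (k ℕ.* N ⊔ N₂) (ℕ.m≤m⊔n (k ℕ.* N) N₂))

  hasValue-var : ∀ (i : Fin n) {x : Vector Carrier n} {s} → x i ≈ s → HasValue V (var i) x s
  hasValue-var {n} i {x} {s} xᵢ≈s M = 1 , λ N 1≤N → ge-0 (x≈y⇒x∙y⁻¹≈ε (sym (trans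
    (trans (∑-single (below-unique (replicate n N)) (unit∈box i 1≤N) (λ α → ι (var i α) * monomial x α)
       λ α _ α≢u → trans (*-congʳ (trans (ι.⟦⟧-cong {var i α} {ℤ_ℓ.0#} (LP.var-≢unit i α α≢u)) ι.0#-homo)) (zeroˡ _))
     (trans (*-cong (trans (ι.⟦⟧-cong {var i (unit i)} {ℤ_ℓ.1#} (LP.var-unit i)) ι.1#-homo) (monomial-unit x i)) (*-identityˡ _)))
    xᵢ≈s)))

  module _ {d} (F : FormalGroupLaw (ℤₗ ℓ) d) where
    open FormalGroupLaw F

    -- By induction the intermediate point S is the value of the preceding multiplication series at
    -- P. Thus the pair of P and S is the value of the series substituted into the law.
    multiple-value : ∀ m P Q → Multiple V F (suc m) P Q →
                     ∀ i → HasValue V (multiplication (suc m) i) (coord P) (coord Q i)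
    multiple-value zero    P Q (lift P≈Q) i = hasValue-var i (P≈Q i)
    multiple-value (suc m) P Q (S , mP≡S , P+S≡Q) i = subst (λ f → HasValue V f (coord P) (coord Q i)) (≡.sym (multiplication-suc F m i)) (hasValue-⟪⟫
      {f = law i} {g = var ++ multiplication (suc m)} {x = coord P} {y = coord P ++ coord S} {s = coord Q i}
      (++-all (HasOrder 1) LP.var-order (LP.multiplication-order F (suc m)))
      (positive P)
      (λ j → positive⇒integral (++-all (λ y → [ 0ℚ ] <∞ v y) (positive P) (positive S) j))
      (++-all₂ (λ f y → HasValue V f (coord P) y)
        (λ j → hasValue-var j refl) (multiple-value m P S mP≡S))
      (P+S≡Q i))

-- The reduction of [ℓ] modulo ℓ

infix 4 _≡?_[mod_]
_≡?_[mod_] : ∀ x y m → Dec (x ≡ y [mod m ])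
x ≡? y [mod m ] = map′ congruent (λ (congruent p) → p) (+ m ℤ∣.∣? (x ℤ.- y))

module _ .{{_ : NonZero m}} where

  -- The carrier of `𝔽 ℓ` is ℤ with congruence as equality; counting its elements requires canonical
  -- representatives.
  reduce : ℤ → Fin m
  reduce z = fromℕ< (n%ℕd<d z m)

  ≡-reduce : ∀ z → z ≡ + toℕ (reduce z) [mod m ]
  ≡-reduce z = subst (λ r → z ≡ + r [mod m ]) (≡.sym (Fin.toℕ-fromℕ< (n%ℕd<d z m))) (≡-%ℕ z)

  toℕ-injective-mod : ∀ (i j : Fin m) → (+ toℕ i) ≡ (+ toℕ j) [mod m ] → i ≡ j
  toℕ-injective-mod i j (congruent p) = Fin.toℕ-injective (helper (ℕ.≤-total (toℕ i) (toℕ j)) )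
    where
    difference : ∀ {a b} → a ≤ b → b < m → + m ∣ + b ℤ.- + a → a ≡ b
    difference {a} {b} a≤b b<m q with b ∸ a in eq
    ... | zero  = ℕ.≤-antisym a≤b (ℕ.m∸n≡0⇒m≤n eq)
    ... | suc d = contradiction
      (subst (m ℕ∣.∣_) (≡.trans (cong ℤ.∣_∣ (≡.trans (ℤ.m-n≡m⊖n b a) (ℤ.⊖-≥ a≤b))) eq) (ℤ∣.∣⇒∣ᵤ q))
      (ℕ∣.>⇒∤ (ℕ.≤-<-trans (subst (_≤ b) eq (ℕ.m∸n≤m b a)) b<m))
    helper : toℕ i ≤ toℕ j ⊎ toℕ j ≤ toℕ i → toℕ i ≡ toℕ j
    helper (inj₁ i≤j) = difference i≤j (Fin.toℕ<n j)
      (_≡_[mod_].divides-difference (mod-sym {x = + toℕ i} {y = + toℕ j} (congruent p)))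
    helper (inj₂ j≤i) = ≡.sym (difference j≤i (Fin.toℕ<n i) p)

1<prime : ∀ {p} → Prime p → 1 < p
1<prime p-prime = ℕ.nonTrivial⇒n>1 _ {{prime⇒nonTrivial p-prime}}

cancel-mod-prime : ∀ {ℓ} → Prime ℓ → ∀ z → ¬ (z ≡ + 0 [mod ℓ ]) →
                   ∀ x y → (x ℤ.* z) ≡ (y ℤ.* z) [mod ℓ ] → x ≡ y [mod ℓ ]
cancel-mod-prime {ℓ} ℓ-prime z z≢0 x y xz≡yz = cancel (invertible-mod-prime ℓ-prime z z≢0)
  where
  module R = CommutativeRing (ℤ/ ℓ)
  open import Relation.Binary.Reasoning.Setoid R.setoid
  cancel : ∃[ u ] (u ℤ.* z) ≡ + 1 [mod ℓ ] → x ≡ y [mod ℓ ]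
  cancel (u , uz≡1) = begin
    x                   ≡⟨ ℤ.*-identityʳ x ⟨
    x ℤ.* + 1           ≈⟨ R.*-congˡ {x} uz≡1 ⟨
    x ℤ.* (u ℤ.* z)     ≡⟨ rearrange x u z ⟩
    u ℤ.* (x ℤ.* z)     ≈⟨ R.*-congˡ {u} xz≡yz ⟩
    u ℤ.* (y ℤ.* z)     ≡⟨ rearrange y u z ⟨
    y ℤ.* (u ℤ.* z)     ≈⟨ R.*-congˡ {y} uz≡1 ⟩
    y ℤ.* + 1           ≡⟨ ℤ.*-identityʳ y ⟩
    y                   ∎
    where
    rearrange : ∀ x u z → x ℤ.* (u ℤ.* z) ≡ u ℤ.* (x ℤ.* z)
    rearrange = solve-∀

∸-suc-< : ∀ {q} → 0 < q → ∀ c → q ∸ suc c < q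
∸-suc-< {suc q} _ c = s≤s (ℕ.m∸n≤m q c)

-- Pointwise equality suffices, since the code of a function is assembled from its values one at a
-- time.
finToFun-injective : ∀ {m n} (k l : Fin (m ^ n)) → (∀ i → finToFun {m} {n} k i ≡ finToFun l i) → k ≡ l
finToFun-injective {m} {n} k l eq = ≡.trans (≡.sym (Fin.funToFin-finToFin {n} {m} k))
  (≡.trans (funToFin-cong {n} {m} eq) (Fin.funToFin-finToFin {n} {m} l))
  where
  funToFin-cong : ∀ {m n} {f g : Fin m → Fin n} → (∀ i → f i ≡ g i) → funToFin f ≡ funToFin g
  funToFin-cong {zero}  eq = ≡.refl
  funToFin-cong {suc m} eq = cong₂ combine (eq zero) (funToFin-cong (eq ∘ suc))

module _ (ℓ : ℕ) (ℓ-prime : Prime ℓ) (q : ℕ) (0<q : 0 < q) where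

  private
    module R = CommutativeRing (ℤ/ ℓ)
    instance
      _ = prime⇒nonZero ℓ-prime
    open R using (_≈_)
  open PowerSeries (𝔽 ℓ)
  open ListSum (ℤ/ ℓ)
  open import Relation.Binary.Reasoning.Setoid R.setoid
  private
    module S {k} = RawRing (seriesRing k)

  module _ (f : Series 2) (f₀≈0 : f (0 ∷ 0 ∷ []) ≈ + 0) (f-powers : InPowers (𝔽 ℓ) q f) (h : Series 2) where

    -- Among exponents with both entries below q only the origin consists of multiples of q, and
    -- there f vanishes by assumption.
    small-coefficient : ∀ a b → a < q → b < q → f (a ∷ b ∷ []) ≈ + 0
    small-coefficient zero    zero    _   _   = f₀≈0
    small-coefficient (suc a) b       a<q _   = f-powers (suc a ∷ b ∷ []) λ q∣ → ℕ∣.>⇒∤ a<q (q∣ zero)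
    small-coefficient zero    (suc b) _   b<q = f-powers (0 ∷ suc b ∷ []) λ q∣ → ℕ∣.>⇒∤ b<q (q∣ (suc zero))

    *-small : ∀ a b → a < q → b < q → (h S.* f) (a ∷ b ∷ []) ≈ + 0
    *-small a b a<q b<q = ∑-zero (below (a ∷ b ∷ [])) {λ β → h β ℤ.* f ((a ∷ b ∷ []) ⊖ β)} λ where
      (c ∷ d ∷ []) → R.trans (R.*-congˡ {h (c ∷ d ∷ [])}
        (small-coefficient (a ∸ c) (b ∸ d) (ℕ.≤-<-trans (ℕ.m∸n≤m a c) a<q) (ℕ.≤-<-trans (ℕ.m∸n≤m b d) b<q)))
        (R.zeroʳ (h (c ∷ d ∷ [])))

    -- As soon as h takes a positive part of Z₁^q, what is left for f is a small exponent, where f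
    -- vanishes. Hence only the constant term of h survives.
    *-q0 : (h S.* f) (q ∷ 0 ∷ []) ≈ h (0 ∷ 0 ∷ []) ℤ.* f (q ∷ 0 ∷ [])
    *-q0 = ∑-single (below-unique α) (0∈below α) (λ β → h β ℤ.* f (α ⊖ β)) λ where
        (zero ∷ d ∷ []) β∈ β≢0 → contradiction
          (cong (λ d → 0 ∷ d ∷ []) (ℕ.n≤0⇒n≡0 (∈-below⁻ α β∈ (suc zero)))) β≢0
        (suc c ∷ d ∷ []) _ _ → R.trans (R.*-congˡ {h (suc c ∷ d ∷ [])}
          (small-coefficient (q ∸ suc c) (0 ∸ d) (∸-suc-< 0<q c) (ℕ.≤-<-trans (ℕ.m∸n≤m 0 d) 0<q)))
          (R.zeroʳ (h (suc c ∷ d ∷ [])))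
      where
      α : Exponent 2
      α = q ∷ 0 ∷ []

    *-0q : (h S.* f) (0 ∷ q ∷ []) ≈ h (0 ∷ 0 ∷ []) ℤ.* f (0 ∷ q ∷ [])
    *-0q = ∑-single (below-unique α) (0∈below α) (λ β → h β ℤ.* f (α ⊖ β)) λ where
        (c ∷ zero ∷ []) β∈ β≢0 → contradiction
          (cong (λ c → c ∷ 0 ∷ []) (ℕ.n≤0⇒n≡0 (∈-below⁻ α β∈ zero))) β≢0
        (c ∷ suc d ∷ []) _ _ → R.trans (R.*-congˡ {h (c ∷ suc d ∷ [])}
          (small-coefficient (0 ∸ c) (q ∸ suc d) (ℕ.≤-<-trans (ℕ.m∸n≤m 0 c) 0<q) (∸-suc-< 0<q d)))
          (R.zeroʳ (h (c ∷ suc d ∷ [])))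
      where
      α : Exponent 2
      α = 0 ∷ q ∷ []

  combination-cong : ∀ {N} {r r′ : Vector ℤ N} (b : Vector (Series k) N) → (∀ i → r i ≈ r′ i) →
                     combination (𝔽 ℓ) r b ≋ combination (𝔽 ℓ) r′ b
  combination-cong {N = zero}  b r≈r′ α = R.refl
  combination-cong {N = suc N} {r} {r′} b r≈r′ α = R.+-cong
    (∑-cong (below α) λ β → R.*-congʳ {b zero (α ⊖ β)} (const-cong β)) (combination-cong (b ∘ suc) (r≈r′ ∘ suc) α)
    where
    const-cong : ∀ β → const (r zero) β ≈ const (r′ zero) β
    const-cong β with does (Vec.≡-dec ℕ._≟_ β (replicate _ 0))
    ... | true  = r≈r′ zero
    ... | false = R.refl

  module Height (f : Vector (Series 2) 2) (f₀≈0 : ∀ i → f i (0 ∷ 0 ∷ []) ≈ + 0)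
                (f-powers : ∀ i → InPowers (𝔽 ℓ) q (f i))
                (dimension : QuotientHasDimension (𝔽 ℓ) f (q ℕ.* q)) where
    open QuotientHasDimension dimension

    coefficient-ideal : ∀ {g} → InIdeal (𝔽 ℓ) f g → ∀ a b → a < q → b < q → g (a ∷ b ∷ []) ≈ + 0
    coefficient-ideal (h , g≋) a b a<q b<q = R.trans (g≋ (a ∷ b ∷ [])) (R.+-cong
      {(h zero S.* f zero) (a ∷ b ∷ [])} {+ 0}
      (*-small (f zero) (f₀≈0 zero) (f-powers zero) (h zero) a b a<q b<q)
      (R.+-cong {(h (suc zero) S.* f (suc zero)) (a ∷ b ∷ [])} {+ 0}
        (*-small (f (suc zero)) (f₀≈0 (suc zero)) (f-powers (suc zero)) (h (suc zero)) a b a<q b<q) (R.refl {+ 0})))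

    module _ (φ₀ φ₁ : ℤ) (kernel : ∀ i → φ₀ ℤ.* f i (q ∷ 0 ∷ []) ℤ.+ φ₁ ℤ.* f i (0 ∷ q ∷ []) ≈ + 0) where

      -- The additional functional. It descends to the quotient because `kernel` makes it vanish on
      -- both generators and, by `*-q0` and `*-0q`, a cofactor h acts on it through h(0).
      Λ : Series 2 → ℤ
      Λ g = φ₀ ℤ.* g (q ∷ 0 ∷ []) ℤ.+ φ₁ ℤ.* g (0 ∷ q ∷ [])

      Λ-* : ∀ h i → Λ (h S.* f i) ≈ + 0
      Λ-* h i = begin
        φ₀ ℤ.* (h S.* f i) (q ∷ 0 ∷ []) ℤ.+ φ₁ ℤ.* (h S.* f i) (0 ∷ q ∷ [])
          ≈⟨ R.+-cong (R.*-congˡ {φ₀} (*-q0 (f i) (f₀≈0 i) (f-powers i) h))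
                      (R.*-congˡ {φ₁} (*-0q (f i) (f₀≈0 i) (f-powers i) h)) ⟩
        φ₀ ℤ.* (h₀ ℤ.* f i (q ∷ 0 ∷ [])) ℤ.+ φ₁ ℤ.* (h₀ ℤ.* f i (0 ∷ q ∷ []))
          ≡⟨ rearrange φ₀ φ₁ h₀ (f i (q ∷ 0 ∷ [])) (f i (0 ∷ q ∷ [])) ⟩
        h₀ ℤ.* (φ₀ ℤ.* f i (q ∷ 0 ∷ []) ℤ.+ φ₁ ℤ.* f i (0 ∷ q ∷ []))
          ≈⟨ R.*-congˡ {h₀} (kernel i) ⟩
        h₀ ℤ.* + 0
          ≈⟨ R.zeroʳ h₀ ⟩
        + 0 ∎
        where
        h₀ : ℤ
        h₀ = h (0 ∷ 0 ∷ [])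
        rearrange : ∀ p q h a b → p ℤ.* (h ℤ.* a) ℤ.+ q ℤ.* (h ℤ.* b) ≡ h ℤ.* (p ℤ.* a ℤ.+ q ℤ.* b)
        rearrange = solve-∀

      Λ-ideal : ∀ {g} → InIdeal (𝔽 ℓ) f g → Λ g ≈ + 0
      Λ-ideal {g} (h , g≋) = begin
        Λ g
          ≈⟨ R.+-cong (R.*-congˡ {φ₀} (g≋ (q ∷ 0 ∷ []))) (R.*-congˡ {φ₁} (g≋ (0 ∷ q ∷ []))) ⟩
        φ₀ ℤ.* (U zero ℤ.+ (U (suc zero) ℤ.+ + 0)) ℤ.+ φ₁ ℤ.* (W zero ℤ.+ (W (suc zero) ℤ.+ + 0))
          ≡⟨ rearrange φ₀ φ₁ (U zero) (U (suc zero)) (W zero) (W (suc zero)) ⟩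
        Λ (h zero S.* f zero) ℤ.+ Λ (h (suc zero) S.* f (suc zero))
          ≈⟨ R.+-cong (Λ-* (h zero) zero) (Λ-* (h (suc zero)) (suc zero)) ⟩
        + 0 ∎
        where
        U W : Fin 2 → ℤ
        U i = (h i S.* f i) (q ∷ 0 ∷ [])
        W i = (h i S.* f i) (0 ∷ q ∷ [])
        rearrange : ∀ p q a b c d → p ℤ.* (a ℤ.+ (b ℤ.+ + 0)) ℤ.+ q ℤ.* (c ℤ.+ (d ℤ.+ + 0))
                                  ≡ (p ℤ.* a ℤ.+ q ℤ.* c) ℤ.+ (p ℤ.* b ℤ.+ q ℤ.* d)
        rearrange = solve-∀

      module _ (ψ₀ ψ₁ : ℤ) (nonzero : ¬ (φ₀ ℤ.* ψ₀ ℤ.+ φ₁ ℤ.* ψ₁ ≈ + 0)) where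

        -- A word prescribes all q·q + 1 functionals at once: letter zero is the multiple of the
        -- vector (ψ₀, ψ₁), which Λ detects, and the other letters are the coefficients with both
        -- exponents below q.
        Word : Set
        Word = Fin (suc (q ℕ.* q)) → Fin ℓ

        -- Outside the square the argument reads only the exponents (q, 0) and (0, q); the remaining
        -- ones receive the same entries as a default.
        entry : Word → ∀ {a b} → Dec (a < q) → Dec (b < q) → ℤ
        entry w (yes a<q) (yes b<q) = + toℕ (w (suc (combine (fromℕ< a<q) (fromℕ< b<q))))
        entry w (yes _)   (no _)    = + toℕ (w zero) ℤ.* ψ₁
        entry w (no _)    _         = + toℕ (w zero) ℤ.* ψ₀

        series : Word → Series 2
        series w (a ∷ b ∷ []) = entry w (a ℕ.<? q) (b ℕ.<? q)

        series-small : ∀ w i j → series w (toℕ i ∷ toℕ j ∷ []) ≡ + toℕ (w (suc (combine i j)))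
        series-small w i j with toℕ i ℕ.<? q | toℕ j ℕ.<? q
        ... | yes i<q | yes j<q = cong₂ (λ i j → + toℕ (w (suc (combine i j)))) (Fin.fromℕ<-toℕ i i<q) (Fin.fromℕ<-toℕ j j<q)
        ... | yes _   | no j≮q  = contradiction (Fin.toℕ<n j) j≮q
        ... | no i≮q  | _       = contradiction (Fin.toℕ<n i) i≮q

        series-q0 : ∀ w → series w (q ∷ 0 ∷ []) ≡ + toℕ (w zero) ℤ.* ψ₀
        series-q0 w with q ℕ.<? q
        ... | yes q<q = contradiction q<q (ℕ.<-irrefl ≡.refl)
        ... | no _    = ≡.refl

        series-0q : ∀ w → series w (0 ∷ q ∷ []) ≡ + toℕ (w zero) ℤ.* ψ₁
        series-0q w with 0 ℕ.<? q | q ℕ.<? q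
        ... | no 0≮q | _       = contradiction 0<q 0≮q
        ... | yes _  | yes q<q = contradiction q<q (ℕ.<-irrefl ≡.refl)
        ... | yes _  | no _    = ≡.refl

        Λ-series : ∀ w → Λ (series w) ≡ + toℕ (w zero) ℤ.* (φ₀ ℤ.* ψ₀ ℤ.+ φ₁ ℤ.* ψ₁)
        Λ-series w = ≡.trans (cong₂ (λ a b → φ₀ ℤ.* a ℤ.+ φ₁ ℤ.* b) (series-q0 w) (series-0q w))
                           (rearrange φ₀ φ₁ (+ toℕ (w zero)) ψ₀ ψ₁)
          where
          rearrange : ∀ p q w a b → p ℤ.* (w ℤ.* a) ℤ.+ q ℤ.* (w ℤ.* b) ≡ w ℤ.* (p ℤ.* a ℤ.+ q ℤ.* b)
          rearrange = solve-∀

        coordinates : Word → Fin (q ℕ.* q) → ℤ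
        coordinates w = proj₁ (spanning (series w))

        class : Word → Series 2
        class w = combination (𝔽 ℓ) (coordinates w) basis

        series-class : ∀ w → InIdeal (𝔽 ℓ) f (series w S.+ S.- class w)
        series-class w = proj₂ (spanning (series w))

        ≈-from-difference : ∀ x y → x ℤ.+ ℤ.- y ≈ + 0 → x ≈ y
        ≈-from-difference x y (congruent p) = congruent (subst (+ ℓ ∣_) (ℤ.+-identityʳ _) p)

        -- Both kinds of functional vanish on the ideal, so they depend only on the class. The small
        -- coefficients return the letters after the first; Λ returns the first letter times the
        -- pairing of φ and ψ, which can be cancelled modulo ℓ.
        same-class⇒same : ∀ w w′ → (∀ i → coordinates w i ≈ coordinates w′ i) → ∀ i → w i ≡ w′ i
        same-class⇒same w w′ r≈r′ = agree
          where
          class≋ : class w ≋ class w′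
          class≋ = combination-cong {r = coordinates w} {coordinates w′} basis r≈r′

          small : ∀ a b → a < q → b < q → series w (a ∷ b ∷ []) ≈ series w′ (a ∷ b ∷ [])
          small a b a<q b<q = begin
            series w (a ∷ b ∷ [])   ≈⟨ ≈-from-difference _ _ (coefficient-ideal (series-class w) a b a<q b<q) ⟩
            class w (a ∷ b ∷ [])    ≈⟨ class≋ (a ∷ b ∷ []) ⟩
            class w′ (a ∷ b ∷ [])   ≈⟨ ≈-from-difference _ _ (coefficient-ideal (series-class w′) a b a<q b<q) ⟨
            series w′ (a ∷ b ∷ [])  ∎

          Λ-class : ∀ w → Λ (series w) ≈ Λ (class w)
          Λ-class w = ≈-from-difference (Λ (series w)) (Λ (class w)) (R.trans
            (R.reflexive (≡.sym (rearrange φ₀ φ₁ (series w (q ∷ 0 ∷ [])) (class w (q ∷ 0 ∷ []))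
              (series w (0 ∷ q ∷ [])) (class w (0 ∷ q ∷ []))))) (Λ-ideal (series-class w)))
            where
            rearrange : ∀ p q a b c d → p ℤ.* (a ℤ.+ ℤ.- b) ℤ.+ q ℤ.* (c ℤ.+ ℤ.- d)
                                      ≡ (p ℤ.* a ℤ.+ q ℤ.* c) ℤ.+ ℤ.- (p ℤ.* b ℤ.+ q ℤ.* d)
            rearrange = solve-∀

          pairing : ℤ
          pairing = φ₀ ℤ.* ψ₀ ℤ.+ φ₁ ℤ.* ψ₁

          top : + toℕ (w zero) ℤ.* pairing ≈ + toℕ (w′ zero) ℤ.* pairing
          top = begin
            + toℕ (w zero) ℤ.* pairing    ≡⟨ Λ-series w ⟨
            Λ (series w)            ≈⟨ Λ-class w ⟩
            Λ (class w)             ≈⟨ R.+-cong (R.*-congˡ {φ₀} (class≋ (q ∷ 0 ∷ []))) (R.*-congˡ {φ₁} (class≋ (0 ∷ q ∷ []))) ⟩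
            Λ (class w′)            ≈⟨ Λ-class w′ ⟨
            Λ (series w′)           ≡⟨ Λ-series w′ ⟩
            + toℕ (w′ zero) ℤ.* pairing   ∎

          agree : ∀ i → w i ≡ w′ i
          agree zero = toℕ-injective-mod (w zero) (w′ zero) (cancel-mod-prime ℓ-prime pairing nonzero _ _ top)
          agree (suc i) = subst (λ i → w (suc i) ≡ w′ (suc i)) (Fin.combine-remQuot {q} q i)
            (toℕ-injective-mod _ _ (subst₂ _≈_ (series-small w j j′) (series-small w′ j j′)
              (small (toℕ j) (toℕ j′) (Fin.toℕ<n j) (Fin.toℕ<n j′))))
            where
            j j′ : Fin q
            j  = proj₁ (remQuot {q} q i)
            j′ = proj₂ (remQuot {q} q i)

        -- The ℓ^(q·q + 1) words have only ℓ^(q·q) reduced coordinate vectors, so two of them share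
        -- a vector, against `same-class⇒same`.
        too-many-functionals : ⊥
        too-many-functionals with Fin.pigeonhole {ℓ ^ (q ℕ.* q)} {ℓ ^ suc (q ℕ.* q)} (ℕ.^-monoʳ-< ℓ (1<prime ℓ-prime) (ℕ.n<1+n (q ℕ.* q)))
          (λ i → funToFin (reduce ∘ coordinates (finToFun i)))
        ... | i , j , i<j , same = Fin.<-irrefl (finToFun-injective {ℓ} {suc (q ℕ.* q)} i j
          (same-class⇒same (finToFun i) (finToFun j) λ l → begin
            coordinates (finToFun i) l                      ≈⟨ ≡-reduce _ ⟩
            + toℕ (reduce (coordinates (finToFun i) l))     ≡⟨ cong (λ i → + toℕ i) (≡.trans (≡.sym (Fin.finToFun-funToFin _ l))
                (≡.trans (cong (λ m → finToFun m l) same) (Fin.finToFun-funToFin _ l))) ⟩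
            + toℕ (reduce (coordinates (finToFun j) l))     ≈⟨ ≡-reduce _ ⟨
            coordinates (finToFun j) l                      ∎)) i<j

    private
      ξ η : Fin 2 → ℤ
      ξ i = f i (q ∷ 0 ∷ [])
      η i = f i (0 ∷ q ∷ [])

    -- If φ₀ or φ₁ were nonzero, the corresponding standard basis vector would serve as (ψ₀, ψ₁).
    -- Congruence modulo ℓ is decidable, so the double negation can be removed.
    injective : ∀ φ₀ φ₁ → (∀ i → φ₀ ℤ.* ξ i ℤ.+ φ₁ ℤ.* η i ≈ + 0) → φ₀ ≈ + 0 × φ₁ ≈ + 0
    injective φ₀ φ₁ kernel = decide (φ₀ ≡? + 0 [mod ℓ ]) first , decide (φ₁ ≡? + 0 [mod ℓ ]) second
      where
      decide : ∀ {p} {P : Set p} → Dec P → (¬ P → ⊥) → P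
      decide (yes p) _ = p
      decide (no ¬p) h = contradiction ¬p h
      first : ¬ ¬ (φ₀ ≈ + 0)
      first φ₀≢0 = too-many-functionals φ₀ φ₁ kernel (+ 1) (+ 0) (φ₀≢0 ∘ R.trans (R.reflexive (≡.sym (simplify φ₀ φ₁))))
        where
        simplify : ∀ p q → p ℤ.* + 1 ℤ.+ q ℤ.* + 0 ≡ p
        simplify = solve-∀
      second : ¬ ¬ (φ₁ ≈ + 0)
      second φ₁≢0 = too-many-functionals φ₀ φ₁ kernel (+ 0) (+ 1) (φ₁≢0 ∘ R.trans (R.reflexive (≡.sym (simplify φ₀ φ₁))))
        where
        simplify : ∀ p q → p ℤ.* + 0 ℤ.+ q ℤ.* + 1 ≡ q
        simplify = solve-∀

    -- If the determinant vanished, each vector (ηᵢ, -ξᵢ) would annihilate both rows and so be zero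
    -- by `injective`. Then ξ vanishes, and (1, 0) annihilates both rows as well.
    determinant≢0 : ¬ (ξ zero ℤ.* η (suc zero) ℤ.- η zero ℤ.* ξ (suc zero) ≈ + 0)
    determinant≢0 det≈0 = 1≢0 (proj₁ (injective (+ 1) (+ 0) λ where
        zero       → R.trans (R.reflexive (simplify (ξ zero) (η zero))) a₀≈0
        (suc zero) → R.trans (R.reflexive (simplify (ξ (suc zero)) (η (suc zero)))) a₁≈0))
      where
      1≢0 : ¬ (+ 1 ≈ + 0)
      1≢0 (congruent (divides q eq)) = ℕ.<-irrefl (≡.sym (ℕ∣.∣1⇒≡1 (ℤ∣.∣⇒∣ᵤ (divides q eq)))) (1<prime ℓ-prime)
      simplify : ∀ a b → + 1 ℤ.* a ℤ.+ + 0 ℤ.* b ≡ a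
      simplify = solve-∀
      alternate : ∀ a b → b ℤ.* a ℤ.+ ℤ.- a ℤ.* b ≡ + 0
      alternate = solve-∀
      expand : ∀ a₀ b₀ a₁ b₁ → b₁ ℤ.* a₀ ℤ.+ ℤ.- a₁ ℤ.* b₀ ≡ a₀ ℤ.* b₁ ℤ.- b₀ ℤ.* a₁
      expand = solve-∀
      expand′ : ∀ a₀ b₀ a₁ b₁ → b₀ ℤ.* a₁ ℤ.+ ℤ.- a₀ ℤ.* b₁ ≡ ℤ.- (a₀ ℤ.* b₁ ℤ.- b₀ ℤ.* a₁)
      expand′ = solve-∀
      negate : ∀ {x} → ℤ.- x ≈ + 0 → x ≈ + 0
      negate {x} -x≈0 = R.trans (R.reflexive (≡.sym (ℤ.neg-involutive x))) (R.-‿cong { ℤ.- x } {+ 0} -x≈0)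
      a₀≈0 : ξ zero ≈ + 0
      a₀≈0 = negate (proj₂ (injective (η zero) (ℤ.- ξ zero) λ where
        zero       → R.reflexive (alternate (ξ zero) (η zero))
        (suc zero) → R.trans (R.reflexive (expand′ (ξ zero) (η zero) (ξ (suc zero)) (η (suc zero)))) (R.-‿cong {y = + 0} det≈0)))
      a₁≈0 : ξ (suc zero) ≈ + 0
      a₁≈0 = negate (proj₂ (injective (η (suc zero)) (ℤ.- ξ (suc zero)) λ where
        zero       → R.trans (R.reflexive (expand (ξ zero) (η zero) (ξ (suc zero)) (η (suc zero)))) det≈0
        (suc zero) → R.reflexive (alternate (ξ (suc zero)) (η (suc zero)))))

-- Roots of [ℓ]

absorption : ∀ n k → suc k ℕ.* (suc n C suc k) ≡ suc n ℕ.* (n C k)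
absorption zero    zero    = ≡.refl
absorption zero    (suc k) = ℕ.*-zeroʳ k
absorption (suc n) zero    = begin
  1 ℕ.* (suc (suc n) C 1)             ≡⟨ cong (1 ℕ.*_) (nCk+nC[k+1]≡[n+1]C[k+1] (suc n) 0) ⟨
  1 ℕ.* (1 ℕ.+ (suc n C 1))           ≡⟨ ℕ.*-identityˡ _ ⟩
  1 ℕ.+ (suc n C 1)                   ≡⟨ cong suc (≡.trans (≡.sym (ℕ.*-identityˡ _)) (absorption n zero)) ⟩
  1 ℕ.+ suc n ℕ.* 1                   ≡⟨⟩
  suc (suc n) ℕ.* 1                   ∎
  where open ≡-Reasoning
absorption (suc n) (suc k) = begin
  suc (suc k) ℕ.* (suc (suc n) C suc (suc k))
    ≡⟨ cong (suc (suc k) ℕ.*_) (nCk+nC[k+1]≡[n+1]C[k+1] (suc n) (suc k)) ⟨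
  suc (suc k) ℕ.* ((suc n C suc k) ℕ.+ (suc n C suc (suc k)))
    ≡⟨ expand (suc k) (suc n C suc k) (suc n C suc (suc k)) ⟩
  (suc n C suc k) ℕ.+ (suc k ℕ.* (suc n C suc k) ℕ.+ suc (suc k) ℕ.* (suc n C suc (suc k)))
    ≡⟨ cong₂ (λ x y → (suc n C suc k) ℕ.+ (x ℕ.+ y)) (absorption n k) (absorption n (suc k)) ⟩
  (suc n C suc k) ℕ.+ (suc n ℕ.* (n C k) ℕ.+ suc n ℕ.* (n C suc k))
    ≡⟨ cong ((suc n C suc k) ℕ.+_) (ℕ.*-distribˡ-+ (suc n) (n C k) (n C suc k)) ⟨
  (suc n C suc k) ℕ.+ suc n ℕ.* ((n C k) ℕ.+ (n C suc k))
    ≡⟨ cong (λ x → (suc n C suc k) ℕ.+ suc n ℕ.* x) (nCk+nC[k+1]≡[n+1]C[k+1] n k) ⟩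
  suc (suc n) ℕ.* (suc n C suc k) ∎
  where
  open ≡-Reasoning
  expand : ∀ m x y → suc m ℕ.* (x ℕ.+ y) ≡ x ℕ.+ (m ℕ.* x ℕ.+ suc m ℕ.* y)
  expand = ℕ.solve-∀

-- By `absorption` p divides (k + 1) times the binomial coefficient, and it does not divide k + 1.
prime∣binomial : ∀ {p} → Prime p → ∀ k → suc k < p → p ℕ∣.∣ p C suc k
prime∣binomial {suc p} p-prime k k<p with euclidsLemma (suc k) (suc p C suc k) p-prime
  (ℕ∣.divides (p C k) (≡.trans (absorption p k) (ℕ.*-comm (suc p) (p C k))))
... | inj₁ p∣k = contradiction p∣k (ℕ∣.>⇒∤ k<p)
... | inj₂ p∣C = p∣C

⋆-⋆ : ∀ m n t → m ⋆ (n ⋆ t) ≡ (m ℕ.* n) ⋆ t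
⋆-⋆ zero    n t = ≡.refl
⋆-⋆ (suc m) n t = ≡.trans (cong (n ⋆ t ⊞_) (⋆-⋆ m n t)) (≡.sym (⋆-+ t n (m ℕ.* n)))

⋆-pos : ∀ {m} → 0 < m → 0ℚ ℚ.< t → 0ℚ ℚ.< m ⋆ t
⋆-pos {t} {suc m} _ 0<t = subst (ℚ._< suc m ⋆ t) (⊞-identityʳ 0ℚ) (⊞-mono-<-≤ 0<t (⋆-nonNeg m (ℚ.<⇒≤ 0<t)))

t<m⋆t : ∀ {m} → 1 < m → 0ℚ ℚ.< t → t ℚ.< m ⋆ t
t<m⋆t {t} {suc m} (s≤s 0<m) 0<t = subst (ℚ._< t ⊞ m ⋆ t) (⊞-identityʳ t) (⊞-mono-≤-< ℚ.≤-refl (⋆-pos 0<m 0<t))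

module _ {q} (1<q : 1 < q) where

  -- Both inequalities say t ≥ 1/(q - 1), respectively t > 1/(q - 1).
  1⊞-strict : ∀ {s t} → s ℚ.< t → 1ℚ ⊞ s ℚ.≤ q ⋆ s → 1ℚ ⊞ t ℚ.< q ⋆ t
  1⊞-strict {s} {t} s<t 1+s≤qs = helper 1<q 1+s≤qs
    where
    helper : ∀ {q} → 1 < q → 1ℚ ⊞ s ℚ.≤ q ⋆ s → 1ℚ ⊞ t ℚ.< q ⋆ t
    helper {suc (suc p)} (s≤s _) le = subst (ℚ._< t ⊞ suc p ⋆ t) (⊞-comm t 1ℚ)
      (⊞-mono-≤-< ℚ.≤-refl (ℚ.≤-<-trans
        (⊞-cancelˡ-≤ s (subst (ℚ._≤ s ⊞ suc p ⋆ s) (⊞-comm 1ℚ s) le)) (⋆-mono-< p s<t)))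

module Roots {ℓ : ℕ} {K : AlgebraicClosure ℓ c e} (V : Valuation K) (ℓ-prime : Prime ℓ) (1<ℓ : 1 < ℓ) where
  open AlgebraicClosure K hiding (zero)
  open AlgebraicClosure K using () renaming (ring to K-ring)
  open Valuation V
  open Differences K-ring
  open Monomials K-ring
  open ListSum K-ring
  open Valued V

  -- Covers {v ≥ t} and {v > t} together: in `difference-ℓ²` the first power of ℓ needs a weak bound
  -- and the second a strict one.
  record IsIdeal (J : Carrier → Set) : Set (c ⊔ₗ e) where
    field
      J-cong : ∀ {x y} → x ≈ y → J x → J y
      J-0    : J 0#
      J-+    : ∀ {x y} → J x → J y → J (x + y)
      J-*    : ∀ {x y} → J x → Ge 0ℚ y → J (x * y)

    J-· : ∀ m {x} → J x → J (m · x)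
    J-· zero    _ = J-0
    J-· (suc m) p = J-+ p (J-· m p)

    J-sum : ∀ {n} {f : Vector Carrier n} → (∀ i → J (f i)) → J (sum f)
    J-sum {zero}  _ = J-0
    J-sum {suc n} p = J-+ (p zero) (J-sum (p ∘ suc))

    difference-* : ∀ {x y z w} → Ge 0ℚ z → Ge 0ℚ y → J (x - z) → J (y - w) → J (x * y - z * w)
    difference-* {x} {y} {z} {w} z≥0 y≥0 p q = J-cong (sym (xy-zw≈[x-z]y+z[y-w] x y z w))
      (J-+ (J-* p y≥0) (J-cong (*-comm _ _) (J-* q z≥0)))

    difference-↑ : ∀ m {x y} → Ge 0ℚ x → Ge 0ℚ y → J (y - x) → J (y ↑ m - x ↑ m)
    difference-↑ zero    _   _   _ = J-cong (sym (x-x≈0 1#)) J-0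
    difference-↑ (suc m) {x} {y} x≥0 y≥0 p = difference-* x≥0
      (ge-trans (⋆-nonNeg {0ℚ} m ℚ.≤-refl) (ge-↑ m y≥0)) p (difference-↑ m x≥0 y≥0 p)

  ge-ideal : ∀ t → IsIdeal (Ge t)
  ge-ideal t = record { J-cong = ge-cong ; J-0 = ge-0 refl ; J-+ = ge-+ ; J-* = ge-*ʳ }

  gt-ideal : ∀ t → IsIdeal (Gt t)
  gt-ideal t = record { J-cong = gt-cong ; J-0 = gt-0 refl ; J-+ = gt-+ ; J-* = gt-*ʳ }

  integral-↑ : ∀ m {x} → Ge 0ℚ x → Ge 0ℚ (x ↑ m)
  integral-↑ m x≥0 = ge-trans (⋆-nonNeg {0ℚ} m ℚ.≤-refl) (ge-↑ m x≥0)

  -- The binomial coefficients other than the outer two are divisible by ℓ.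
  frobenius : ∀ {J} → IsIdeal J → ∀ {x y} → Ge 0ℚ x → Ge 0ℚ y → J ((y - x) ↑ ℓ) →
              (∀ z → Ge 0ℚ z → J (ℓ · ((y - x) * z))) → J (y ↑ ℓ - x ↑ ℓ)
  frobenius {J} ideal {x} {y} x≥0 y≥0 J-top J-middle = J-cong (sym expansion) (J-sum term)
    where
    open IsIdeal ideal
    open import Algebra.Properties.CommutativeSemiring.Binomial commutativeSemiring using (theorem; binomialTerm)
    open import Algebra.Properties.Monoid.Mult +-monoid using (×-assocˡ; ×-congˡ; ×-congʳ)
    open import Relation.Binary.Reasoning.Setoid setoid
    d : Carrier
    d = y - x
    d≥0 : Ge 0ℚ d
    d≥0 = ge-+ y≥0 (ge-neg x≥0)
    rest : Vector Carrier ℓ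
    rest i = binomialTerm d x ℓ (suc i)
    expansion : y ↑ ℓ - x ↑ ℓ ≈ sum rest
    expansion = begin
      y ↑ ℓ - x ↑ ℓ                              ≈⟨ +-congʳ (↑-cong ℓ ([x-y]+y≈x y x)) ⟨
      (d + x) ↑ ℓ - x ↑ ℓ                        ≈⟨ +-congʳ (theorem ℓ d x) ⟩
      (1 · (1# * x ↑ ℓ) + sum rest) - x ↑ ℓ      ≈⟨ +-congʳ (+-congʳ (trans (+-identityʳ _) (*-identityˡ _))) ⟩
      (x ↑ ℓ + sum rest) - x ↑ ℓ                 ≈⟨ +-congʳ (+-comm _ _) ⟩
      (sum rest + x ↑ ℓ) - x ↑ ℓ                 ≈⟨ +-assoc _ _ _ ⟩
      sum rest + (x ↑ ℓ - x ↑ ℓ)                 ≈⟨ trans (+-congˡ (x-x≈0 _)) (+-identityʳ _) ⟩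
      sum rest                                   ∎
    term : ∀ i → J (rest i)
    term i = J-case (ℕ.m≤n⇒m<n∨m≡n (Fin.toℕ<n i))
      where
      j : ℕ
      j = toℕ i
      z : Carrier
      z = d ↑ j * x ↑ (ℓ ∸ suc j)
      z≥0 : Ge 0ℚ z
      z≥0 = ge-*ˡ (integral-↑ j d≥0) (integral-↑ (ℓ ∸ suc j) x≥0)
      J-case : suc j < ℓ ⊎ suc j ≡ ℓ → J ((ℓ C suc j) · (d ↑ suc j * x ↑ (ℓ ∸ suc j)))
      J-case (inj₁ j<ℓ) = middle (prime∣binomial ℓ-prime j j<ℓ)
        where
        middle : ℓ ℕ∣.∣ ℓ C suc j → J ((ℓ C suc j) · (d ↑ suc j * x ↑ (ℓ ∸ suc j)))
        middle (ℕ∣.divides m eq) = J-cong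
          (trans (×-assocˡ (d * z) m ℓ) (trans (×-congˡ (≡.sym eq)) (×-congʳ (ℓ C suc j) (sym (*-assoc _ _ _)))))
          (J-· m (J-middle z z≥0))
      J-case (inj₂ j≡ℓ) = J-· (ℓ C suc j) (J-* (subst (λ m → J (d ↑ m)) (≡.sym j≡ℓ) J-top) (integral-↑ (ℓ ∸ suc j) x≥0))

  ↑-ℓ² : ∀ x → x ↑ (ℓ ^ 2) ≈ (x ↑ ℓ) ↑ ℓ
  ↑-ℓ² x = trans (sym (↑-↑ x ℓ (ℓ ℕ.* 1))) (↑-cong ℓ (reflexive (cong (x ↑_) (ℕ.*-identityʳ ℓ))))

  -- Two applications of `frobenius`. The first gives v(y^ℓ - x^ℓ) ≥ r with r = min(ℓδ, 1 + δ). In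
  -- the second the middle terms have valuation at least 1 + r > 1 + δ, and the top term at least
  -- ℓr. If r = ℓδ, then ℓr = ℓ²δ > 1 + δ by hypothesis; if r = 1 + δ, then ℓr > r because ℓ > 1.
  difference-ℓ² : ∀ {δ x y} → 0ℚ ℚ.< δ → 1ℚ ⊞ δ ℚ.< ℓ ^ 2 ⋆ δ → Ge 0ℚ x → Ge 0ℚ y → Ge δ (y - x) →
                  Gt (1ℚ ⊞ δ) (y ↑ (ℓ ^ 2) - x ↑ (ℓ ^ 2))
  difference-ℓ² {δ} {x} {y} 0<δ 1+δ<qδ x≥0 y≥0 d≥δ =
    gt-cong (+-cong (sym (↑-ℓ² y)) (-‿cong (sym (↑-ℓ² x)))) (cases (ℚ.≤-total (ℓ ⋆ δ) (1ℚ ⊞ δ)))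
    where
    0<1+δ : 0ℚ ℚ.< 1ℚ ⊞ δ
    0<1+δ = ℚ.<-trans 0<δ (p<r⊞p 1ℚ δ 0<1)
    via : ∀ r → r ℚ.≤ ℓ ⋆ δ → r ℚ.≤ 1ℚ ⊞ δ → δ ℚ.< r → 1ℚ ⊞ δ ℚ.< ℓ ⋆ r → Gt (1ℚ ⊞ δ) ((y ↑ ℓ) ↑ ℓ - (x ↑ ℓ) ↑ ℓ)
    via r r≤ℓδ r≤1+δ δ<r 1+δ<ℓr = frobenius (gt-ideal (1ℚ ⊞ δ)) (integral-↑ ℓ x≥0) (integral-↑ ℓ y≥0)
      (ge⇒gt 1+δ<ℓr (ge-↑ ℓ first)) (λ z z≥0 → ge⇒gt (⊞-mono-≤-< ℚ.≤-refl δ<r) (ge-ℓ· (ge-*ʳ first z≥0)))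
      where
      first : Ge r (y ↑ ℓ - x ↑ ℓ)
      first = frobenius (ge-ideal r) x≥0 y≥0 (ge-trans r≤ℓδ (ge-↑ ℓ d≥δ))
        (λ z z≥0 → ge-trans r≤1+δ (ge-ℓ· (ge-*ʳ d≥δ z≥0)))
    cases : ℓ ⋆ δ ℚ.≤ 1ℚ ⊞ δ ⊎ 1ℚ ⊞ δ ℚ.≤ ℓ ⋆ δ → Gt (1ℚ ⊞ δ) ((y ↑ ℓ) ↑ ℓ - (x ↑ ℓ) ↑ ℓ)
    cases (inj₁ ℓδ≤) = via (ℓ ⋆ δ) ℚ.≤-refl ℓδ≤ (t<m⋆t 1<ℓ 0<δ)
      (subst (1ℚ ⊞ δ ℚ.<_) (≡.trans (cong (λ m → (ℓ ℕ.* m) ⋆ δ) (ℕ.*-identityʳ ℓ)) (≡.sym (⋆-⋆ ℓ ℓ δ))) 1+δ<qδ)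
    cases (inj₂ ≤ℓδ) = via (1ℚ ⊞ δ) ≤ℓδ ℚ.≤-refl (p<r⊞p 1ℚ δ 0<1) (t<m⋆t 1<ℓ 0<1+δ)

-- Here κ stands for the coefficients of [ℓ] in K: linear part ℓ Z, and a factor ℓ wherever the
-- exponents are not both multiples of q.
module Solutions
  {ℓ : ℕ} {K : AlgebraicClosure ℓ c e} (V : Valuation K) (ℓ-prime : Prime ℓ) (1<ℓ : 1 < ℓ)
  (κ : Fin 2 → Exponent 2 → AlgebraicClosure.Carrier K)
  (κ-integral : ∀ i α → Valued.Ge V 0ℚ (κ i α))
  (κ-0 : ∀ i → AlgebraicClosure._≈_ K (κ i (0 ∷ 0 ∷ [])) (AlgebraicClosure.0# K))
  (κ-unit : ∀ i → AlgebraicClosure._≈_ K (κ i (unit i)) (AlgebraicClosure._·_ K ℓ (AlgebraicClosure.1# K)))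
  (κ-other : ∀ i j → j ≢ i → AlgebraicClosure._≈_ K (κ i (unit j)) (AlgebraicClosure.0# K))
  (κ-off : ∀ i α → ¬ (∀ j → ℓ ^ 2 ℕ∣.∣ lookup α j) → Valued.Ge V 1ℚ (κ i α))
  where
  open AlgebraicClosure K hiding (zero)
  open AlgebraicClosure K using () renaming (ring to K-ring)
  open Valuation V
  open Differences K-ring
  open Monomials K-ring
  open ListSum K-ring
  open Valued V
  open Roots V ℓ-prime 1<ℓ

  private
    q : ℕ
    q = ℓ ^ 2

  1<q : 1 < q
  1<q = ℕ.<-≤-trans 1<ℓ (subst (ℓ ≤_) (cong (ℓ ℕ.*_) (≡.sym (ℕ.*-identityʳ ℓ)))
          (ℕ.m≤m*n ℓ ℓ {{ℕ.>-nonZero (ℕ.<-trans (s≤s z≤n) 1<ℓ)}}))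

  0<q : 0 < q
  0<q = ℕ.<-trans (s≤s z≤n) 1<q

  partial : Fin 2 → Vector Carrier 2 → ℕ → Carrier
  partial i x N = ∑ (box 2 N) λ α → κ i α * monomial x α

  -- Vanishing as a limit, at arbitrary rational precision, so that thresholds such as 1 + μ can be
  -- requested directly.
  Root : Vector Carrier 2 → Set
  Root x = ∀ i t → Eventually λ N → Ge t (partial i x N)

  -- The ultrametric principle behind both contradictions: a term that alone has minimal valuation
  -- cannot be cancelled in a sum of larger valuation.
  gt-∑-single : ∀ {xs : List A} {x} → Unique xs → x ∈ xs → (f : A → Carrier) →
                (∀ y → y ≢ x → Gt t (f y)) → Gt t (∑ xs f) → Gt t (f x)
  gt-∑-single {t = t} {xs} {x} u x∈xs f small total = gt-cong recover (gt-+ total (gt-neg (others u x∈xs)))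
    where
    recover : ∑ xs f + - (∑ xs f - f x) ≈ f x
    recover = trans (+-congˡ (⁻¹-anti-homo‿- (∑ xs f) (f x))) (trans (+-comm _ _) ([x-y]+y≈x (f x) (∑ xs f)))
    others : ∀ {xs} → Unique xs → x ∈ xs → Gt t (∑ xs f - f x)
    others {z ∷ xs} (z# ∷ _) (here ≡.refl) = gt-cong
      (sym (trans (+-congʳ (+-comm _ _)) (trans (+-assoc _ _ _) (trans (+-congˡ (x-x≈0 (f z))) (+-identityʳ _)))))
      (gt-∑ xs λ y y∈ → small y λ y≡z → All.lookup z# y∈ (≡.sym y≡z))
    others {z ∷ xs} (z# ∷ u) (there x∈) = gt-cong (sym (+-assoc _ _ _))
      (gt-+ (small z (All.lookup z# x∈)) (others u x∈))

  monomial₂ : ∀ x a b → monomial {2} x (a ∷ b ∷ []) ≈ x zero ↑ a * x (suc zero) ↑ b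
  monomial₂ x a b = *-congˡ (*-identityʳ _)

  v-↑-pos : ∀ {m} → 0 < m → ∀ {x} → v x ≡ [ t ] → v (x ↑ m) ≡ [ m ⋆ t ]
  v-↑-pos {m = suc m} _ = v-↑ m

  -- `D` is the determinant of the linear part of g, lifted to K; `D-cancel` expresses that it is a
  -- unit.
  module Bound (D : Carrier) (D≈det : D ≈ κ zero (q ∷ 0 ∷ []) * κ (suc zero) (0 ∷ q ∷ []) - κ zero (0 ∷ q ∷ []) * κ (suc zero) (q ∷ 0 ∷ []))
               (D-cancel : ∀ {t y} → Ge t y → Gt t (D * y) → Gt t y)
               {x : Vector Carrier 2} (root : Root x) {μ : ℚ} (0<μ : 0ℚ ℚ.< μ) (x≥μ : ∀ i → Ge μ (x i)) where

    private
      Q₀ Q₁ : Exponent 2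
      Q₀ = q ∷ 0 ∷ []
      Q₁ = 0 ∷ q ∷ []

      0≤μ : 0ℚ ℚ.≤ μ
      0≤μ = ℚ.<⇒≤ 0<μ

    ge-term : ∀ α {m} → m ≤ Vec.sum α → Ge (m ⋆ μ) (monomial x α)
    ge-term α m≤α = ge-trans (⋆-monoˡ-≤ 0≤μ m≤α) (ge-monomial x≥μ α)

    module _ (qμ<1+μ : q ⋆ μ ℚ.< 1ℚ ⊞ μ) where

      small-off : ∀ i α → 1 ≤ Vec.sum α → ¬ (∀ j → q ℕ∣.∣ lookup α j) → Gt (q ⋆ μ) (κ i α * monomial x α)
      small-off i α 1≤α off = ge⇒gt qμ<1+μ
        (ge-* (κ-off i α off) (subst (λ t → Ge t (monomial x α)) (⊞-identityʳ μ) (ge-term α {1} 1≤α)))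

      -- Off the multiples of q the coefficient supplies 1 and the monomial at least μ, and 1 + μ >
      -- qμ by the assumption to be refuted. On the multiples of q every exponent other than the
      -- origin, `Q₀` and `Q₁` has degree at least 2q.
      small : ∀ i α → α ≢ Q₀ → α ≢ Q₁ → Gt (q ⋆ μ) (κ i α * monomial x α)
      small i (a ∷ b ∷ []) ≢Q₀ ≢Q₁ = cases (q ℕ∣.∣? a) (q ℕ∣.∣? b)
        where
        α : Exponent 2
        α = a ∷ b ∷ []
        big : q ℕ.+ q ≤ Vec.sum α → Gt (q ⋆ μ) (κ i α * monomial x α)
        big 2q≤α = gt-*ˡ (κ-integral i α) (ge⇒gt
          (subst (q ⋆ μ ℚ.<_) (≡.sym (⋆-+ μ q q)) (p<r⊞p (q ⋆ μ) (q ⋆ μ) (⋆-pos 0<q 0<μ)))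
          (ge-term α 2q≤α))
        both : ∀ k m → a ≡ k ℕ.* q → b ≡ m ℕ.* q → Gt (q ⋆ μ) (κ i α * monomial x α)
        both zero          zero          ≡.refl ≡.refl = gt-0 (trans (*-congʳ (κ-0 i)) (zeroˡ _))
        both (suc zero)    zero          eq     ≡.refl = contradiction (cong (_∷ 0 ∷ []) (≡.trans eq (ℕ.*-identityˡ q))) ≢Q₀
        both zero          (suc zero)    ≡.refl eq     = contradiction (cong (λ b → 0 ∷ b ∷ []) (≡.trans eq (ℕ.*-identityˡ q))) ≢Q₁
        both (suc (suc k)) m             eq     _      = big (subst (λ a → q ℕ.+ q ≤ a ℕ.+ (b ℕ.+ 0)) (≡.sym eq)
          (ℕ.≤-trans (ℕ.+-monoʳ-≤ q (ℕ.m≤m+n q (k ℕ.* q))) (ℕ.m≤m+n _ (b ℕ.+ 0))))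
        both (suc zero)    (suc m)       eq     eq′    = big (subst₂ (λ a b → q ℕ.+ q ≤ a ℕ.+ (b ℕ.+ 0)) (≡.sym eq) (≡.sym eq′)
          (ℕ.+-mono-≤ (ℕ.m≤m+n q 0) (ℕ.≤-trans (ℕ.m≤m+n q (m ℕ.* q)) (ℕ.m≤m+n _ 0))))
        both zero          (suc (suc m)) _      eq     = big (subst (λ b → q ℕ.+ q ≤ a ℕ.+ (b ℕ.+ 0)) (≡.sym eq)
          (ℕ.m≤n⇒m≤o+n a (ℕ.≤-trans (ℕ.+-monoʳ-≤ q (ℕ.m≤m+n q (m ℕ.* q))) (ℕ.m≤m+n _ 0))))
        off₀ : ¬ (q ℕ∣.∣ a) → 1 ≤ Vec.sum α
        off₀ ∤a = ℕ.≤-trans (ℕ.n≢0⇒n>0 λ where ≡.refl → ∤a (q ℕ∣.∣0)) (ℕ.m≤m+n a _)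
        off₁ : ¬ (q ℕ∣.∣ b) → 1 ≤ Vec.sum α
        off₁ ∤b = ℕ.m≤n⇒m≤o+n a (ℕ.≤-trans (ℕ.n≢0⇒n>0 λ where ≡.refl → ∤b (q ℕ∣.∣0)) (ℕ.m≤m+n b _))
        cases : Dec (q ℕ∣.∣ a) → Dec (q ℕ∣.∣ b) → Gt (q ⋆ μ) (κ i α * monomial x α)
        cases (yes (ℕ∣.divides k eq)) (yes (ℕ∣.divides m eq′)) = both k m eq eq′
        cases (no ∤a) _       = small-off i α (off₀ ∤a) λ q∣ → ∤a (q∣ zero)
        cases (yes _) (no ∤b) = small-off i α (off₁ ∤b) λ q∣ → ∤b (q∣ (suc zero))

      -- Eliminating one of the two monomials of degree q isolates the other.
      eliminate : ∀ B₀ B₁ Q Q′ → (∀ α → α ≢ Q → α ≢ Q′ → α ≢ Q₀ × α ≢ Q₁) → Ge 0ℚ B₀ → Ge 0ℚ B₁ →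
                  (∀ i → lookup Q i ≤ q) → q ≤ Vec.sum Q →
                  B₀ * κ zero Q′ + B₁ * κ (suc zero) Q′ ≈ 0# → B₀ * κ zero Q + B₁ * κ (suc zero) Q ≈ D →
                  Gt (q ⋆ μ) (monomial x Q)
      eliminate B₀ B₁ Q Q′ exceptional B₀≥0 B₁≥0 Q≤q q≤Q vanish det = D-cancel monomial≥
        (gt-cong (trans (factor Q) (*-congʳ det)) (at (root zero (1ℚ ⊞ μ)) (root (suc zero) (1ℚ ⊞ μ))))
        where
        G : Exponent 2 → Carrier
        G α = B₀ * (κ zero α * monomial x α) + B₁ * (κ (suc zero) α * monomial x α)
        factor : ∀ α → G α ≈ (B₀ * κ zero α + B₁ * κ (suc zero) α) * monomial x α
        factor α = trans (+-cong (sym (*-assoc _ _ _)) (sym (*-assoc _ _ _))) (sym (distribʳ _ _ _))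
        monomial≥ : Ge (q ⋆ μ) (monomial x Q)
        monomial≥ = ge-term Q q≤Q
        G-small : ∀ α → α ≢ Q → Gt (q ⋆ μ) (G α)
        G-small α α≢Q with Vec.≡-dec ℕ._≟_ α Q′
        ... | yes ≡.refl = gt-0 (trans (factor α) (trans (*-congʳ vanish) (zeroˡ _)))
        ... | no α≢Q′ = gt-+ (gt-*ˡ B₀≥0 (small zero α (proj₁ (exceptional α α≢Q α≢Q′)) (proj₂ (exceptional α α≢Q α≢Q′))))
                             (gt-*ˡ B₁≥0 (small (suc zero) α (proj₁ (exceptional α α≢Q α≢Q′)) (proj₂ (exceptional α α≢Q α≢Q′))))
        at : Eventually (λ N → Ge (1ℚ ⊞ μ) (partial zero x N)) → Eventually (λ N → Ge (1ℚ ⊞ μ) (partial (suc zero) x N)) →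
             Gt (q ⋆ μ) (G Q)
        at (N₀ , p₀) (N₁ , p₁) = gt-∑-single (below-unique (replicate 2 N)) (∈-box⁺ Q λ i → ℕ.≤-trans (Q≤q i) q≤N) G G-small
          (gt-cong sum-G (ge⇒gt qμ<1+μ (ge-+ (ge-*ˡ B₀≥0 (p₀ N N₀≤N)) (ge-*ˡ B₁≥0 (p₁ N N₁≤N)))))
          where
          N : ℕ
          N = q ⊔ (N₀ ⊔ N₁)
          q≤N : q ≤ N
          q≤N = ℕ.m≤m⊔n q (N₀ ⊔ N₁)
          N₀≤N : N₀ ≤ N
          N₀≤N = ℕ.≤-trans (ℕ.m≤m⊔n N₀ N₁) (ℕ.m≤n⊔m q (N₀ ⊔ N₁))
          N₁≤N : N₁ ≤ N
          N₁≤N = ℕ.≤-trans (ℕ.m≤n⊔m N₀ N₁) (ℕ.m≤n⊔m q (N₀ ⊔ N₁))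
          sum-G : B₀ * partial zero x N + B₁ * partial (suc zero) x N ≈ ∑ (box 2 N) G
          sum-G = trans (+-cong (*-∑ (box 2 N) B₀ _) (*-∑ (box 2 N) B₁ _))
            (sym (∑-+ (box 2 N) (λ α → B₀ * (κ zero α * monomial x α)) (λ α → B₁ * (κ (suc zero) α * monomial x α))))

    -- The multipliers are the rows of the adjugate matrix: each kills one of `Q₀`, `Q₁` and leaves
    -- the determinant at the other. Then x j ↑ q has valuation above qμ, although it is exactly qμ.
    bound : ∀ j → v (x j) ≡ [ μ ] → 1ℚ ⊞ μ ℚ.≤ q ⋆ μ
    bound zero eq = ℚ.≮⇒≥ λ qμ<1+μ → gt-irrefl (v-↑-pos 0<q eq)
      (gt-cong (trans (monomial₂ x q 0) (*-identityʳ _))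
        (eliminate qμ<1+μ (κ (suc zero) Q₁) (- κ zero Q₁) Q₀ Q₁ (λ _ p p′ → p , p′)
          (κ-integral (suc zero) Q₁) (ge-neg (κ-integral zero Q₁))
          (λ where zero → ℕ.≤-refl ; (suc zero) → z≤n) (ℕ.m≤m+n q 0)
          (trans (+-cong (*-comm _ _) (sym (-‿distribˡ-* _ _))) (x-x≈0 _))
          (trans (+-cong (*-comm _ _) (sym (-‿distribˡ-* _ _))) (sym D≈det))))
    bound (suc zero) eq = ℚ.≮⇒≥ λ qμ<1+μ → gt-irrefl (v-↑-pos 0<q eq)
      (gt-cong (trans (monomial₂ x 0 q) (*-identityˡ _))
        (eliminate qμ<1+μ (- κ (suc zero) Q₀) (κ zero Q₀) Q₁ Q₀ (λ _ p p′ → p′ , p)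
          (ge-neg (κ-integral (suc zero) Q₀)) (κ-integral zero Q₀)
          (λ where zero → z≤n ; (suc zero) → ℕ.≤-refl) (ℕ.m≤m+n q 0)
          (trans (+-comm _ _) (trans (+-cong (*-comm _ _) (sym (-‿distribˡ-* _ _))) (x-x≈0 _)))
          (trans (+-comm _ _) (trans (+-congˡ (trans (sym (-‿distribˡ-* _ _)) (-‿cong (*-comm _ _)))) (sym D≈det)))))

  module Close {x y : Vector Carrier 2} (x-root : Root x) (y-root : Root y)
               {μ δ : ℚ} (0<μ : 0ℚ ℚ.< μ) (μ<δ : μ ℚ.< δ) (1+μ≤qμ : 1ℚ ⊞ μ ℚ.≤ q ⋆ μ)
               (x≥μ : ∀ i → Ge μ (x i)) (y≥μ : ∀ i → Ge μ (y i)) (d≥δ : ∀ i → Ge δ (y i - x i)) where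

    private
      0<δ : 0ℚ ℚ.< δ
      0<δ = ℚ.<-trans 0<μ μ<δ

      x>0 : ∀ i → Gt 0ℚ (x i)
      x>0 i = ge⇒gt 0<μ (x≥μ i)
      y>0 : ∀ i → Gt 0ℚ (y i)
      y>0 i = ge⇒gt 0<μ (y≥μ i)
      x≥0 : ∀ i → Ge 0ℚ (x i)
      x≥0 i = gt⇒ge (x>0 i)
      y≥0 : ∀ i → Ge 0ℚ (y i)
      y≥0 i = gt⇒ge (y>0 i)

      difference : Exponent 2 → Carrier
      difference α = monomial y α - monomial x α

    difference-monomial : ∀ {J} → IsIdeal J → ∀ a b → J (y zero ↑ a - x zero ↑ a) → J (y (suc zero) ↑ b - x (suc zero) ↑ b) →
                          J (difference (a ∷ b ∷ []))
    difference-monomial ideal a b p p′ = J-cong (+-cong (sym (monomial₂ y a b)) (-‿cong (sym (monomial₂ x a b))))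
      (difference-* (integral-↑ a (x≥0 zero)) (integral-↑ b (y≥0 (suc zero))) p p′)
      where open IsIdeal ideal

    difference≥δ : ∀ a b → Ge δ (y zero ↑ a * y (suc zero) ↑ b - x zero ↑ a * x (suc zero) ↑ b)
    difference≥δ a b = difference-* (integral-↑ a (x≥0 zero)) (integral-↑ b (y≥0 (suc zero)))
        (difference-↑ a (x≥0 zero) (y≥0 zero) (d≥δ zero)) (difference-↑ b (x≥0 (suc zero)) (y≥0 (suc zero)) (d≥δ (suc zero)))
      where open IsIdeal (ge-ideal δ)

    gt-monomial : ∀ (z : Vector Carrier 2) → (∀ i → Gt 0ℚ (z i)) → ∀ a b → 1 ≤ a ℕ.+ b → Gt 0ℚ (z zero ↑ a * z (suc zero) ↑ b)
    gt-monomial z z>0 zero    (suc b) _ = gt-*ˡ ge-1 (gt-*ʳ (z>0 (suc zero)) (integral-↑ b (gt⇒ge (z>0 (suc zero)))))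
    gt-monomial z z>0 (suc a) b       _ = gt-*ʳ (gt-*ʳ (z>0 zero) (integral-↑ a (gt⇒ge (z>0 zero)))) (integral-↑ b (gt⇒ge (z>0 (suc zero))))

    -- In y m(y) - x m(x) = (y - x) m(y) + x (m(y) - m(x)) each summand has a difference of
    -- valuation at least δ and a further factor of positive valuation.
    difference-step : ∀ i a b → 1 ≤ a ℕ.+ b →
                      Gt δ (y i * (y zero ↑ a * y (suc zero) ↑ b) - x i * (x zero ↑ a * x (suc zero) ↑ b))
    difference-step i a b 1≤ = gt-cong (sym (xy-zw≈[x-z]y+z[y-w] _ _ _ _)) (gt-+
      (subst (λ t → Gt t _) (⊞-identityˡ δ) (gt-cong (*-comm _ _) (gt-* (gt-monomial y y>0 a b 1≤) (d≥δ i))))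
      (subst (λ t → Gt t _) (⊞-identityˡ δ) (gt-* (x>0 i) (difference≥δ a b))))

    difference>δ : ∀ a b → 2 ≤ a ℕ.+ b → Gt δ (difference (a ∷ b ∷ []))
    difference>δ (suc a) b (s≤s 1≤) = gt-cong (+-cong (eq y) (-‿cong (eq x))) (difference-step zero a b 1≤)
      where
      eq : ∀ (z : Vector Carrier 2) → z zero * (z zero ↑ a * z (suc zero) ↑ b) ≈ monomial z (suc a ∷ b ∷ [])
      eq z = trans (sym (*-assoc _ _ _)) (sym (monomial₂ z (suc a) b))
    difference>δ zero (suc b) (s≤s 1≤) = gt-cong (+-cong (eq y) (-‿cong (eq x))) (difference-step (suc zero) zero b 1≤)
      where
      eq : ∀ (z : Vector Carrier 2) → z (suc zero) * (1# * z (suc zero) ↑ b) ≈ monomial z (zero ∷ suc b ∷ [])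
      eq z = trans (*-congˡ (*-identityˡ _)) (trans (sym (*-identityˡ _)) (sym (monomial₂ z zero (suc b))))

    -- The estimate for y^q - x^q passes to powers and products, because {v > 1 + δ} is an ideal of
    -- the valuation ring.
    difference-q : ∀ k m → Gt (1ℚ ⊞ δ) (difference (k ℕ.* q ∷ m ℕ.* q ∷ []))
    difference-q k m = difference-monomial (gt-ideal (1ℚ ⊞ δ)) (k ℕ.* q) (m ℕ.* q) (factor zero k) (factor (suc zero) m)
      where
      factor : ∀ i k → Gt (1ℚ ⊞ δ) (y i ↑ (k ℕ.* q) - x i ↑ (k ℕ.* q))
      factor i k = gt-cong (+-cong (↑-↑ (y i) k q) (-‿cong (↑-↑ (x i) k q)))
        (difference-↑ k (integral-↑ q (x≥0 i)) (integral-↑ q (y≥0 i))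
          (difference-ℓ² 0<δ (1⊞-strict 1<q μ<δ 1+μ≤qμ) (x≥0 i) (y≥0 i) (d≥δ i)))
        where open IsIdeal (gt-ideal (1ℚ ⊞ δ))

    -- Off the multiples of q the coefficient contributes 1 and the difference more than δ; on them
    -- the difference alone exceeds 1 + δ.
    large : ∀ i a b → 2 ≤ a ℕ.+ b → Gt (1ℚ ⊞ δ) (κ i (a ∷ b ∷ []) * difference (a ∷ b ∷ []))
    large i a b 2≤ = cases (q ℕ∣.∣? a) (q ℕ∣.∣? b)
      where
      α : Exponent 2
      α = a ∷ b ∷ []
      off : ¬ (∀ j → q ℕ∣.∣ lookup α j) → Gt (1ℚ ⊞ δ) (κ i α * difference α)
      off ∤α = subst (λ t → Gt t (κ i α * difference α)) (⊞-comm δ 1ℚ)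
        (gt-cong (*-comm _ _) (gt-* (difference>δ a b 2≤) (κ-off i α ∤α)))
      cases : Dec (q ℕ∣.∣ a) → Dec (q ℕ∣.∣ b) → Gt (1ℚ ⊞ δ) (κ i α * difference α)
      cases (yes (ℕ∣.divides k ≡.refl)) (yes (ℕ∣.divides m ≡.refl)) = gt-*ˡ (κ-integral i α) (difference-q k m)
      cases (no ∤a) _       = off λ q∣ → ∤a (q∣ zero)
      cases (yes _) (no ∤b) = off λ q∣ → ∤b (q∣ (suc zero))

    small : ∀ i α → α ≢ unit i → Gt (1ℚ ⊞ δ) (κ i α * difference α)
    small i (0 ∷ 0 ∷ []) _ = gt-0 (trans (*-congʳ (κ-0 i)) (zeroˡ _))
    small zero       (1 ∷ 0 ∷ []) ≢u = contradiction ≡.refl ≢u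
    small (suc zero) (1 ∷ 0 ∷ []) _  = gt-0 (trans (*-congʳ (κ-other (suc zero) zero λ ())) (zeroˡ _))
    small zero       (0 ∷ 1 ∷ []) _  = gt-0 (trans (*-congʳ (κ-other zero (suc zero) λ ())) (zeroˡ _))
    small (suc zero) (0 ∷ 1 ∷ []) ≢u = contradiction ≡.refl ≢u
    small i (suc (suc a) ∷ b ∷ []) _ = large i (suc (suc a)) b (s≤s (s≤s z≤n))
    small i (1 ∷ suc b ∷ []) _       = large i 1 (suc b) (s≤s (s≤s z≤n))
    small i (0 ∷ suc (suc b) ∷ []) _ = large i 0 (suc (suc b)) (s≤s (s≤s z≤n))

    -- In [ℓ](y) - [ℓ](x), compared exponent by exponent, the linear term ℓ (y j - x j) has
    -- valuation exactly 1 + δ and every other term more, while the whole sum tends to 0.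
    contradictory : ∀ j → v (y j - x j) ≡ [ δ ] → ⊥
    -- Any precision strictly above 1 + δ serves here; 2 + δ is one.
    contradictory j eq = at (x-root j (1ℚ ⊞ (1ℚ ⊞ δ))) (y-root j (1ℚ ⊞ (1ℚ ⊞ δ)))
      where
      G : Exponent 2 → Carrier
      G α = κ j α * difference α
      G-unit : G (unit j) ≈ (ℓ · 1#) * (y j - x j)
      G-unit = *-cong (κ-unit j) (+-cong (monomial-unit y j) (-‿cong (monomial-unit x j)))
      v-unit : v (G (unit j)) ≡ [ 1ℚ ⊞ δ ]
      v-unit = ≡.trans (v-cong G-unit) (≡.trans (v-* _ _) (≡.trans (cong₂ _+∞_ v-ℓ eq) (+∞-⊞ 1ℚ δ)))
      at : Eventually (λ N → Ge (1ℚ ⊞ (1ℚ ⊞ δ)) (partial j x N)) → Eventually (λ N → Ge (1ℚ ⊞ (1ℚ ⊞ δ)) (partial j y N)) → ⊥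
      at (N₀ , p₀) (N₁ , p₁) = gt-irrefl v-unit (gt-∑-single (below-unique (replicate 2 N)) (unit∈box j 1≤N) G (small j)
          (gt-cong sum-G (ge⇒gt (p<r⊞p 1ℚ (1ℚ ⊞ δ) 0<1) (ge-+ (p₁ N N₁≤N) (ge-neg (p₀ N N₀≤N))))))
        where
        N : ℕ
        N = 1 ⊔ (N₀ ⊔ N₁)
        1≤N : 1 ≤ N
        1≤N = ℕ.m≤m⊔n 1 (N₀ ⊔ N₁)
        N₀≤N : N₀ ≤ N
        N₀≤N = ℕ.≤-trans (ℕ.m≤m⊔n N₀ N₁) (ℕ.m≤n⊔m 1 (N₀ ⊔ N₁))
        N₁≤N : N₁ ≤ N
        N₁≤N = ℕ.≤-trans (ℕ.m≤n⊔m N₀ N₁) (ℕ.m≤n⊔m 1 (N₀ ⊔ N₁))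
        sum-G : partial j y N - partial j x N ≈ ∑ (box 2 N) G
        sum-G = sym (trans
          (∑-cong (box 2 N) λ α → trans (x[y-z]≈xy-xz (κ j α) (monomial y α) (monomial x α)) (+-congˡ (sym (-1*x≈-x _))))
          (trans (∑-+ (box 2 N) (λ α → κ j α * monomial y α) (λ α → - 1# * (κ j α * monomial x α)))
            (+-congˡ (trans (sym (*-∑ (box 2 N) (- 1#) (λ α → κ j α * monomial x α))) (-1*x≈-x _)))))

-- Wild inertia and torsion points

module Minimum {ℓ : ℕ} {K : AlgebraicClosure ℓ c e} (V : Valuation K) where
  open AlgebraicClosure K hiding (zero)
  open Valuation V
  open Valued V

  valuation-cases : ∀ x → x ≈ 0# ⊎ ∃[ t ] v x ≡ [ t ]
  valuation-cases x = helper (v x) ≡.refl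
    where
    helper : ∀ w → v x ≡ w → x ≈ 0# ⊎ ∃[ t ] v x ≡ [ t ]
    helper ⊤⁺    eq = inj₁ (Equivalence.to (v-zero x) eq)
    helper [ t ] eq = inj₂ (t , eq)

  ge-≡ : ∀ {x} → v x ≡ [ t ] → Ge t x
  ge-≡ eq = subst ([ _ ] ≤∞_) (≡.sym eq) NonStrict.[ ℚ.≤-refl ]

  gt⇒< : ∀ {x} → v x ≡ [ t ] → Gt s x → s ℚ.< t
  gt⇒< eq p = Strict.[<]-injective ℚ._<_ (subst ([ _ ] <∞_) eq p)

  minimum : (z : Vector Carrier 2) → (∀ i → z i ≈ 0#) ⊎ ∃[ j ] ∃[ t ] v (z j) ≡ [ t ] × (∀ i → Ge t (z i))
  minimum z = cases (valuation-cases (z zero)) (valuation-cases (z (suc zero)))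
    where
    cases : z zero ≈ 0# ⊎ ∃[ t ] v (z zero) ≡ [ t ] → z (suc zero) ≈ 0# ⊎ ∃[ t ] v (z (suc zero)) ≡ [ t ] →
            (∀ i → z i ≈ 0#) ⊎ ∃[ j ] ∃[ t ] v (z j) ≡ [ t ] × (∀ i → Ge t (z i))
    cases (inj₁ p)        (inj₁ q)        = inj₁ λ where zero → p ; (suc zero) → q
    cases (inj₁ p)        (inj₂ (t , eq)) = inj₂ (suc zero , t , eq , λ where zero → ge-0 p ; (suc zero) → ge-≡ eq)
    cases (inj₂ (t , eq)) (inj₁ q)        = inj₂ (zero , t , eq , λ where zero → ge-≡ eq ; (suc zero) → ge-0 q)
    cases (inj₂ (s , eq)) (inj₂ (t , eq′)) = compare (ℚ.≤-total s t)
      where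
      compare : s ℚ.≤ t ⊎ t ℚ.≤ s → _
      compare (inj₁ s≤t) = inj₂ (zero , s , eq , λ where zero → ge-≡ eq ; (suc zero) → ge-trans s≤t (ge-≡ eq′))
      compare (inj₂ t≤s) = inj₂ (suc zero , t , eq′ , λ where zero → ge-trans t≤s (ge-≡ eq) ; (suc zero) → ge-≡ eq′)

module Wild {ℓ : ℕ} {K : AlgebraicClosure ℓ c e} (V : Valuation K) (σ : Gal K) (wild : IsWild V σ) where
  open AlgebraicClosure K hiding (zero)
  open AlgebraicClosure K using () renaming (ring to K-ring)
  open Valuation V
  open Valued V
  open Minimum V
  open Differences K-ring
  open Gal σ
  private
    module σ = RingMorphisms.IsRingIsomorphism iso
    module ι = RingMorphisms.IsRingMonomorphism ι-mono
    module ℤ_ℓ = CommutativeRing (ℤ-adic ℓ)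

  -- For x ≠ 0 write σx - x = (σx/x - 1) x; wildness says that the first factor has positive
  -- valuation.
  gt-moved : ∀ {x} → Ge t x → Gt t (act x - x)
  gt-moved {t} {x} x≥t = cases (valuation-cases x)
    where
    cases : x ≈ 0# ⊎ ∃[ s ] v x ≡ [ s ] → Gt t (act x - x)
    cases (inj₁ x≈0) = gt-0 (trans (+-cong (trans (σ.⟦⟧-cong x≈0) σ.0#-homo) (-‿cong x≈0)) (x-x≈0 0#))
    cases (inj₂ (s , eq)) = nonzero (inverse x λ x≈0 → gt-irrefl eq (gt-0 x≈0))
      where
      nonzero : ∃[ y ] x * y ≈ 1# → Gt t (act x - x)
      nonzero (y , xy≈1) = gt-cong recover (subst (λ t → Gt t ((act x * y - 1#) * x)) (⊞-identityˡ t)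
        (gt-* (wild x y xy≈1) x≥t))
        where
        recover : (act x * y - 1#) * x ≈ act x - x
        recover = trans ([y-z]x≈yx-zx x (act x * y) 1#) (+-cong
          (trans (*-assoc (act x) y x) (trans (*-congˡ (trans (*-comm y x) xy≈1)) (*-identityʳ (act x))))
          (-‿cong (*-identityˡ x)))

  -- Both summands of σx = (σx - x) + x have valuation at least t.
  ge-act : ∀ {x} → Ge t x → Ge t (act x)
  ge-act {x = x} x≥t = ge-cong ([x-y]+y≈x (act x) x) (ge-+ (gt⇒ge (gt-moved x≥t)) x≥t)

  act-ι : ∀ z → act (ι z) ≈ ι z
  act-ι z = fixes (ι z) (z , ℤ_ℓ.1# , 1≉0ₗ , trans (*-congʳ ι.1#-homo) (*-identityˡ (ι z)))
    where
    1≉0ₗ : ¬ (ℤ_ℓ.1# ℤ_ℓ.≈ ℤ_ℓ.0#)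
    1≉0ₗ 1≈0 = 1≉0 (trans (sym ι.1#-homo) (trans (ι.⟦⟧-cong {ℤ_ℓ.1#} {ℤ_ℓ.0#} 1≈0) ι.0#-homo))

  act-∑ : ∀ (xs : List A) (f : A → Carrier) → act (∑ xs f) ≈ ∑ xs (act ∘ f)
  act-∑ []       f = σ.0#-homo
  act-∑ (x ∷ xs) f = trans (σ.+-homo _ _) (+-congˡ (act-∑ xs f))

  act-↑ : ∀ x m → act (x ↑ m) ≈ act x ↑ m
  act-↑ x zero    = σ.1#-homo
  act-↑ x (suc m) = trans (σ.*-homo _ _) (*-congˡ (act-↑ x m))

  act-monomial : ∀ (x : Vector Carrier n) α → act (monomial x α) ≈ monomial (act ∘ x) α
  act-monomial x []      = σ.1#-homo
  act-monomial x (a ∷ α) = trans (σ.*-homo _ _) (*-cong (act-↑ (x zero) a) (act-monomial (x ∘ suc) α))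

module Torsion
  (ℓ : ℕ) (ℓ-prime : Prime ℓ)
  (F : FormalGroupLaw (ℤₗ ℓ) 2) (height : HasHeight ℓ F 4) (exponent : HasExponent ℓ F 2)
  {c′ e′ : Level} {K : AlgebraicClosure ℓ c′ e′} (V : Valuation K)
  where
  open AlgebraicClosure K hiding (zero)
  open AlgebraicClosure K using () renaming (ring to K-ring)
  open FormalGroupLaw F using (multiplication)
  open Valuation V
  open Valued V
  open Differences K-ring
  open Monomials K-ring using (·-zero)
  open PowerSeries (ℤₗ ℓ) using (Series; var)
  private
    module ι = RingMorphisms.IsRingMonomorphism ι-mono
    module ℤ_ℓ = CommutativeRing (ℤ-adic ℓ)
    module LP = LinearPart (ℤₗ-isCommutative ℓ)
    instance _ = prime⇒nonZero ℓ-prime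

    q : ℕ
    q = ℓ ^ 2

  γ : Fin 2 → Exponent 2 → AdicInteger ℓ
  γ = multiplication ℓ

  κ : Fin 2 → Exponent 2 → Carrier
  κ i α = ι (γ i α)

  γ-0 : ∀ i → γ i (0 ∷ 0 ∷ []) ℤ_ℓ.≈ ℤ_ℓ.0#
  γ-0 i = LP.multiplication-order F ℓ i (0 ∷ 0 ∷ []) (s≤s z≤n)

  κ-0 : ∀ i → κ i (0 ∷ 0 ∷ []) ≈ 0#
  κ-0 i = trans (ι.⟦⟧-cong {γ i (0 ∷ 0 ∷ [])} {ℤ_ℓ.0#} (γ-0 i)) ι.0#-homo

  κ-linear : ∀ i j → κ i (unit j) ≈ ℓ · ι (var i (unit j))
  κ-linear i j = trans
    (ι.⟦⟧-cong {γ i (unit j)} {RingNotation._·_ (ℤₗ ℓ) ℓ (var i (unit j))}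
      (LP.multiplication-linear F ℓ i (unit j) (ℕ.≤-reflexive (sum-unit j))))
    (ι-· ℓ (var i (unit j)))

  open import Algebra.Properties.Monoid.Mult +-monoid using (×-congʳ)

  κ-unit : ∀ i → κ i (unit i) ≈ ℓ · 1#
  κ-unit i = trans (κ-linear i i)
    (×-congʳ ℓ (trans (ι.⟦⟧-cong {var i (unit i)} {ℤ_ℓ.1#} (LP.var-unit i)) ι.1#-homo))

  κ-other : ∀ i j → j ≢ i → κ i (unit j) ≈ 0#
  κ-other i j j≢i = trans (κ-linear i j) (trans
    (×-congʳ ℓ (trans (ι.⟦⟧-cong {var i (unit j)} {ℤ_ℓ.0#} (LP.var-≢unit i (unit j) (j≢i ∘ unit-injective i j))) ι.0#-homo))
    (·-zero ℓ))
    where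
    unit-injective : ∀ (i j : Fin 2) → unit j ≡ unit i → j ≡ i
    unit-injective zero       zero       _  = ≡.refl
    unit-injective (suc zero) (suc zero) _  = ≡.refl
    unit-injective zero       (suc zero) ()
    unit-injective (suc zero) zero       ()

  κ-off : ∀ i α → ¬ (∀ j → q ℕ∣.∣ lookup α j) → Ge 1ℚ (κ i α)
  κ-off i α off = ge-ι-divisible (γ i α) (proj₁ exponent i α off)

  1<ℓ : 1 < ℓ
  1<ℓ = 1<prime ℓ-prime

  open Solutions V ℓ-prime 1<ℓ κ (λ i α → v-integral (γ i α)) κ-0 κ-unit κ-other κ-off public

  Q₀ Q₁ : Exponent 2
  Q₀ = q ∷ 0 ∷ []
  Q₁ = 0 ∷ q ∷ []

  det : AdicInteger ℓ
  det = γ zero Q₀ ℤ_ℓ.* γ (suc zero) Q₁ ℤ_ℓ.- γ zero Q₁ ℤ_ℓ.* γ (suc zero) Q₀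

  -- The residue of `det` at index 1 computes to the determinant of the reduced coefficients. Index
  -- 1 means modulo ℓ ^ 1, and height 4 becomes dimension q * q; both require a transport.
  det≢0 : ¬ (residue det 1 ≡ + 0 [mod ℓ ])
  det≢0 = Height.determinant≢0 ℓ ℓ-prime q 0<q (reduced-[ℓ] ℓ F)
    (λ i → subst (λ m → residue (γ i (0 ∷ 0 ∷ [])) 1 ≡ + 0 [mod m ]) (ℕ.*-identityʳ ℓ) (γ-0 i 1))
    (proj₁ exponent)
    (subst (QuotientHasDimension (𝔽 ℓ) (reduced-[ℓ] ℓ F)) (ℕ.^-distribˡ-+-* ℓ 2 2) height)

  ι-det : ι det ≈ κ zero Q₀ * κ (suc zero) Q₁ - κ zero Q₁ * κ (suc zero) Q₀
  ι-det = trans (ι.+-homo (γ zero Q₀ ℤ_ℓ.* γ (suc zero) Q₁) (ℤ_ℓ.- (γ zero Q₁ ℤ_ℓ.* γ (suc zero) Q₀))) (+-cong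
    (ι.*-homo (γ zero Q₀) (γ (suc zero) Q₁))
    (trans (ι.-‿homo (γ zero Q₁ ℤ_ℓ.* γ (suc zero) Q₀)) (-‿cong (ι.*-homo (γ zero Q₁) (γ (suc zero) Q₀)))))

  torsion-root : ∀ P → IsTorsion V F ℓ P → Root (coord P)
  torsion-root P (O , O≈0 , ℓP≡O) i t = at (≤-natural t)
    where
    -- `multiple-value` speaks of successors, so ℓ is generalised to m before it is matched.
    value : ∀ m → m ≡ ℓ → Multiple V F m P O → HasValue V (multiplication m i) (coord P) (coord O i)
    value zero    0≡ℓ _ = contradiction (subst (1 <_) (≡.sym 0≡ℓ) 1<ℓ) λ ()
    value (suc m) _   p = Values.multiple-value V F m P O p i
    at : ∃[ M ] t ℚ.≤ (+ M) ℚ./ 1 → Eventually (λ N → Ge t (partial i (coord P) N))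
    at (M , t≤M) = proj₁ close , λ N N₀≤N → ge-trans t≤M (ge-cong (negate N) (ge-neg (proj₂ close N N₀≤N)))
      where
      close : Eventually (λ N → Ge ((+ M) ℚ./ 1) (coord O i - partialSum V (multiplication ℓ i) (coord P) N))
      close = value ℓ ≡.refl ℓP≡O M
      negate : ∀ N → - (coord O i - partial i (coord P) N) ≈ partial i (coord P) N
      negate N = trans (⁻¹-anti-homo‿- (coord O i) (partial i (coord P) N))
        (trans (+-congˡ (-‿cong (O≈0 i))) (x-0≈x _))

  module _ (σ : Gal K) (wild : IsWild V σ) where
    open Wild V σ wild
    open Gal σ
    open ListSum K-ring using (∑-cong)

    -- σ commutes with each finite partial sum, since it fixes the coefficients, and by `ge-act` it
    -- preserves the bounds on them.
    act-root : ∀ {x} → Root x → Root (act ∘ x)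
    act-root {x} root i t = proj₁ (root i t) , λ N N₀≤N → ge-cong (act-partial N) (ge-act (proj₂ (root i t) N N₀≤N))
      where
      module σ = RingMorphisms.IsRingIsomorphism iso
      act-partial : ∀ N → act (partial i x N) ≈ partial i (act ∘ x) N
      act-partial N = trans (act-∑ (box 2 N) _)
        (∑-cong (box 2 N) λ α → trans (σ.*-homo _ _) (*-cong (act-ι (γ i α)) (act-monomial x α)))

    open Minimum V

    fixed : ∀ P → IsTorsion V F ℓ P → ∀ i → act (coord P i) ≈ coord P i
    fixed P torsion = at (minimum x)
      where
      x : Vector Carrier 2
      x = coord P
      root : Root x
      root = torsion-root P torsion
      at : (∀ i → x i ≈ 0#) ⊎ ∃[ j ] ∃[ μ ] v (x j) ≡ [ μ ] × (∀ i → Ge μ (x i)) → ∀ i → act (x i) ≈ x i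
      at (inj₁ x≈0) i = trans (σ.⟦⟧-cong (x≈0 i)) (trans σ.0#-homo (sym (x≈0 i)))
        where module σ = RingMorphisms.IsRingIsomorphism iso
      at (inj₂ (j , μ , vxⱼ≡μ , x≥μ)) = moved (minimum λ i → act (x i) - x i)
        where
        0<μ : 0ℚ ℚ.< μ
        0<μ = gt⇒< vxⱼ≡μ (positive P j)
        moved : (∀ i → act (x i) - x i ≈ 0#) ⊎ ∃[ k ] ∃[ δ ] v (act (x k) - x k) ≡ [ δ ] × (∀ i → Ge δ (act (x i) - x i)) →
                ∀ i → act (x i) ≈ x i
        moved (inj₁ d≈0) i = x∙y⁻¹≈ε⇒x≈y _ _ (d≈0 i)
        moved (inj₂ (k , δ , vdₖ≡δ , d≥δ)) = ⊥-elim (Close.contradictory root (act-root {x} root)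
          -- δ > μ is tested at the coordinate k that attains δ: there x k has valuation at least μ,
          -- and wildness makes the difference strictly better.
          0<μ (gt⇒< vdₖ≡δ (gt-moved (x≥μ k)))
          (Bound.bound (ι det) ι-det (λ {t} {y} → gt-ι-cancel ℓ-prime det det≢0) root 0<μ x≥μ j vxⱼ≡μ)
          x≥μ (λ i → ge-act (x≥μ i)) d≥δ k vdₖ≡δ)

theorem4p6 : ∀ (ℓ : ℕ) → Prime ℓ → 2 < ℓ →
    (F : FormalGroupLaw (ℤₗ ℓ) 2) → Symmetric F → HasHeight ℓ F 4 → HasExponent ℓ F 2 →
    ∀ {c e : Level} (K : AlgebraicClosure ℓ c e) (V : Valuation K) →
    (σ : Gal K) → IsWild V σ →
    (P : Point V 2) → IsTorsion V F ℓ P →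
    ∀ i → AlgebraicClosure._≈_ K (Gal.act σ (coord P i)) (coord P i)
theorem4p6 ℓ ℓ-prime _ F _ height exponent K V σ wild P torsion =
  Torsion.fixed ℓ ℓ-prime F height exponent V σ wild P torsion
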